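{- Let $t\ge 2$ be an integer and let $\kappa\ge 1$ be a real number. For positive integers $r,s$ let $P^t_{r,s}$ be the number of $t$-cores $\lambda$ with $\ell(\lambda)\le r$ and $\lambda_1\le s$. As $r,s\to\infty$ such that $s/r\to\kappa$, $$\lim_{r,s\to\infty}\frac{P^t_{r,s}}{r^{t-1}}=\frac{A(t,\kappa)}{t^{t-1}},$$ where $$A(t,\kappa)=\frac{1}{(t-1)!}\sum_{j=0}^{\left\lfloor \frac{t}{\kappa+1}\right\rfloor}(-1)^j\binom{t}{j}\bigl(t-(1+\kappa)j\bigr)^{t-1}.$$
   Context: A partition $\lambda=(\lambda_1\ge\lambda_2\ge\cdots)$ is a weakly decreasing finite sequence of positive integers (possibly empty); $\ell(\lambda)$ is its number of parts, and $\lambda_1=0$ if $\lambda$ is empty. A rim-hook of $\lambda$ is a connected skew shape $\lambda/\mu$ (with $\mu\subseteq\lambda$ a partition) containing no $2\times 2$ block of boxes; a $t$-rim hook is a rim-hook with exactly $t$ boxes. A partition is a $t$-core if no $t$-rim hook can be removed from it so as to leave the Young diagram of a partition. The limit means: for all sequences of positive integers $(r_k),(s_k)$ with $r_k\to\infty$, $s_k\to\infty$ and $s_k/r_k\to\kappa$, the quantity $P^t_{r_k,s_k}/r_k^{t-1}$ converges to the stated value. -}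

module Defs where

open import Data.Empty using (⊥-elim)
open import Data.Integer as ℤ using (+_)
open import Data.List using (List; []; _∷_; length; map; concatMap; filter; upTo; drop)
import Data.List.Properties as Listₚ
open import Data.List.Membership.Propositional using (_∈_; find; lose)
open import Data.List.Membership.Propositional.Properties
  using (∈-map⁺; ∈-map⁻; ∈-concatMap⁺; ∈-concatMap⁻; ∈-upTo⁺; ∈-upTo⁻)
open import Data.List.Relation.Unary.All as All using (All; []; _∷_)
import Data.List.Membership.DecPropositional as DecMembership
open import Data.List.Relation.Binary.Disjoint.Propositional using (Disjoint)
open import Data.List.Relation.Unary.AllPairs as AllPairs using ([]; _∷_)
import Data.List.Relation.Unary.AllPairs.Properties as AllPairsₚ
import Data.List.Relation.Unary.All.Properties as Allₚ
open import Data.List.Relation.Unary.Unique.Propositional using (Unique)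
import Data.List.Relation.Unary.Unique.Propositional.Properties as Uniqueₚ
open import Data.List.Relation.Unary.Any as Any using (here; there)
open import Data.List.Relation.Unary.Linked as Linked using (Linked; []; [-]; _∷_)
open import Data.Nat as ℕ using (ℕ; zero; suc; _!)
open import Data.Nat.Combinatorics using (_C_)
import Data.Nat.Properties as ℕₚ
open import Data.Nat.Properties using (_!≢0)
open import Data.Product using (∃; _×_; _,_; proj₁; proj₂)
import Data.Product.Properties as Productₚ
open import Data.Rational as ℚ using (ℚ; 0ℚ; 1ℚ; ½)
import Data.Rational.Properties as ℚₚ
open import Data.Rational.Solver using (module +-*-Solver)
open import Data.Sum using (_⊎_; inj₁; inj₂)
open import Level using (0ℓ)
open import Function using (_∘_)
open import Relation.Binary using (Rel; Decidable)
open import Relation.Binary.Construct.Closure.ReflexiveTransitive using (Star; ε; _◅_; _◅◅_)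
open import Relation.Binary.PropositionalEquality
  using (_≡_; _≢_; refl; sym; trans; cong; subst)
open import Relation.Nullary using (Dec; yes; ¬_)
open import Relation.Nullary.Decidable using (map′; _×-dec_; _⊎-dec_; ¬?)

-- A real number is a Cauchy sequence of rationals; as usual for constructive
-- reals, distinct sequences may represent the same number.

IsCauchy : (ℕ → ℚ) → Set
IsCauchy a = ∀ δ → 0ℚ ℚ.< δ →
  ∃ λ N → ∀ m n → N ℕ.≤ m → N ℕ.≤ n → ℚ.∣ a m ℚ.- a n ∣ ℚ.< δ

record ℝ : Set where
  constructor mkℝ
  field
    seq    : ℕ → ℚ
    cauchy : IsCauchy seq

open ℝ public

module CauchyLemmas where
  open +-*-Solver
  open ℚₚ.≤-Reasoning

  half>0 : ∀ {δ} → 0ℚ ℚ.< δ → 0ℚ ℚ.< ½ ℚ.* δ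
  half>0 {δ} 0<δ = subst (ℚ._< ½ ℚ.* δ) (ℚₚ.*-zeroʳ ½) (ℚₚ.*-monoʳ-<-pos ½ 0<δ)

  half+half : ∀ δ → ½ ℚ.* δ ℚ.+ ½ ℚ.* δ ≡ δ
  half+half δ = trans (sym (ℚₚ.*-distribʳ-+ δ ½ ½)) (ℚₚ.*-identityˡ δ)

  ∣-∣-sym : ∀ x y → ℚ.∣ x ℚ.- y ∣ ≡ ℚ.∣ y ℚ.- x ∣
  ∣-∣-sym x y = trans (sym (ℚₚ.∣-p∣≡∣p∣ (x ℚ.- y)))
    (cong ℚ.∣_∣ (solve 2 (λ x y → :- (x :+ :- y) := y :+ :- x) refl x y))

  ∣x∣≤∣x-y∣+∣y∣ : ∀ x y → ℚ.∣ x ∣ ℚ.≤ ℚ.∣ x ℚ.- y ∣ ℚ.+ ℚ.∣ y ∣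
  ∣x∣≤∣x-y∣+∣y∣ x y = begin
    ℚ.∣ x ∣                    ≡⟨ cong ℚ.∣_∣ (solve 2 (λ x y → x := (x :+ :- y) :+ y) refl x y) ⟩
    ℚ.∣ (x ℚ.- y) ℚ.+ y ∣      ≤⟨ ℚₚ.∣p+q∣≤∣p∣+∣q∣ (x ℚ.- y) y ⟩
    ℚ.∣ x ℚ.- y ∣ ℚ.+ ℚ.∣ y ∣  ∎

  ∣x∣-∣y∣≤∣x-y∣ : ∀ x y → ℚ.∣ x ∣ ℚ.- ℚ.∣ y ∣ ℚ.≤ ℚ.∣ x ℚ.- y ∣
  ∣x∣-∣y∣≤∣x-y∣ x y = begin
    ℚ.∣ x ∣ ℚ.- ℚ.∣ y ∣
      ≤⟨ ℚₚ.+-monoˡ-≤ (ℚ.- ℚ.∣ y ∣) (∣x∣≤∣x-y∣+∣y∣ x y) ⟩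
    (ℚ.∣ x ℚ.- y ∣ ℚ.+ ℚ.∣ y ∣) ℚ.- ℚ.∣ y ∣
      ≡⟨ solve 2 (λ u v → (u :+ v) :+ :- v := u) refl ℚ.∣ x ℚ.- y ∣ ℚ.∣ y ∣ ⟩
    ℚ.∣ x ℚ.- y ∣ ∎

  ∣∣x∣-∣y∣∣≤∣x-y∣ : ∀ x y → ℚ.∣ ℚ.∣ x ∣ ℚ.- ℚ.∣ y ∣ ∣ ℚ.≤ ℚ.∣ x ℚ.- y ∣
  ∣∣x∣-∣y∣∣≤∣x-y∣ x y with ℚₚ.∣p∣≡p∨∣p∣≡-p (ℚ.∣ x ∣ ℚ.- ℚ.∣ y ∣)
  ... | inj₁ e = begin
    ℚ.∣ ℚ.∣ x ∣ ℚ.- ℚ.∣ y ∣ ∣  ≡⟨ e ⟩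
    ℚ.∣ x ∣ ℚ.- ℚ.∣ y ∣        ≤⟨ ∣x∣-∣y∣≤∣x-y∣ x y ⟩
    ℚ.∣ x ℚ.- y ∣              ∎
  ... | inj₂ e = begin
    ℚ.∣ ℚ.∣ x ∣ ℚ.- ℚ.∣ y ∣ ∣  ≡⟨ e ⟩
    ℚ.- (ℚ.∣ x ∣ ℚ.- ℚ.∣ y ∣)
      ≡⟨ solve 2 (λ u v → :- (u :+ :- v) := v :+ :- u) refl ℚ.∣ x ∣ ℚ.∣ y ∣ ⟩
    ℚ.∣ y ∣ ℚ.- ℚ.∣ x ∣        ≤⟨ ∣x∣-∣y∣≤∣x-y∣ y x ⟩
    ℚ.∣ y ℚ.- x ∣              ≡⟨ ∣-∣-sym y x ⟩
    ℚ.∣ x ℚ.- y ∣              ∎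

  const-cauchy : ∀ q → IsCauchy (λ _ → q)
  const-cauchy q δ 0<δ = 0 , λ _ _ _ _ →
    subst (ℚ._< δ) (sym (cong ℚ.∣_∣ (ℚₚ.+-inverseʳ q))) 0<δ

  +-cauchy : ∀ {a b} → IsCauchy a → IsCauchy b → IsCauchy (λ n → a n ℚ.+ b n)
  +-cauchy {a} {b} ca cb δ 0<δ with ca _ (half>0 0<δ) | cb _ (half>0 0<δ)
  ... | M , p | N , q = M ℕ.⊔ N , λ m n ≤m ≤n → begin-strict
    ℚ.∣ (a m ℚ.+ b m) ℚ.- (a n ℚ.+ b n) ∣
      ≡⟨ cong ℚ.∣_∣ (solve 4 (λ x y z w → (x :+ y) :+ :- (z :+ w) :=
           (x :+ :- z) :+ (y :+ :- w)) refl (a m) (b m) (a n) (b n)) ⟩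
    ℚ.∣ (a m ℚ.- a n) ℚ.+ (b m ℚ.- b n) ∣
      ≤⟨ ℚₚ.∣p+q∣≤∣p∣+∣q∣ (a m ℚ.- a n) (b m ℚ.- b n) ⟩
    ℚ.∣ a m ℚ.- a n ∣ ℚ.+ ℚ.∣ b m ℚ.- b n ∣
      <⟨ ℚₚ.+-mono-< (p m n (ℕₚ.m⊔n≤o⇒m≤o M N ≤m) (ℕₚ.m⊔n≤o⇒m≤o M N ≤n))
                     (q m n (ℕₚ.m⊔n≤o⇒n≤o M N ≤m) (ℕₚ.m⊔n≤o⇒n≤o M N ≤n)) ⟩
    ½ ℚ.* δ ℚ.+ ½ ℚ.* δ  ≡⟨ half+half δ ⟩
    δ ∎

  neg-cauchy : ∀ {a} → IsCauchy a → IsCauchy (λ n → ℚ.- a n)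
  neg-cauchy {a} ca δ 0<δ with ca δ 0<δ
  ... | N , p = N , λ m n ≤m ≤n → subst (ℚ._< δ)
    (trans (sym (ℚₚ.∣-p∣≡∣p∣ (a m ℚ.- a n)))
      (cong ℚ.∣_∣ (ℚₚ.neg-distrib-+ (a m) (ℚ.- a n))))
    (p m n ≤m ≤n)

  ∣∣-cauchy : ∀ {a} → IsCauchy a → IsCauchy (λ n → ℚ.∣ a n ∣)
  ∣∣-cauchy {a} ca δ 0<δ with ca δ 0<δ
  ... | N , p = N , λ m n ≤m ≤n →
    ℚₚ.≤-<-trans (∣∣x∣-∣y∣∣≤∣x-y∣ (a m) (a n)) (p m n ≤m ≤n)

  bounded : ∀ {a} → IsCauchy a →
    ∃ λ B → 0ℚ ℚ.< B × ∃ λ N → ∀ n → N ℕ.≤ n → ℚ.∣ a n ∣ ℚ.≤ B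
  bounded {a} ca with ca 1ℚ (ℚₚ.positive⁻¹ 1ℚ)
  ... | N , p = 1ℚ ℚ.+ ℚ.∣ a N ∣
    , ℚₚ.+-mono-<-≤ (ℚₚ.positive⁻¹ 1ℚ) (ℚₚ.0≤∣p∣ (a N))
    , N , λ n N≤n → begin
      ℚ.∣ a n ∣                        ≤⟨ ∣x∣≤∣x-y∣+∣y∣ (a n) (a N) ⟩
      ℚ.∣ a n ℚ.- a N ∣ ℚ.+ ℚ.∣ a N ∣
        ≤⟨ ℚₚ.+-monoˡ-≤ ℚ.∣ a N ∣ (ℚₚ.<⇒≤ (p n N N≤n ℕₚ.≤-refl)) ⟩
      1ℚ ℚ.+ ℚ.∣ a N ∣                 ∎

  quotient : ∀ c → 0ℚ ℚ.< c → ∀ δ → 0ℚ ℚ.< δ → ∃ λ γ → 0ℚ ℚ.< γ × c ℚ.* γ ≡ δ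
  quotient c 0<c δ 0<δ = (ℚ.1/ c) ℚ.* δ
    , subst (ℚ._< (ℚ.1/ c) ℚ.* δ) (ℚₚ.*-zeroʳ (ℚ.1/ c)) (ℚₚ.*-monoʳ-<-pos (ℚ.1/ c) 0<δ)
    , trans (sym (ℚₚ.*-assoc c (ℚ.1/ c) δ))
        (trans (cong (ℚ._* δ) (ℚₚ.*-inverseʳ c)) (ℚₚ.*-identityˡ δ))
    where
    instance
      _ = ℚ.positive 0<c
      _ = ℚₚ.pos⇒nonZero c
      _ = ℚₚ.1/pos⇒pos c

  product-split : ∀ x y z w →
    x ℚ.* y ℚ.- z ℚ.* w ≡ x ℚ.* (y ℚ.- w) ℚ.+ w ℚ.* (x ℚ.- z)
  product-split = solve 4 (λ x y z w → (x :* y) :+ :- (z :* w) :=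
    (x :* (y :+ :- w)) :+ (w :* (x :+ :- z))) refl

  ∣x*y∣<K*γ : ∀ {K γ} → 0ℚ ℚ.< K → ∀ x y → ℚ.∣ x ∣ ℚ.≤ K → ℚ.∣ y ∣ ℚ.< γ →
    ℚ.∣ x ℚ.* y ∣ ℚ.< K ℚ.* γ
  ∣x*y∣<K*γ {K} {γ} 0<K x y x≤ y< = begin-strict
    ℚ.∣ x ℚ.* y ∣        ≡⟨ ℚₚ.∣p*q∣≡∣p∣*∣q∣ x y ⟩
    ℚ.∣ x ∣ ℚ.* ℚ.∣ y ∣
      ≤⟨ ℚₚ.*-monoʳ-≤-nonNeg ℚ.∣ y ∣ {{ℚₚ.∣-∣-nonNeg y}} x≤ ⟩
    K ℚ.* ℚ.∣ y ∣        <⟨ ℚₚ.*-monoʳ-<-pos K {{ℚ.positive 0<K}} y< ⟩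
    K ℚ.* γ              ∎

  product-estimate : ∀ {A B γ} → 0ℚ ℚ.< A → 0ℚ ℚ.< B → ∀ x y z w →
    ℚ.∣ x ∣ ℚ.≤ A → ℚ.∣ w ∣ ℚ.≤ B → ℚ.∣ x ℚ.- z ∣ ℚ.< γ → ℚ.∣ y ℚ.- w ∣ ℚ.< γ →
    ℚ.∣ x ℚ.* y ℚ.- z ℚ.* w ∣ ℚ.< (A ℚ.+ B) ℚ.* γ
  product-estimate {A} {B} {γ} 0<A 0<B x y z w x≤ w≤ xz< yw< = begin-strict
    ℚ.∣ x ℚ.* y ℚ.- z ℚ.* w ∣  ≡⟨ cong ℚ.∣_∣ (product-split x y z w) ⟩
    ℚ.∣ x ℚ.* (y ℚ.- w) ℚ.+ w ℚ.* (x ℚ.- z) ∣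
      ≤⟨ ℚₚ.∣p+q∣≤∣p∣+∣q∣ (x ℚ.* (y ℚ.- w)) (w ℚ.* (x ℚ.- z)) ⟩
    ℚ.∣ x ℚ.* (y ℚ.- w) ∣ ℚ.+ ℚ.∣ w ℚ.* (x ℚ.- z) ∣
      <⟨ ℚₚ.+-mono-< (∣x*y∣<K*γ 0<A x (y ℚ.- w) x≤ yw<) (∣x*y∣<K*γ 0<B w (x ℚ.- z) w≤ xz<) ⟩
    A ℚ.* γ ℚ.+ B ℚ.* γ        ≡⟨ sym (ℚₚ.*-distribʳ-+ γ A B) ⟩
    (A ℚ.+ B) ℚ.* γ            ∎

  *-cauchy : ∀ {a b} → IsCauchy a → IsCauchy b → IsCauchy (λ n → a n ℚ.* b n)
  *-cauchy {a} {b} ca cb δ 0<δ =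
    let A , 0<A , N₁ , ≤A = bounded ca
        B , 0<B , N₂ , ≤B = bounded cb
        γ , 0<γ , eq      = quotient (A ℚ.+ B) (ℚₚ.+-mono-< 0<A 0<B) δ 0<δ
        N₃ , p            = ca γ 0<γ
        N₄ , q            = cb γ 0<γ
        N₁₂               = N₁ ℕ.⊔ N₂
        N₃₄               = N₃ ℕ.⊔ N₄
    in N₁₂ ℕ.⊔ N₃₄ , λ m n ≤m ≤n →
    subst (ℚ.∣ a m ℚ.* b m ℚ.- a n ℚ.* b n ∣ ℚ.<_) eq
      (product-estimate 0<A 0<B (a m) (b m) (a n) (b n)
        (≤A m (ℕₚ.m⊔n≤o⇒m≤o N₁ N₂ (ℕₚ.m⊔n≤o⇒m≤o N₁₂ N₃₄ ≤m)))
        (≤B n (ℕₚ.m⊔n≤o⇒n≤o N₁ N₂ (ℕₚ.m⊔n≤o⇒m≤o N₁₂ N₃₄ ≤n)))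
        (p m n (ℕₚ.m⊔n≤o⇒m≤o N₃ N₄ (ℕₚ.m⊔n≤o⇒n≤o N₁₂ N₃₄ ≤m))
               (ℕₚ.m⊔n≤o⇒m≤o N₃ N₄ (ℕₚ.m⊔n≤o⇒n≤o N₁₂ N₃₄ ≤n)))
        (q m n (ℕₚ.m⊔n≤o⇒n≤o N₃ N₄ (ℕₚ.m⊔n≤o⇒n≤o N₁₂ N₃₄ ≤m))
               (ℕₚ.m⊔n≤o⇒n≤o N₃ N₄ (ℕₚ.m⊔n≤o⇒n≤o N₁₂ N₃₄ ≤n))))

  max-pos : ∀ {δ} → 0ℚ ℚ.< δ → ∀ x → ℚ.Positive (x ℚ.⊔ δ)
  max-pos {δ} 0<δ x = ℚ.positive (ℚₚ.<-≤-trans 0<δ (ℚₚ.p≤q⊔p x δ))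

  1/max : ∀ {δ} → 0ℚ ℚ.< δ → ℚ → ℚ
  1/max {δ} 0<δ x = (ℚ.1/ (x ℚ.⊔ δ)) {{ℚₚ.pos⇒nonZero (x ℚ.⊔ δ) {{max-pos 0<δ x}}}}

  1/max-inverse : ∀ {δ} (0<δ : 0ℚ ℚ.< δ) x → 1/max 0<δ x ℚ.* (x ℚ.⊔ δ) ≡ 1ℚ
  1/max-inverse {δ} 0<δ x = ℚₚ.*-inverseˡ (x ℚ.⊔ δ) {{ℚₚ.pos⇒nonZero (x ℚ.⊔ δ) {{max-pos 0<δ x}}}}

  1/max-cauchy : ∀ {a δ} (0<δ : 0ℚ ℚ.< δ) → (∃ λ N → ∀ n → N ℕ.≤ n → δ ℚ.≤ a n) →
    IsCauchy a → IsCauchy (λ n → 1/max 0<δ (a n))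
  1/max-cauchy {a} {δ} 0<δ (N , δ≤) ca γ 0<γ with ca ((δ ℚ.* δ) ℚ.* γ) 0<δδγ
    where
    0<δδγ : 0ℚ ℚ.< (δ ℚ.* δ) ℚ.* γ
    0<δδγ = ℚₚ.positive⁻¹ _ {{ℚₚ.pos*pos⇒pos (δ ℚ.* δ)
      {{ℚₚ.pos*pos⇒pos δ {{ℚ.positive 0<δ}} δ {{ℚ.positive 0<δ}}}} γ {{ℚ.positive 0<γ}}}}
  ... | M , p = N ℕ.⊔ M , λ m n ≤m ≤n →
    estimate (δ≤ m (ℕₚ.m⊔n≤o⇒m≤o N M ≤m)) (δ≤ n (ℕₚ.m⊔n≤o⇒m≤o N M ≤n))
             (p m n (ℕₚ.m⊔n≤o⇒n≤o N M ≤m) (ℕₚ.m⊔n≤o⇒n≤o N M ≤n))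
    where
    inverse : ∀ {x} → δ ℚ.≤ x → 1/max 0<δ x ℚ.* x ≡ 1ℚ
    inverse {x} δ≤x = subst (λ z → 1/max 0<δ x ℚ.* z ≡ 1ℚ) (ℚₚ.p≥q⇒p⊔q≡p δ≤x) (1/max-inverse 0<δ x)

    estimate : ∀ {x y} → δ ℚ.≤ x → δ ℚ.≤ y → ℚ.∣ x ℚ.- y ∣ ℚ.< (δ ℚ.* δ) ℚ.* γ →
      ℚ.∣ 1/max 0<δ x ℚ.- 1/max 0<δ y ∣ ℚ.< γ
    estimate {x} {y} δ≤x δ≤y x-y< =
      ℚₚ.*-cancelˡ-<-nonNeg (δ ℚ.* δ) {{ℚₚ.pos⇒nonNeg (δ ℚ.* δ)}} (begin-strict
      (δ ℚ.* δ) ℚ.* ℚ.∣ u ℚ.- v ∣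
        ≤⟨ ℚₚ.*-monoʳ-≤-nonNeg ℚ.∣ u ℚ.- v ∣ {{ℚₚ.∣-∣-nonNeg (u ℚ.- v)}} δδ≤xy ⟩
      (x ℚ.* y) ℚ.* ℚ.∣ u ℚ.- v ∣
        ≡⟨ cong (ℚ._* ℚ.∣ u ℚ.- v ∣) (sym (ℚₚ.0≤p⇒∣p∣≡p
             (ℚₚ.≤-trans (ℚₚ.<⇒≤ (ℚₚ.positive⁻¹ (δ ℚ.* δ))) δδ≤xy))) ⟩
      ℚ.∣ x ℚ.* y ∣ ℚ.* ℚ.∣ u ℚ.- v ∣   ≡⟨ sym (ℚₚ.∣p*q∣≡∣p∣*∣q∣ (x ℚ.* y) (u ℚ.- v)) ⟩
      ℚ.∣ (x ℚ.* y) ℚ.* (u ℚ.- v) ∣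
        ≡⟨ cong ℚ.∣_∣ (trans (solve 4 (λ x y u v → (x :* y) :* (u :+ :- v) :=
             ((u :* x) :* y) :+ :- ((v :* y) :* x)) refl x y u v)
             (trans (cong (λ z → z ℚ.* y ℚ.- (v ℚ.* y) ℚ.* x) (inverse δ≤x))
             (trans (cong (λ z → 1ℚ ℚ.* y ℚ.- z ℚ.* x) (inverse δ≤y))
             (solve 2 (λ x y → con 1ℚ :* y :+ :- (con 1ℚ :* x) := y :+ :- x) refl x y)))) ⟩
      ℚ.∣ y ℚ.- x ∣                     ≡⟨ ∣-∣-sym y x ⟩
      ℚ.∣ x ℚ.- y ∣                     <⟨ x-y< ⟩
      (δ ℚ.* δ) ℚ.* γ                   ∎)
      where
      u = 1/max 0<δ x
      v = 1/max 0<δ y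
      instance
        _ = ℚ.positive 0<δ
        _ = ℚₚ.pos⇒nonNeg δ
        _ = ℚₚ.pos*pos⇒pos δ δ
      δδ≤xy : δ ℚ.* δ ℚ.≤ x ℚ.* y
      δδ≤xy = ℚₚ.≤-trans (ℚₚ.*-monoʳ-≤-nonNeg δ δ≤x)
        (ℚₚ.*-monoˡ-≤-nonNeg x {{ℚ.nonNegative (ℚₚ.≤-trans (ℚₚ.<⇒≤ 0<δ) δ≤x)}} δ≤y)

open CauchyLemmas

infixl 6 _+ᴿ_ _-ᴿ_
infixl 7 _*ᴿ_ _/ᴿ_[_] _/ℕ_
infixr 8 _^ᴿ_ -ᴿ_
infix  4 _<ᴿ_ _≤ᴿ_ _⟶_

fromℚ : ℚ → ℝ
fromℚ q = mkℝ (λ _ → q) (const-cauchy q)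

fromℕ : ℕ → ℝ
fromℕ n = fromℚ (+ n ℚ./ 1)

0ᴿ 1ᴿ : ℝ
0ᴿ = fromℕ 0
1ᴿ = fromℕ 1

_+ᴿ_ : ℝ → ℝ → ℝ
x +ᴿ y = mkℝ (λ n → seq x n ℚ.+ seq y n) (+-cauchy {seq x} {seq y} (cauchy x) (cauchy y))

-ᴿ_ : ℝ → ℝ
-ᴿ x = mkℝ (λ n → ℚ.- seq x n) (neg-cauchy {seq x} (cauchy x))

_-ᴿ_ : ℝ → ℝ → ℝ
x -ᴿ y = x +ᴿ (-ᴿ y)

_*ᴿ_ : ℝ → ℝ → ℝ
x *ᴿ y = mkℝ (λ n → seq x n ℚ.* seq y n) (*-cauchy {seq x} {seq y} (cauchy x) (cauchy y))

∣_∣ᴿ : ℝ → ℝ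
∣ x ∣ᴿ = mkℝ (λ n → ℚ.∣ seq x n ∣) (∣∣-cauchy {seq x} (cauchy x))

_^ᴿ_ : ℝ → ℕ → ℝ
x ^ᴿ zero  = 1ᴿ
x ^ᴿ suc n = x *ᴿ (x ^ᴿ n)

_<ᴿ_ : ℝ → ℝ → Set
x <ᴿ y = ∃ λ δ → 0ℚ ℚ.< δ × ∃ λ N → ∀ n → N ℕ.≤ n → seq x n ℚ.+ δ ℚ.≤ seq y n

_≤ᴿ_ : ℝ → ℝ → Set
x ≤ᴿ y = ∀ δ → 0ℚ ℚ.< δ → ∃ λ N → ∀ n → N ℕ.≤ n → seq x n ℚ.≤ seq y n ℚ.+ δ

-- The cut-off at δ only alters the finitely many terms of y that are below δ;
-- up to equality of reals the result is independent of the witness 0<y.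
_/ᴿ_[_] : (x y : ℝ) → 0ᴿ <ᴿ y → ℝ
x /ᴿ y [ δ , 0<δ , N , δ≤ ] = x *ᴿ mkℝ (λ n → 1/max 0<δ (seq y n))
  (1/max-cauchy {seq y} 0<δ (N , λ n N≤n → subst (ℚ._≤ seq y n) (ℚₚ.+-identityˡ δ) (δ≤ n N≤n)) (cauchy y))

_/ℕ_ : ℝ → (n : ℕ) → .{{ℕ.NonZero n}} → ℝ
x /ℕ n = x *ᴿ fromℚ (+ 1 ℚ./ n)

-- The upper limit is included: Σ[ n ] f = f 0 + f 1 + ⋯ + f n.
Σ[_] : ℕ → (ℕ → ℝ) → ℝ
Σ[ zero  ] f = f 0
Σ[ suc n ] f = Σ[ n ] f +ᴿ f (suc n)

-- A relation, since the floor of a constructive real is not computable.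
IsFloor : ℝ → ℕ → Set
IsFloor x n = fromℕ n ≤ᴿ x × x <ᴿ fromℕ (suc n)

_⟶_ : (ℕ → ℝ) → ℝ → Set
a ⟶ L = ∀ δ → 0ᴿ <ᴿ δ → ∃ λ N → ∀ k → N ℕ.≤ k → ∣ a k -ᴿ L ∣ᴿ <ᴿ δ

_⟶∞ : (ℕ → ℕ) → Set
a ⟶∞ = ∀ M → ∃ λ N → ∀ k → N ℕ.≤ k → M ℕ.≤ a k

IsPartition : List ℕ → Set
IsPartition lam = Linked ℕ._≥_ lam × All (0 ℕ.<_) lam

-- Rows are numbered from 0, and missing parts are 0; the largest part is
-- part lam 0.
part : List ℕ → ℕ → ℕ
part []       _       = 0
part (x ∷ _)  zero    = x
part (_ ∷ xs) (suc i) = part xs i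

Box : Set
Box = ℕ × ℕ

Adjacent : Rel Box 0ℓ
Adjacent (i , j) (k , l) = ℕ.∣ i - k ∣ ℕ.+ ℕ.∣ j - l ∣ ≡ 1

AdjacentIn : List Box → Rel Box 0ℓ
AdjacentIn bs b c = b ∈ bs × c ∈ bs × Adjacent b c

Connected : List Box → Set
Connected bs = ∀ b c → b ∈ bs → c ∈ bs → Star (AdjacentIn bs) b c

_⊆ᴾ_ : List ℕ → List ℕ → Set
mu ⊆ᴾ lam = ∀ i → part mu i ℕ.≤ part lam i

-- For mu ⊆ᴾ lam, the boxes (i , j) with mu_i ≤ j < lam_i, each listed once.
skewBoxes : List ℕ → List ℕ → List Box
skewBoxes lam mu = concatMap
  (λ i → map (λ d → i , part mu i ℕ.+ d) (upTo (part lam i ℕ.∸ part mu i)))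
  (upTo (length lam))

record IsRimHook (t : ℕ) (lam mu : List ℕ) : Set where
  field
    contained : mu ⊆ᴾ lam
    size      : length (skewBoxes lam mu) ≡ t
    connected : Connected (skewBoxes lam mu)
    no2×2     : ∀ i j → let bs = skewBoxes lam mu in
                ¬ ((i , j) ∈ bs × (i , suc j) ∈ bs × (suc i , j) ∈ bs × (suc i , suc j) ∈ bs)

IsCore : ℕ → List ℕ → Set
IsCore t lam = ∀ mu → IsPartition mu → ¬ IsRimHook t lam mu

-- All partitions with at most r parts and largest part at most s.
partitionsInBox : ℕ → ℕ → List (List ℕ)
partitionsInBox zero    s = [] ∷ []
partitionsInBox (suc r) s = [] ∷
  concatMap (λ a → map (suc a ∷_) (partitionsInBox r (suc a))) (upTo s)

∈-partitionsInBox⁺ : ∀ {r s lam} → IsPartition lam → length lam ℕ.≤ r → part lam 0 ℕ.≤ s →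
  lam ∈ partitionsInBox r s
∈-partitionsInBox⁺ {zero}  {lam = []} _ _ _ = here refl
∈-partitionsInBox⁺ {suc r} {lam = []} _ _ _ = here refl
∈-partitionsInBox⁺ {suc r} {s} {suc a ∷ xs} (dec , _ ∷ pos) (ℕ.s≤s len) a<s = there
  (∈-concatMap⁺ (λ b → map (suc b ∷_) (partitionsInBox r (suc b)))
    (lose (∈-upTo⁺ a<s)
      (∈-map⁺ (suc a ∷_) (∈-partitionsInBox⁺ (Linked.tail dec , pos) len (bound dec)))))
  where
  bound : ∀ {x ys} → Linked ℕ._≥_ (x ∷ ys) → part ys 0 ℕ.≤ x
  bound [-]     = ℕ.z≤n
  bound (p ∷ _) = p

∈-partitionsInBox⁻ : ∀ {r s lam} → lam ∈ partitionsInBox r s →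
  IsPartition lam × length lam ℕ.≤ r × part lam 0 ℕ.≤ s
∈-partitionsInBox⁻ {zero}  (here refl) = ([] , []) , ℕ.z≤n , ℕ.z≤n
∈-partitionsInBox⁻ {suc r} (here refl) = ([] , []) , ℕ.z≤n , ℕ.z≤n
∈-partitionsInBox⁻ {suc r} {s} (there p)
  with find (∈-concatMap⁻ (λ b → map (suc b ∷_) (partitionsInBox r (suc b))) {xs = upTo s} p)
... | a , a∈ , q with ∈-map⁻ (suc a ∷_) q
... | xs , xs∈ , refl with ∈-partitionsInBox⁻ {r} xs∈
... | (dec , pos) , len , bound =
  (cons xs dec bound , ℕ.s≤s ℕ.z≤n ∷ pos) , ℕ.s≤s len , ∈-upTo⁻ a∈
  where
  cons : ∀ {x} ys → Linked ℕ._≥_ ys → part ys 0 ℕ.≤ x → Linked ℕ._≥_ (x ∷ ys)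
  cons []      _   _ = [-]
  cons (_ ∷ _) dec p = p ∷ dec

partitionsInBox-unique : ∀ r s → Unique (partitionsInBox r s)
partitionsInBox-unique zero    s = [] ∷ []
partitionsInBox-unique (suc r) s =
  All.tabulate (λ p e → nonempty (subst (_∈ _) (sym e) p)) ∷
  Uniqueₚ.concat⁺
    (Allₚ.map⁺ (All.tabulate λ {a} _ →
      Uniqueₚ.map⁺ Listₚ.∷-injectiveʳ (partitionsInBox-unique r (suc a))))
    (AllPairsₚ.map⁺ (AllPairs.map disjoint (Uniqueₚ.upTo⁺ s)))
  where
  row : ℕ → List (List ℕ)
  row a = map (suc a ∷_) (partitionsInBox r (suc a))

  nonempty : ¬ [] ∈ concatMap row (upTo s)
  nonempty p with find (∈-concatMap⁻ row {xs = upTo s} p)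
  ... | a , _ , q with ∈-map⁻ (suc a ∷_) q
  ... | _ , _ , ()

  disjoint : ∀ {a b} → a ≢ b → Disjoint (row a) (row b)
  disjoint {a} {b} a≢b (p , q) with ∈-map⁻ (suc a ∷_) p | ∈-map⁻ (suc b ∷_) q
  ... | _ , _ , refl | _ , _ , e = a≢b (ℕₚ.suc-injective (Listₚ.∷-injectiveˡ e))

-- Reachability in a finite graph is decided by successively allowing more
-- vertices as intermediate stops.
module Reachability {A : Set} {E : Rel A 0ℓ} (_≟_ : Decidable (_≡_ {A = A})) (E? : Decidable E) where

  Via : List A → Rel A 0ℓ
  Via []       a b = a ≡ b ⊎ E a b
  Via (v ∷ vs) a b = Via vs a b ⊎ (Via vs a v × Via vs v b)

  via? : ∀ vs → Decidable (Via vs)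
  via? []       a b = (a ≟ b) ⊎-dec E? a b
  via? (v ∷ vs) a b = via? vs a b ⊎-dec (via? vs a v ×-dec via? vs v b)

  via⇒star : ∀ vs {a b} → Via vs a b → Star E a b
  via⇒star []       (inj₁ refl)    = ε
  via⇒star []       (inj₂ e)       = e ◅ ε
  via⇒star (v ∷ vs) (inj₁ p)       = via⇒star vs p
  via⇒star (v ∷ vs) (inj₂ (p , q)) = via⇒star vs p ◅◅ via⇒star vs q

  direct : ∀ vs {a b} → Via [] a b → Via vs a b
  direct []       p = p
  direct (v ∷ vs) p = inj₁ (direct vs p)

  join : ∀ {vs x} → x ∈ vs → ∀ {a b} → Via vs a x → Via vs x b → Via vs a b
  join {v ∷ vs} (here refl) p q = inj₂ (into p , from q)
    where
    into : ∀ {a} → Via (v ∷ vs) a v → Via vs a v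
    into (inj₁ p)       = p
    into (inj₂ (p , _)) = p
    from : ∀ {b} → Via (v ∷ vs) v b → Via vs v b
    from (inj₁ q)       = q
    from (inj₂ (_ , q)) = q
  join {v ∷ vs} (there x∈) (inj₁ p)       (inj₁ q)       = inj₁ (join x∈ p q)
  join {v ∷ vs} (there x∈) (inj₁ p)       (inj₂ (q , r)) = inj₂ (join x∈ p q , r)
  join {v ∷ vs} (there x∈) (inj₂ (o , p)) (inj₁ q)       = inj₂ (o , join x∈ p q)
  join {v ∷ vs} (there x∈) (inj₂ (o , _)) (inj₂ (_ , r)) = inj₂ (o , r)

  star⇒via : ∀ vs → (∀ {a b} → E a b → b ∈ vs) → ∀ {a b} → Star E a b → Via vs a b
  star⇒via vs E⊆vs ε       = direct vs (inj₁ refl)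
  star⇒via vs E⊆vs (e ◅ p) = join (E⊆vs e) (direct vs (inj₂ e)) (star⇒via vs E⊆vs p)

  star? : ∀ vs → (∀ {a b} → E a b → b ∈ vs) → Decidable (Star E)
  star? vs E⊆vs a b = map′ (via⇒star vs) (star⇒via vs E⊆vs) (via? vs a b)

_≟ᴮ_ : Decidable (_≡_ {A = Box})
_≟ᴮ_ = Productₚ.≡-dec ℕ._≟_ ℕ._≟_

_∈?_ : Decidable (_∈_ {A = Box})
_∈?_ = DecMembership._∈?_ _≟ᴮ_

adjacentIn? : ∀ bs → Decidable (AdjacentIn bs)
adjacentIn? bs b c = b ∈? bs ×-dec c ∈? bs ×-dec (_ ℕ.≟ 1)

connected? : ∀ bs → Dec (Connected bs)
connected? bs = map′
  (λ p _ _ b∈ c∈ → All.lookup (All.lookup p b∈) c∈)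
  (λ p → All.tabulate λ b∈ → All.tabulate λ c∈ → p _ _ b∈ c∈)
  (All.all? (λ b → All.all? (star? bs (λ e → proj₁ (proj₂ e)) b) bs) bs)
  where open Reachability _≟ᴮ_ (adjacentIn? bs)

_⊆ᴾ?_ : Decidable _⊆ᴾ_
[]       ⊆ᴾ? lam = yes λ _ → ℕ.z≤n
(x ∷ xs) ⊆ᴾ? lam = map′
  (λ { (p , q) zero → p ; (p , q) (suc i) → subst (part xs i ℕ.≤_) (part-drop lam i) (q i) })
  (λ p → p 0 , λ i → subst (part xs i ℕ.≤_) (sym (part-drop lam i)) (p (suc i)))
  ((x ℕ.≤? part lam 0) ×-dec (xs ⊆ᴾ? drop 1 lam))
  where
  part-drop : ∀ ys i → part (drop 1 ys) i ≡ part ys (suc i)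
  part-drop []       i = refl
  part-drop (y ∷ ys) i = refl

isRimHook? : ∀ t lam mu → Dec (IsRimHook t lam mu)
isRimHook? t lam mu = map′
  (λ { (c , s , k , n) → record
       { contained = c ; size = s ; connected = k
       ; no2×2 = λ i j p → All.lookup n (proj₁ p) p } })
  (λ h → let open IsRimHook h in
       contained , size , connected , All.tabulate λ { {i , j} _ → no2×2 i j })
  ((mu ⊆ᴾ? lam) ×-dec (length bs ℕ.≟ t) ×-dec connected? bs ×-dec
    All.all? (λ { (i , j) → ¬? ((i , j) ∈? bs ×-dec (i , suc j) ∈? bs ×-dec
                                (suc i , j) ∈? bs ×-dec (suc i , suc j) ∈? bs) }) bs)
  where
  bs = skewBoxes lam mu

isCore? : ∀ t lam → Dec (IsCore t lam)
isCore? t lam = map′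
  (λ none mu mu-partition h → let open IsRimHook h in none
    (lose (∈-partitionsInBox⁺ mu-partition (shorter mu lam (proj₂ mu-partition) contained) (contained 0)) h))
  (λ core p → let mu , mu∈ , h = find p in core mu (proj₁ (∈-partitionsInBox⁻ {length lam} mu∈)) h)
  (¬? (Any.any? (isRimHook? t lam) (partitionsInBox (length lam) (part lam 0))))
  where
  shorter : ∀ mu nu → All (0 ℕ.<_) mu → mu ⊆ᴾ nu → length mu ℕ.≤ length nu
  shorter []       nu       _        _ = ℕ.z≤n
  shorter (_ ∷ _)  []       (p ∷ _)  c = ⊥-elim (ℕₚ.<⇒≱ p (c 0))
  shorter (_ ∷ mu) (_ ∷ nu) (_ ∷ ps) c = ℕ.s≤s (shorter mu nu ps (c ∘ suc))

-- The number of t-cores with at most r parts and largest part at most s.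
P : (t r s : ℕ) → ℕ
P t r s = length (filter (isCore? t) (partitionsInBox r s))

0<κ+1 : ∀ κ → 1ᴿ ≤ᴿ κ → 0ᴿ <ᴿ κ +ᴿ 1ᴿ
0<κ+1 κ 1≤κ with 1≤κ 1ℚ (ℚₚ.positive⁻¹ 1ℚ)
... | N , p = 1ℚ , ℚₚ.positive⁻¹ 1ℚ , N , p

-- A(t,κ), where n stands for ⌊t/(κ+1)⌋
A : (t n : ℕ) → ℝ → ℝ
A t n κ = Σ[ n ] (λ j →
    (-ᴿ 1ᴿ) ^ᴿ j *ᴿ fromℕ (t C j) *ᴿ (fromℕ t -ᴿ (1ᴿ +ᴿ κ) *ᴿ fromℕ j) ^ᴿ (t ℕ.∸ 1))
  /ℕ ((t ℕ.∸ 1) !)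
  where instance _ = (t ℕ.∸ 1) !≢0

{-# OPTIONS --safe #-}

{-
The first-column hook lengths of a partition with at most r parts and largest part at most s form an
r-element subset X of {0, …, r+s−1}.  Removing a t-rim hook replaces some x + t ∈ X by x ∉ X, so the
t-cores are the sets X closed under subtraction of t.  Such an X is given by the numbers n_i of its
elements congruent to i modulo t, and these are arbitrary numbers with sum r, each bounded by
q = ⌊(r+s)/t⌋ or by q + 1, depending on i.  Hence P t r s lies between the numbers of t-tuples with
sum r and all entries at most q, respectively q + 1.

By inclusion–exclusion, (t−1)! times the number of t-tuples with entries at most c and sum r equals
Σ_j (−1)^j C(t,j) Π_{1≤i<t} max(r + i − j(c+1), 0).  After division by r^(t−1) every factor converges
to max(1 − j(1+κ)/t, 0), and the floor n cuts the sum off where this vanishes.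
-}

module Submission where

open import Defs
open import Data.Empty using (⊥-elim)
open import Data.Integer as ℤ using (+_; +[1+_])
import Data.Integer.Properties as ℤₚ
open import Data.List
  using (List; []; _∷_; _++_; _∷ʳ_; length; map; concatMap; filter; upTo; drop; applyUpTo; downFrom)
import Data.List.Properties as Listₚ
import Data.List.Membership.DecPropositional as DecMembership
open import Data.List.Membership.Propositional using (_∈_; find; lose)
open import Data.List.Membership.Propositional.Properties
  using (∈-map⁺; ∈-map⁻; ∈-concatMap⁺; ∈-concatMap⁻; ∈-upTo⁺; ∈-upTo⁻; ∈-filter⁺; ∈-filter⁻;
         ∈-downFrom⁺; ∈-downFrom⁻; ∈-∃++; ∈-++⁺ˡ; ∈-++⁺ʳ; ∈-++⁻)
open import Data.List.Relation.Binary.Disjoint.Propositional using (Disjoint)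
open import Data.List.Relation.Unary.All as All using (All; []; _∷_)
import Data.List.Relation.Unary.All.Properties as Allₚ
open import Data.List.Relation.Unary.AllPairs as AllPairs using (AllPairs; []; _∷_)
import Data.List.Relation.Unary.AllPairs.Properties as AllPairsₚ
open import Data.List.Relation.Unary.Any using (here; there)
open import Data.List.Relation.Unary.Linked as Linked using (Linked; []; [-]; _∷_)
open import Data.List.Relation.Unary.Unique.Propositional using (Unique)
import Data.List.Relation.Unary.Unique.Propositional.Properties as Uniqueₚ
open import Data.Nat as ℕ
  using (ℕ; zero; suc; _+_; _*_; _∸_; _^_; _≤_; _<_; _≥_; _>_; _⊓_; _⊔_; z≤n; s≤s;
         NonZero; NonTrivial; nonTrivial⇒nonZero; _!)
open import Data.Nat.Combinatorics using (_C_; k>n⇒nCk≡0; nCk+nC[k+1]≡[n+1]C[k+1])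
import Data.Nat.DivMod as ℕ÷
open import Data.Nat.ListAction using (sum)
import Data.Nat.Properties as ℕₚ
open import Data.Nat.Properties using (m^n≢0; _!≢0)
import Data.Nat.Solver
open import Data.Product using (∃; ∃₂; _×_; _,_; proj₁; proj₂)
open import Data.Rational as ℚ using (ℚ; 0ℚ; 1ℚ; ½; _/_)
import Data.Rational.Properties as ℚₚ
import Data.Rational.Solver
import Data.Rational.Unnormalised as ℚᵘ
import Data.Rational.Unnormalised.Properties as ℚᵘₚ
open import Data.Sum using (_⊎_; inj₁; inj₂)
open import Function using (_∘_; id)
open import Relation.Binary using (tri<; tri≈; tri>)
open import Relation.Binary.Construct.Closure.ReflexiveTransitive using (Star; _◅_; _◅◅_; reverse)
open import Relation.Binary.PropositionalEquality
  using (_≡_; _≢_; _≗_; refl; sym; trans; cong; cong₂; subst; subst₂; module ≡-Reasoning)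
open import Relation.Nullary using (Dec; yes; no; ¬_; contradiction)
open import Relation.Nullary.Decidable using (_×-dec_)
open import Relation.Unary using (Decidable)

open CauchyLemmas
  using (half>0; half+half; ∣-∣-sym; ∣x∣≤∣x-y∣+∣y∣; bounded; quotient; product-estimate; 1/max; 1/max-inverse)

-- Connectedness and the absence of 2×2 blocks are awkward to use directly, so rim hooks are
-- translated into `HookRows`: the hook occupies consecutive rows, and the last box of row x + 1
-- lies exactly under the first hook box of row x. This one equation per row also makes the size of
-- the hook telescope to a difference of two first-column hook lengths.
--
-- The formula for bounded tuples does not come from a sum over sets of violated bounds, but from
-- difference operators. As a generating function in r, the number of t-tuples is ((1 - x^(c+1))/(1
-- - x))^t. Division by 1 - x is avoided by applying the backward difference `∇` to both sides and
-- using that `∇` is injective.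
--
-- For a real κ the sign of t - (1+κ)j cannot be decided. The floor hypothesis supplies what is
-- needed instead: this number is nonnegative for j ≤ n and nonpositive for j > n. The truncated
-- subtraction in the finite formula then converges to the right limit in either case, and the two
-- cases are compatible where the number is zero.

module ℕ-Solver = Data.Nat.Solver.+-*-Solver
module ℚ-Solver = Data.Rational.Solver.+-*-Solver

-- Rim hooks

∑ : ℕ → (ℕ → ℕ) → ℕ
∑ zero    f = 0
∑ (suc n) f = ∑ n f + f n

Antitone : (ℕ → ℕ) → Set
Antitone f = ∀ {i j} → i ≤ j → f j ≤ f i

antitone : ∀ {f} → (∀ i → f (suc i) ≤ f i) → Antitone f
antitone {f} step i≤j = go (ℕₚ.≤⇒≤′ i≤j)
  where
  go : ∀ {i j} → i ℕ.≤′ j → f j ≤ f i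
  go ℕ.≤′-refl        = ℕₚ.≤-refl
  go (ℕ.≤′-step i≤j)  = ℕₚ.≤-trans (step _) (go i≤j)

part-antitone : ∀ {lam} → Linked _≥_ lam → Antitone (part lam)
part-antitone = antitone ∘ step
  where
  step : ∀ {lam} → Linked _≥_ lam → ∀ i → part lam (suc i) ≤ part lam i
  step []          i       = z≤n
  step [-]         i       = z≤n
  step (x≥y ∷ _)   zero    = x≥y
  step (_ ∷ dec)   (suc i) = step dec i

part-beyond : ∀ lam {i} → length lam ≤ i → part lam i ≡ 0
part-beyond []        _         = refl
part-beyond (x ∷ lam) (s≤s len) = part-beyond lam len

part>0⇒<length : ∀ lam {i} → 0 < part lam i → i < length lam
part>0⇒<length lam {i} pos with i ℕ.<? length lam
... | yes i<len = i<len
... | no  i≮len = contradiction (part-beyond lam (ℕₚ.≮⇒≥ i≮len)) (ℕₚ.>⇒≢ pos)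

linked-∷ : ∀ {x} ys → Linked _≥_ ys → part ys 0 ≤ x → Linked _≥_ (x ∷ ys)
linked-∷ []      _   _ = [-]
linked-∷ (_ ∷ _) dec p = p ∷ dec

fromParts : (ℕ → ℕ) → ℕ → List ℕ
fromParts f zero    = []
fromParts f (suc r) with f 0
... | zero  = []
... | suc a = suc a ∷ fromParts (f ∘ suc) r

part-fromParts : ∀ f r → Antitone f → f r ≡ 0 → ∀ i → part (fromParts f r) i ≡ f i
part-fromParts f zero    anti fr≡0 i = sym (ℕₚ.n≤0⇒n≡0 (ℕₚ.≤-trans (anti z≤n) (ℕₚ.≤-reflexive fr≡0)))
part-fromParts f (suc r) anti fr≡0 i with f 0 in eq
... | zero  = sym (ℕₚ.n≤0⇒n≡0 (subst (f i ≤_) eq (anti z≤n)))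
part-fromParts f (suc r) anti fr≡0 zero    | suc a = sym eq
part-fromParts f (suc r) anti fr≡0 (suc i) | suc a =
  part-fromParts (f ∘ suc) r (anti ∘ s≤s) fr≡0 i

fromParts-partition : ∀ f r → Antitone f → f r ≡ 0 → IsPartition (fromParts f r)
fromParts-partition f zero    anti fr≡0 = [] , []
fromParts-partition f (suc r) anti fr≡0 with f 0 in eq
... | zero  = [] , []
... | suc a =
  let dec , pos = fromParts-partition (f ∘ suc) r (anti ∘ s≤s) fr≡0
  in linked-∷ _ dec (subst₂ _≤_ (sym (part-fromParts (f ∘ suc) r (anti ∘ s≤s) fr≡0 0)) eq (anti z≤n))
   , s≤s z≤n ∷ pos

∈-skewBoxes⁺ : ∀ lam mu {i j} → part mu i ≤ j → j < part lam i → (i , j) ∈ skewBoxes lam mu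
∈-skewBoxes⁺ lam mu {i} {j} mu≤j j<lam = ∈-concatMap⁺ _
  (lose (∈-upTo⁺ (part>0⇒<length lam (ℕₚ.≤-<-trans z≤n j<lam)))
    (subst (λ x → (i , x) ∈ _) (ℕₚ.m+[n∸m]≡n mu≤j)
      (∈-map⁺ (λ d → i , part mu i + d) (∈-upTo⁺ (ℕₚ.∸-monoˡ-< j<lam mu≤j)))))

∈-skewBoxes⁻ : ∀ lam mu {i j} → (i , j) ∈ skewBoxes lam mu → part mu i ≤ j × j < part lam i
∈-skewBoxes⁻ lam mu p with find (∈-concatMap⁻ _ {xs = upTo (length lam)} p)
... | i , _ , q with ∈-map⁻ (λ d → i , part mu i + d) q
... | d , d∈ , refl = ℕₚ.m≤m+n _ _ , (begin-strict
  part mu i + d                           <⟨ ℕₚ.+-monoʳ-< (part mu i) d< ⟩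
  part mu i + (part lam i ∸ part mu i)
    ≡⟨ ℕₚ.m+[n∸m]≡n {part mu i} {part lam i} (ℕₚ.<⇒≤ (ℕₚ.m∸n≢0⇒n<m (ℕₚ.m<n⇒n≢0 d<))) ⟩
  part lam i                              ∎)
  where
  open ℕₚ.≤-Reasoning
  d< = ∈-upTo⁻ d∈

length-concatMap-upTo : ∀ {A : Set} (f : ℕ → List A) n →
  length (concatMap f (upTo n)) ≡ ∑ n (length ∘ f)
length-concatMap-upTo f zero    = refl
length-concatMap-upTo f (suc n) = begin
  length (concatMap f (upTo (suc n)))
    ≡⟨ cong (length ∘ concatMap f) (Listₚ.upTo-∷ʳ n) ⟨
  length (concatMap f (upTo n ∷ʳ n))
    ≡⟨ cong length (Listₚ.concatMap-++ f (upTo n) (n ∷ [])) ⟩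
  length (concatMap f (upTo n) ++ (f n ++ []))
    ≡⟨ Listₚ.length-++ (concatMap f (upTo n)) ⟩
  length (concatMap f (upTo n)) + length (f n ++ [])
    ≡⟨ cong₂ _+_ (length-concatMap-upTo f n) (cong length (Listₚ.++-identityʳ (f n))) ⟩
  ∑ n (length ∘ f) + length (f n) ∎
  where open ≡-Reasoning

∑-cong : ∀ n {f g} → (∀ {i} → i < n → f i ≡ g i) → ∑ n f ≡ ∑ n g
∑-cong zero    eq = refl
∑-cong (suc n) eq = cong₂ _+_ (∑-cong n (eq ∘ ℕₚ.m<n⇒m<1+n)) (eq ℕₚ.≤-refl)

∑-zero : ∀ n {f} → (∀ {i} → i < n → f i ≡ 0) → ∑ n f ≡ 0
∑-zero zero    eq = refl
∑-zero (suc n) eq = cong₂ _+_ (∑-zero n (eq ∘ ℕₚ.m<n⇒m<1+n)) (eq ℕₚ.≤-refl)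

length-skewBoxes : ∀ lam mu →
  length (skewBoxes lam mu) ≡ ∑ (length lam) (λ i → part lam i ∸ part mu i)
length-skewBoxes lam mu = trans (length-concatMap-upTo _ (length lam))
  (∑-cong (length lam) λ {i} _ →
    trans (Listₚ.length-map (λ d → i , part mu i + d) (upTo (part lam i ∸ part mu i)))
    (Listₚ.length-upTo (part lam i ∸ part mu i)))

-- The row-by-row shape of a rim hook l/m occupying the rows from i to k.
record HookRows (l m : ℕ → ℕ) (i k : ℕ) : Set where
  field
    i≤k     : i ≤ k
    above   : ∀ {x} → x < i → m x ≡ l x
    below   : ∀ {x} → k < x → m x ≡ l x
    interlock : ∀ {x} → i ≤ x → x < k → suc (m x) ≡ l (suc x)
    end     : m k < l k

  gap : ℕ → ℕ
  gap x = l x ∸ m x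

  inside : Antitone l → ∀ {x} → i ≤ x → x ≤ k → m x < l x
  inside anti i≤x x≤k with ℕₚ.m≤n⇒m<n∨m≡n x≤k
  ... | inj₁ x<k  = subst (_≤ l _) (sym (interlock i≤x x<k)) (anti (ℕₚ.n≤1+n _))
  ... | inj₂ refl = end

  contained : Antitone l → ∀ x → m x ≤ l x
  contained anti x with x ℕ.<? i | k ℕ.<? x
  ... | yes x<i | _       = ℕₚ.≤-reflexive (above x<i)
  ... | no _    | yes k<x = ℕₚ.≤-reflexive (below k<x)
  ... | no x≮i  | no k≮x  = ℕₚ.<⇒≤ (inside anti (ℕₚ.≮⇒≥ x≮i) (ℕₚ.≮⇒≥ k≮x))

  -- By `interlock` the gap of row x is l x + 1 - l (x + 1), so the sum telescopes. The summand
  -- `l (i + d)` on the left keeps the equation free of subtraction.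
  ∑-upto : Antitone l → ∀ d → i + d ≤ k → ∑ (i + d) gap + l (i + d) ≡ l i + d
  ∑-upto anti zero _ rewrite ℕₚ.+-identityʳ i | ℕₚ.+-identityʳ (l i) =
    cong (_+ l i) (∑-zero i λ {x} x<i → trans (cong (l x ∸_) (above x<i)) (ℕₚ.n∸n≡0 (l x)))
  ∑-upto anti (suc d) le rewrite ℕₚ.+-suc i d = begin
    ∑ (i + d) gap + (l x ∸ m x) + l (suc x)
      ≡⟨ cong (∑ (i + d) gap + (l x ∸ m x) ℕ.+_) (interlock (ℕₚ.m≤m+n i d) le) ⟨
    ∑ (i + d) gap + (l x ∸ m x) + suc (m x)     ≡⟨ shuffle (∑ (i + d) gap) (l x ∸ m x) (m x) ⟩
    suc (∑ (i + d) gap + (l x ∸ m x + m x))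
      ≡⟨ cong (λ z → suc (∑ (i + d) gap + z)) (ℕₚ.m∸n+n≡m (contained anti x)) ⟩
    suc (∑ (i + d) gap + l x)                   ≡⟨ cong suc (∑-upto anti d (ℕₚ.<⇒≤ le)) ⟩
    suc (l i + d)                             ≡⟨ ℕₚ.+-suc (l i) d ⟨
    l i + suc d ∎
    where
    open ≡-Reasoning
    open ℕ-Solver
    x = i + d
    shuffle : ∀ a b c → a + b + suc c ≡ suc (a + (b + c))
    shuffle = solve 3 (λ a b c → a :+ b :+ (con 1 :+ c) := con 1 :+ (a :+ (b :+ c))) refl

  ∑-past : ∀ e → ∑ (suc k + e) gap ≡ ∑ (suc k) gap
  ∑-past zero    = cong (λ z → ∑ z gap) (ℕₚ.+-identityʳ (suc k))
  ∑-past (suc e) rewrite ℕₚ.+-suc k e = trans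
    (cong₂ _+_ (∑-past e)
      (trans (cong (l (suc (k + e)) ∸_) (below (s≤s (ℕₚ.m≤m+n k e))))
      (ℕₚ.n∸n≡0 (l (suc (k + e))))))
    (ℕₚ.+-identityʳ _)

  -- Among r rows, row x has first-column hook length l x + r - suc x. The equation therefore says
  -- that the value of row i in l exceeds the value of row k in m by the size of the hook.
  hook-size : Antitone l → ∀ {L} → k < L → ∑ L gap + m k + i ≡ l i + k
  hook-size anti {L} k<L = begin
    ∑ L gap + m k + i                    ≡⟨ cong (λ z → ∑ z gap + m k + i) (ℕₚ.m+[n∸m]≡n k<L) ⟨
    ∑ (suc k + (L ∸ suc k)) gap + m k + i  ≡⟨ cong (λ z → z + m k + i) (∑-past (L ∸ suc k)) ⟩
    ∑ k gap + (l k ∸ m k) + m k + i      ≡⟨ cong (_+ i) (ℕₚ.+-assoc (∑ k gap) (l k ∸ m k) (m k)) ⟩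
    ∑ k gap + (l k ∸ m k + m k) + i      ≡⟨ cong (λ z → ∑ k gap + z + i) (ℕₚ.m∸n+n≡m (contained anti k)) ⟩
    ∑ k gap + l k + i                    ≡⟨ cong (λ z → ∑ z gap + l z + i) (ℕₚ.m+[n∸m]≡n i≤k) ⟨
    ∑ (i + (k ∸ i)) gap + l (i + (k ∸ i)) + i
      ≡⟨ cong (_+ i) (∑-upto anti (k ∸ i) (ℕₚ.≤-reflexive (ℕₚ.m+[n∸m]≡n i≤k))) ⟩
    l i + (k ∸ i) + i                  ≡⟨ ℕₚ.+-assoc (l i) (k ∸ i) i ⟩
    l i + (k ∸ i + i)                  ≡⟨ cong (l i ℕ.+_) (ℕₚ.m∸n+n≡m i≤k) ⟩
    l i + k ∎
    where open ≡-Reasoning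

-- First-column hook lengths and cores

-- beta r lam lists the first-column hook lengths of lam, padded to r parts.
beta : ℕ → List ℕ → List ℕ
beta zero    lam = []
beta (suc r) lam = part lam 0 + r ∷ beta r (drop 1 lam)

part-drop : ∀ lam i → part (drop 1 lam) i ≡ part lam (suc i)
part-drop []        i = refl
part-drop (_ ∷ lam) i = refl

-- The hook length x = part lam i + r - suc i is described by an additive equation, here and below,
-- so that no truncated subtraction has to be controlled.
∈-beta⁺ : ∀ r lam {i x} → i < r → part lam i + r ≡ x + suc i → x ∈ beta r lam
∈-beta⁺ (suc r) lam {zero}  {x} _         eq =
  here (ℕₚ.suc-injective (trans (ℕₚ.+-comm 1 x) (trans (sym eq) (ℕₚ.+-suc (part lam 0) r))))
∈-beta⁺ (suc r) lam {suc i} {x} (s≤s i<r) eq = there (∈-beta⁺ r (drop 1 lam) i<r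
  (trans (cong (_+ r) (part-drop lam i))
    (ℕₚ.suc-injective (trans (sym (ℕₚ.+-suc _ r)) (trans eq (ℕₚ.+-suc x (suc i)))))))

∈-beta⁻ : ∀ r lam {x} → x ∈ beta r lam → ∃ λ i → i < r × part lam i + r ≡ x + suc i
∈-beta⁻ (suc r) lam (here refl) = 0 , s≤s z≤n ,
  trans (ℕₚ.+-suc _ r) (ℕₚ.+-comm 1 (part lam 0 + r))
∈-beta⁻ (suc r) lam {x} (there x∈) with ∈-beta⁻ r (drop 1 lam) x∈
... | i , i<r , eq = suc i , s≤s i<r ,
  trans (ℕₚ.+-suc _ r) (trans (cong suc (trans (cong (_+ r) (sym (part-drop lam i))) eq))
    (sym (ℕₚ.+-suc x (suc i))))

Closed : ℕ → List ℕ → Set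
Closed t xs = ∀ {x} → x + t ∈ xs → x ∈ xs

adjacentIn-sym : ∀ {bs b c} → AdjacentIn bs b c → AdjacentIn bs c b
adjacentIn-sym {b = i , j} {k , l} (b∈ , c∈ , adj) = c∈ , b∈ ,
  trans (cong₂ _+_ (ℕₚ.∣-∣-comm k i) (ℕₚ.∣-∣-comm l j)) adj

adjacent-horizontal : ∀ i j → Adjacent (i , j) (i , suc j)
adjacent-horizontal i j = cong₂ _+_ (ℕₚ.∣n-n∣≡0 i) (trans (cong ℕ.∣ j -_∣ (ℕₚ.+-comm 1 j)) (ℕₚ.∣m-m+n∣≡n j 1))

adjacent-vertical : ∀ i j → Adjacent (i , j) (suc i , j)
adjacent-vertical i j = cong₂ _+_ (trans (cong ℕ.∣ i -_∣ (ℕₚ.+-comm 1 i)) (ℕₚ.∣m-m+n∣≡n i 1)) (ℕₚ.∣n-n∣≡0 j)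

-- The change of row already uses up the whole distance 1, so the columns agree.
adjacent-below : ∀ {i k j l} → Adjacent (i , j) (k , l) → i < k → k ≡ suc i × j ≡ l
adjacent-below {i} {k} {j} {l} adj i<k with ℕₚ.m≤n⇒∃[o]m+o≡n i<k
... | e , refl with trans (cong (_+ ℕ.∣ j - l ∣)
        (sym (trans (cong ℕ.∣ i -_∣ (sym (ℕₚ.+-suc i e))) (ℕₚ.∣m-m+n∣≡n i (suc e))))) adj
... | eq with ℕₚ.m+n≡0⇒m≡0 e (ℕₚ.suc-injective eq) | ℕₚ.m+n≡0⇒n≡0 e (ℕₚ.suc-injective eq)
... | refl | eq′ = cong suc (ℕₚ.+-identityʳ i) , ℕₚ.∣m-n∣≡0⇒m≡n eq′

-- Rows x and x + 1 of the hook share exactly the column `part mu x`. Sharing no second column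
-- excludes 2×2 blocks. The shared column gives a vertical step, and with horizontal moves inside
-- the rows it connects every box to the leftmost box of row i.
hookRows⇒rimHook : ∀ {t i k} lam mu → IsPartition lam → HookRows (part lam) (part mu) i k →
  part lam i + k ≡ t + part mu k + i → IsRimHook t lam mu
hookRows⇒rimHook {t} {i} {k} lam mu (dec , _) hook size = record
  { contained = contained anti
  ; size = trans (length-skewBoxes lam mu) (ℕₚ.+-cancelʳ-≡ (part mu k) _ _ (ℕₚ.+-cancelʳ-≡ i _ _
      (trans (hook-size anti (part>0⇒<length lam (ℕₚ.≤-<-trans z≤n end))) size)))
  ; connected = λ b c b∈ c∈ → to-corner b∈ ◅◅ reverse adjacentIn-sym (to-corner c∈)
  ; no2×2 = λ x j (p , _ , q , r) →
      let mu≤j , _ = ∈-skewBoxes⁻ lam mu p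
          _ , <lam = ∈-skewBoxes⁻ lam mu r
      in contradiction <lam (ℕₚ.≤⇒≯ (subst (_≤ suc j) (interlock (i≤row p) (row≤k q)) (s≤s mu≤j)))
  }
  where
  open HookRows hook
  anti : Antitone (part lam)
  anti = part-antitone dec
  bs = skewBoxes lam mu

  i≤row : ∀ {x j} → (x , j) ∈ bs → i ≤ x
  i≤row {x} p with ∈-skewBoxes⁻ lam mu p | x ℕ.<? i
  ... | mu≤j , j<lam | yes x<i =
    contradiction (subst (_< part lam x) (above x<i) (ℕₚ.≤-<-trans mu≤j j<lam)) (ℕₚ.<-irrefl refl)
  ... | _            | no x≮i  = ℕₚ.≮⇒≥ x≮i

  row≤k : ∀ {x j} → (x , j) ∈ bs → x ≤ k
  row≤k {x} p with ∈-skewBoxes⁻ lam mu p | k ℕ.<? x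
  ... | mu≤j , j<lam | yes k<x =
    contradiction (subst (_< part lam x) (below k<x) (ℕₚ.≤-<-trans mu≤j j<lam)) (ℕₚ.<-irrefl refl)
  ... | _            | no k≮x  = ℕₚ.≮⇒≥ k≮x

  leftwards : ∀ x j d → part mu x ≤ j → j + d < part lam x → Star (AdjacentIn bs) (x , j + d) (x , j)
  leftwards x j zero    mu≤j <lam =
    subst (λ z → Star (AdjacentIn bs) (x , z) (x , j)) (sym (ℕₚ.+-identityʳ j)) Star.ε
  leftwards x j (suc d) mu≤j <lam rewrite ℕₚ.+-suc j d =
    adjacentIn-sym
      ( ∈-skewBoxes⁺ lam mu (ℕₚ.≤-trans mu≤j (ℕₚ.m≤m+n j d)) (ℕₚ.<⇒≤ <lam)
      , ∈-skewBoxes⁺ lam mu (ℕₚ.≤-trans mu≤j (ℕₚ.≤-trans (ℕₚ.m≤m+n j d) (ℕₚ.n≤1+n _))) <lam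
      , adjacent-horizontal x (j + d))
    ◅ leftwards x j d mu≤j (ℕₚ.<⇒≤ <lam)

  along-row : ∀ {x j j′} → (x , j) ∈ bs → (x , j′) ∈ bs → Star (AdjacentIn bs) (x , j) (x , j′)
  along-row {x} {j} {j′} p q with ∈-skewBoxes⁻ lam mu p | ∈-skewBoxes⁻ lam mu q
  ... | mu≤j , j< | mu≤j′ , j′< = leftmost mu≤j j< ◅◅ reverse adjacentIn-sym (leftmost mu≤j′ j′<)
    where
    leftmost : ∀ {j} → part mu x ≤ j → j < part lam x → Star (AdjacentIn bs) (x , j) (x , part mu x)
    leftmost {j} mu≤j j< with ℕₚ.m≤n⇒∃[o]m+o≡n mu≤j
    ... | d , refl = leftwards x (part mu x) d ℕₚ.≤-refl j<

  climb : ∀ d {j} → (i + d , j) ∈ bs → Star (AdjacentIn bs) (i + d , j) (i , part mu i)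
  climb zero p rewrite ℕₚ.+-identityʳ i = along-row p
    (∈-skewBoxes⁺ lam mu ℕₚ.≤-refl (inside anti ℕₚ.≤-refl i≤k))
  climb (suc d) p rewrite ℕₚ.+-suc i d =
    along-row p lower ◅◅ adjacentIn-sym (upper , lower , adjacent-vertical x (part mu x)) ◅ climb d upper
    where
    x = i + d
    i≤x = ℕₚ.m≤m+n i d
    x<k = row≤k p
    lower : (suc x , part mu x) ∈ bs
    lower = ∈-skewBoxes⁺ lam mu
      (ℕ.s≤s⁻¹ (subst (part mu (suc x) <_) (sym (interlock i≤x x<k)) (inside anti (ℕₚ.m≤n⇒m≤1+n i≤x) x<k)))
      (ℕₚ.≤-reflexive (interlock i≤x x<k))
    upper : (x , part mu x) ∈ bs
    upper = ∈-skewBoxes⁺ lam mu ℕₚ.≤-refl (inside anti i≤x (ℕₚ.<⇒≤ x<k))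

  to-corner : ∀ {b} → b ∈ bs → Star (AdjacentIn bs) b (i , part mu i)
  to-corner {x , j} p = subst (λ z → (z , j) ∈ bs → Star (AdjacentIn bs) (z , j) _)
    (ℕₚ.m+[n∸m]≡n (i≤row p)) (climb (x ∸ i)) p

least : ∀ {Q : ℕ → Set} → Decidable Q → ∀ n → Q n → ∃ λ i → i ≤ n × Q i × (∀ {x} → x < i → ¬ Q x)
least Q? zero    q = 0 , z≤n , q , λ ()
least Q? (suc n) q with Q? 0
... | yes q₀ = 0 , z≤n , q₀ , λ ()
... | no ¬q₀ with least (Q? ∘ suc) n q
...   | i , i≤n , qᵢ , min = suc i , s≤s i≤n , qᵢ , λ { {zero} _ → ¬q₀ ; {suc x} (s≤s x<i) → min x<i }

greatest : ∀ {Q : ℕ → Set} → Decidable Q → ∀ N → (∀ {x} → N ≤ x → ¬ Q x) → ∀ n → Q n →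
  ∃ λ k → n ≤ k × Q k × (∀ {x} → k < x → ¬ Q x)
greatest Q? zero    none n q = contradiction q (none z≤n)
greatest Q? (suc N) none n q with Q? N
... | yes q′ = N , ℕₚ.≮⇒≥ (λ N<n → none N<n q) , q′ , none
... | no ¬q  = greatest Q? N (λ {x} N≤x qₓ → case-≤ N≤x qₓ) n q
  where
  case-≤ : ∀ {x} → N ≤ x → ¬ _
  case-≤ N≤x qₓ with ℕₚ.m≤n⇒m<n∨m≡n N≤x
  ... | inj₁ N<x  = none N<x qₓ
  ... | inj₂ refl = ¬q qₓ

-- An adjacency step changes the row by at most one, so a path that passes from row x or above to
-- below row x contains a vertical step from row x to row x + 1.
crossing : ∀ {bs} x {b c} → Star (AdjacentIn bs) b c → proj₁ b ≤ x → x < proj₁ c →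
  ∃ λ j → (x , j) ∈ bs × (suc x , j) ∈ bs
crossing x Star.ε b≤x x<c = contradiction x<c (ℕₚ.≤⇒≯ b≤x)
crossing x (_◅_ {i = i₀ , j₀} {j = i₁ , j₁} (b∈ , b′∈ , adj) path) b≤x x<c with i₁ ℕ.≤? x
... | yes b′≤x = crossing x path b′≤x x<c
... | no  b′≰x with adjacent-below {i₀} {i₁} {j₀} {j₁} adj (ℕₚ.≤-<-trans b≤x (ℕₚ.≰⇒> b′≰x))
...   | refl , refl with ℕₚ.≤-antisym b≤x (ℕ.s≤s⁻¹ (ℕₚ.≰⇒> b′≰x))
...     | refl = _ , b∈ , b′∈

-- Here i and k are the first and the last row containing a box. A path between boxes of these rows
-- crosses from row x to x + 1, so the two rows share a column and part mu x < part lam (suc x); a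
-- larger difference would leave room for a 2×2 block. Together these are the interlocking equation.
rimHook⇒hookRows : ∀ {t} lam mu → IsPartition lam → IsPartition mu → 0 < t → IsRimHook t lam mu →
  ∃₂ λ i k → HookRows (part lam) (part mu) i k × part lam i + k ≡ t + part mu k + i
rimHook⇒hookRows {t} lam mu (decλ , _) (decμ , _) 0<t hook =
  let (x₀ , y₀) , p₀              = some (subst (0 <_) (sym size) 0<t)
      mu≤ , <lam                  = ∈-skewBoxes⁻ lam mu p₀
      row₀                        = ℕₚ.≤-<-trans mu≤ <lam
      i , i≤x₀ , row-i , before-i = least row? x₀ row₀
      k , x₀≤k , row-k , after-k  = greatest row? (length lam)
        (λ len≤x row → ℕₚ.<⇒≱ (part>0⇒<length lam (ℕₚ.≤-<-trans z≤n row)) len≤x) x₀ row₀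
      rows                        = hookRows (ℕₚ.≤-trans i≤x₀ x₀≤k) row-i before-i row-k after-k
  in i , k , rows ,
    trans (sym (HookRows.hook-size rows antiλ (part>0⇒<length lam (ℕₚ.≤-<-trans z≤n row-k))))
      (cong (λ z → z + part mu k + i) (trans (sym (length-skewBoxes lam mu)) size))
  where
  open IsRimHook hook
  antiλ : Antitone (part lam)
  antiλ = part-antitone decλ
  antiμ : Antitone (part mu)
  antiμ = part-antitone decμ

  some : ∀ {xs : List Box} → 0 < length xs → ∃ λ b → b ∈ xs
  some {b ∷ _} _ = b , here refl

  Row : ℕ → Set
  Row x = part mu x < part lam x

  row? : Decidable Row
  row? x = part mu x ℕ.<? part lam x

  empty : ∀ {x} → ¬ Row x → part mu x ≡ part lam x
  empty {x} ¬row = ℕₚ.≤-antisym (contained x) (ℕₚ.≮⇒≥ ¬row)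

  upper : ∀ {x} → ¬ suc (part mu x) < part lam (suc x)
  upper {x} lt = no2×2 x (part mu x)
    ( ∈-skewBoxes⁺ lam mu ℕₚ.≤-refl (ℕₚ.<-≤-trans (ℕₚ.<⇒≤ lt) (antiλ (ℕₚ.n≤1+n x)))
    , ∈-skewBoxes⁺ lam mu (ℕₚ.n≤1+n _) (ℕₚ.<-≤-trans lt (antiλ (ℕₚ.n≤1+n x)))
    , ∈-skewBoxes⁺ lam mu (antiμ (ℕₚ.n≤1+n x)) (ℕₚ.<⇒≤ lt)
    , ∈-skewBoxes⁺ lam mu (ℕₚ.m≤n⇒m≤1+n (antiμ (ℕₚ.n≤1+n x))) lt )

  hookRows : ∀ {i k} → i ≤ k → Row i → (∀ {x} → x < i → ¬ Row x) →
    Row k → (∀ {x} → k < x → ¬ Row x) → HookRows (part lam) (part mu) i k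
  hookRows {i} {k} i≤k row-i before-i row-k after-k = record
    { i≤k       = i≤k
    ; above     = λ x<i → empty (before-i x<i)
    ; below     = λ k<x → empty (after-k k<x)
    ; interlock = λ i≤x x<k → ℕₚ.≤-antisym (lower i≤x x<k) (ℕₚ.≮⇒≥ upper)
    ; end       = row-k
    }
    where
    lower : ∀ {x} → i ≤ x → x < k → part mu x < part lam (suc x)
    lower {x} i≤x x<k with crossing x
      (connected (i , part mu i) (k , part mu k) (∈-skewBoxes⁺ lam mu ℕₚ.≤-refl row-i)
        (∈-skewBoxes⁺ lam mu ℕₚ.≤-refl row-k)) i≤x x<k
    ... | j , p , q = ℕₚ.≤-<-trans (proj₁ (∈-skewBoxes⁻ lam mu p)) (proj₂ (∈-skewBoxes⁻ lam mu q))

HookRows-resp : ∀ {l m m′ i k} → (∀ x → m′ x ≡ m x) → HookRows l m i k → HookRows l m′ i k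
HookRows-resp m′≗m rows = record
  { i≤k       = i≤k
  ; above     = λ x<i → trans (m′≗m _) (above x<i)
  ; below     = λ k<x → trans (m′≗m _) (below k<x)
  ; interlock = λ i≤x x<k → trans (cong suc (m′≗m _)) (interlock i≤x x<k)
  ; end       = subst (_< _) (sym (m′≗m _)) end
  }
  where open HookRows rows

-- Outside the hook m agrees with l, and between rows i and k it is l moved up by one row and
-- lowered by one. Monotonicity can fail only from row k to row k + 1, which the last hypothesis
-- covers.
hookRows-antitone : ∀ {l m i k} → Antitone l → HookRows l m i k → l (suc k) ≤ m k → Antitone m
hookRows-antitone {l} {m} {i} {k} anti rows l≤m = antitone step
  where
  open HookRows rows
  step : ∀ x → m (suc x) ≤ m x
  step x with suc x ℕ.≤? i
  ... | yes x<i = subst (m (suc x) ≤_) (sym (above x<i)) (ℕₚ.≤-trans (contained anti (suc x)) (anti (ℕₚ.n≤1+n x)))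
  ... | no  x≮i with ℕₚ.<-cmp x k
  ...   | tri< x<k _ _ = ℕ.s≤s⁻¹ (subst (m (suc x) <_)
      (sym (interlock i≤x x<k)) (inside anti (ℕₚ.m≤n⇒m≤1+n i≤x) x<k))
    where i≤x = ℕ.s≤s⁻¹ (ℕₚ.≰⇒> x≮i)
  ...   | tri≈ _ refl _ = subst (_≤ m x) (sym (below ℕₚ.≤-refl)) l≤m
  ...   | tri> _ _ k<x = subst₂ _≤_ (sym (below (ℕₚ.m<n⇒m<1+n k<x))) (sym (below k<x)) (anti (ℕₚ.n≤1+n x))

module RemoveHook (l : ℕ → ℕ) (i k a : ℕ) where

  -- In first-column hook lengths, rows i + 1, ..., k keep their values but move up one index; the
  -- value of row i disappears, and the one belonging to a part of size `a` appears in row k.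
  remaining : ℕ → ℕ
  remaining x with x ℕ.<? i | ℕₚ.<-cmp x k
  ... | yes _ | _          = l x
  ... | no _  | tri< _ _ _ = l (suc x) ∸ 1
  ... | no _  | tri≈ _ _ _ = a
  ... | no _  | tri> _ _ _ = l x

  remaining-k : i ≤ k → remaining k ≡ a
  remaining-k i≤k with k ℕ.<? i | ℕₚ.<-cmp k k
  ... | yes k<i | _            = contradiction k<i (ℕₚ.≤⇒≯ i≤k)
  ... | no _    | tri< _ k≢k _ = contradiction refl k≢k
  ... | no _    | tri≈ _ _ _   = refl
  ... | no _    | tri> _ k≢k _ = contradiction refl k≢k

  remaining-rows : Antitone l → i ≤ k → a < l k → HookRows l remaining i k
  remaining-rows anti i≤k a<l = record
    { i≤k       = i≤k
    ; above     = above
    ; below     = below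
    ; interlock = interlock
    ; end       = subst (_< l k) (sym (remaining-k i≤k)) a<l
    }
    where
    above : ∀ {x} → x < i → remaining x ≡ l x
    above {x} x<i with x ℕ.<? i | ℕₚ.<-cmp x k
    ... | yes _  | _ = refl
    ... | no x≮i | _ = contradiction x<i x≮i

    below : ∀ {x} → k < x → remaining x ≡ l x
    below {x} k<x with x ℕ.<? i | ℕₚ.<-cmp x k
    ... | yes _ | _            = refl
    ... | no _  | tri< _ _ k≮x = contradiction k<x k≮x
    ... | no _  | tri≈ _ _ k≮x = contradiction k<x k≮x
    ... | no _  | tri> _ _ _   = refl

    interlock : ∀ {x} → i ≤ x → x < k → suc (remaining x) ≡ l (suc x)
    interlock {x} i≤x x<k with x ℕ.<? i | ℕₚ.<-cmp x k
    ... | yes x<i | _            = contradiction x<i (ℕₚ.≤⇒≯ i≤x)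
    ... | no _    | tri< _ _ _   = ℕₚ.m+[n∸m]≡n (ℕₚ.<-≤-trans (ℕₚ.≤-<-trans z≤n a<l) (anti x<k))
    ... | no _    | tri≈ x≮k _ _ = contradiction x<k x≮k
    ... | no _    | tri> x≮k _ _ = contradiction x<k x≮k

-- A removable hook on rows i to k would give y = m k + r - suc k with y + t the hook length of row
-- i. Closure puts y among the hook lengths of lam, but those of rows up to k are larger than y and
-- those of later rows are smaller.
closed⇒core : ∀ {t r lam} → 0 < t → IsPartition lam → length lam ≤ r → Closed t (beta r lam) → IsCore t lam
closed⇒core {t} {r} {lam} 0<t plam len≤r closed mu pmu hook =
  let i , k , rows , size = rimHook⇒hookRows lam mu plam pmu 0<t hook in impossible rows size
  where
  impossible : ∀ {i k} → HookRows (part lam) (part mu) i k → ¬ part lam i + k ≡ t + part mu k + i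
  impossible {i} {k} rows size = clash (∈-beta⁻ r lam (closed (∈-beta⁺ r lam i<r top)))
    where
    open HookRows rows
    open ≡-Reasoning
    open ℕ-Solver
    l = part lam
    m = part mu
    anti : Antitone l
    anti = part-antitone (proj₁ plam)
    k<r : k < r
    k<r = ℕₚ.<-≤-trans (part>0⇒<length lam (ℕₚ.≤-<-trans z≤n end)) len≤r
    i<r = ℕₚ.≤-<-trans i≤k k<r
    y = m k + (r ∸ suc k)

    y-eq : y + suc k ≡ m k + r
    y-eq = trans (ℕₚ.+-assoc (m k) _ (suc k)) (cong (m k ℕ.+_) (ℕₚ.m∸n+n≡m k<r))

    top : l i + r ≡ y + t + suc i
    top = ℕₚ.+-cancelʳ-≡ k _ _ (begin
      l i + r + k            ≡⟨ solve 3 (λ a b c → a :+ b :+ c := (a :+ c) :+ b) refl (l i) r k ⟩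
      l i + k + r            ≡⟨ cong (_+ r) size ⟩
      t + m k + i + r
        ≡⟨ solve 4 (λ a b c d → a :+ b :+ c :+ d := (b :+ d) :+ (a :+ c)) refl t (m k) i r ⟩
      m k + r + (t + i)      ≡⟨ cong (_+ (t + i)) y-eq ⟨
      y + suc k + (t + i)
        ≡⟨ solve 4 (λ a b c d → (a :+ (con 1 :+ b)) :+ (c :+ d) := a :+ c :+ (con 1 :+ d) :+ b) refl y k t i ⟩
      y + t + suc i + k      ∎)

    clash : ¬ ∃ λ z → z < r × l z + r ≡ y + suc z
    clash (z , _ , eq) = compare (ℕₚ.+-cancelʳ-≡ r _ _ (begin
      l z + suc k + r        ≡⟨ solve 3 (λ a b c → a :+ b :+ c := (a :+ c) :+ b) refl (l z) (suc k) r ⟩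
      l z + r + suc k        ≡⟨ cong (_+ suc k) eq ⟩
      y + suc z + suc k      ≡⟨ solve 3 (λ a b c → a :+ b :+ c := (a :+ c) :+ b) refl y (suc z) (suc k) ⟩
      y + suc k + suc z      ≡⟨ cong (_+ suc z) y-eq ⟩
      m k + r + suc z        ≡⟨ solve 3 (λ a b c → a :+ b :+ c := (a :+ c) :+ b) refl (m k) r (suc z) ⟩
      m k + suc z + r        ∎))
      where
      compare : l z + suc k ≢ m k + suc z
      compare eq with z ℕ.≤? k
      ... | yes z≤k = ℕₚ.<-irrefl (sym eq) (ℕₚ.+-mono-<-≤ (ℕₚ.<-≤-trans end (anti z≤k)) (s≤s z≤k))
      ... | no  z≰k = ℕₚ.<-irrefl eq (ℕₚ.+-mono-≤-<
        (ℕₚ.≤-trans (ℕₚ.≤-reflexive (sym (below (ℕₚ.≰⇒> z≰k)))) (part-antitone (proj₁ pmu) (ℕₚ.<⇒≤ (ℕₚ.≰⇒> z≰k))))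
        (s≤s (ℕₚ.≰⇒> z≰k)))

-- The hook removed starts in the row of x + t and ends in the last row whose
-- first-column hook length exceeds x.
core⇒closed : ∀ {t r lam} → 0 < t → IsPartition lam → length lam ≤ r → IsCore t lam → Closed t (beta r lam)
core⇒closed {t} {r} {lam} 0<t plam len≤r core {x} x+t∈ with DecMembership._∈?_ ℕ._≟_ x (beta r lam)
... | yes x∈ = x∈
... | no  x∉ with ∈-beta⁻ r lam x+t∈
...   | i , i<r , top = ⊥-elim (hook (greatest beyond? r (λ r≤z q → ℕₚ.<⇒≱ (proj₁ q) r≤z) i
          (i<r , subst (x + suc i <_) (sym top) (ℕₚ.+-monoˡ-< (suc i) (ℕₚ.m<m+n x 0<t)))))
  where
  l = part lam
  anti : Antitone l
  anti = part-antitone (proj₁ plam)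

  Beyond : ℕ → Set
  Beyond z = z < r × x + suc z < l z + r

  beyond? : Decidable Beyond
  beyond? z = (z ℕ.<? r) ×-dec (x + suc z ℕ.<? l z + r)

  hook : ¬ ∃ λ k → i ≤ k × Beyond k × (∀ {z} → k < z → ¬ Beyond z)
  hook (k , i≤k , (k<r , x<βₖ) , last) = core (fromParts m r) (fromParts-partition m r anti-m m-r)
    (hookRows⇒rimHook lam (fromParts m r) plam (HookRows-resp m≗ rows)
      (trans size (cong (λ z → t + z + i) (sym (trans (m≗ k) (remaining-k i≤k))))))
    where
    -- Row k + 1 is no longer beyond x, and since x is absent its hook length is strictly below x.
    next : suc k < r → l (suc k) + r < x + suc (suc k)
    next 1+k<r = ℕₚ.≤∧≢⇒< (ℕₚ.≮⇒≥ λ x< → last ℕₚ.≤-refl (1+k<r , x<))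
      (λ eq → x∉ (∈-beta⁺ r lam 1+k<r eq))

    r≤ : r ≤ x + suc k
    r≤ with suc k ℕ.<? r
    ... | yes 1+k<r = ℕ.s≤s⁻¹ (subst (suc r ≤_) (ℕₚ.+-suc x (suc k))
      (ℕₚ.≤-trans (s≤s (ℕₚ.m≤n+m r (l (suc k)))) (next 1+k<r)))
    ... | no  1+k≮r = ℕₚ.≤-trans (ℕₚ.≮⇒≥ 1+k≮r) (ℕₚ.m≤n+m (suc k) x)

    -- A part of size `a` in row k has first-column hook length exactly x; `r≤` makes the
    -- subtraction exact.
    a = x + suc k ∸ r
    a+r : a + r ≡ x + suc k
    a+r = ℕₚ.m∸n+n≡m r≤

    open RemoveHook l i k a renaming (remaining to m)

    a<l : a < l k
    a<l = ℕₚ.+-cancelʳ-< r _ _ (subst (_< l k + r) (sym a+r) x<βₖ)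

    l≤a : l (suc k) ≤ a
    l≤a with suc k ℕ.<? r
    ... | yes 1+k<r = ℕₚ.+-cancelʳ-≤ r _ _ (subst (l (suc k) + r ≤_) (sym a+r)
      (ℕ.s≤s⁻¹ (subst (suc (l (suc k) + r) ≤_) (ℕₚ.+-suc x (suc k)) (next 1+k<r))))
    ... | no  1+k≮r = subst (_≤ a) (sym (part-beyond lam (ℕₚ.≤-trans len≤r (ℕₚ.≮⇒≥ 1+k≮r)))) z≤n

    rows : HookRows l m i k
    rows = remaining-rows anti i≤k a<l

    anti-m : Antitone m
    anti-m = hookRows-antitone anti rows (subst (l (suc k) ≤_) (sym (remaining-k i≤k)) l≤a)

    m-r : m r ≡ 0
    m-r = trans (HookRows.below rows k<r) (part-beyond lam len≤r)

    m≗ : ∀ z → part (fromParts m r) z ≡ m z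
    m≗ = part-fromParts m r anti-m m-r

    size : l i + k ≡ t + a + i
    size = ℕₚ.+-cancelʳ-≡ r _ _ (begin
      l i + k + r             ≡⟨ solve 3 (λ a b c → a :+ b :+ c := (a :+ c) :+ b) refl (l i) k r ⟩
      l i + r + k             ≡⟨ cong (_+ k) top ⟩
      x + t + suc i + k
        ≡⟨ solve 4 (λ a b c d → a :+ b :+ (con 1 :+ c) :+ d := b :+ (a :+ (con 1 :+ d)) :+ c) refl x t i k ⟩
      t + (x + suc k) + i     ≡⟨ cong (λ z → t + z + i) a+r ⟨
      t + (a + r) + i         ≡⟨ solve 4 (λ a b c d → a :+ (b :+ c) :+ d := a :+ b :+ d :+ c) refl t a r i ⟩
      t + a + i + r           ∎)
      where
      open ≡-Reasoning
      open ℕ-Solver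

-- Cores as tuples

-- The partner of the first element is deleted from `ys`, and injectivity shows that no later
-- element needs it. A relation takes the place of a function so that `Runners`, read in its two
-- directions, serves both the upper and the lower bound on the number of cores.
length-≤-by-relation : ∀ {A B : Set} (R : A → B → Set) {xs : List A} {ys : List B} → Unique xs →
  (∀ {x} → x ∈ xs → ∃ λ y → y ∈ ys × R x y) →
  (∀ {x x′ y} → x ∈ xs → x′ ∈ xs → R x y → R x′ y → x ≡ x′) →
  length xs ≤ length ys
length-≤-by-relation R {[]}     _              image inj = z≤n
length-≤-by-relation R {x ∷ xs} {ys} (x∉ ∷ uniq) image inj with image (here refl)
... | y , y∈ , Rxy with ∈-∃++ y∈
... | as , bs , refl = begin
  suc (length xs)             ≤⟨ s≤s (length-≤-by-relation R uniq image′ λ p q → inj (there p) (there q)) ⟩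
  suc (length (as ++ bs))     ≡⟨ Listₚ.length-++-sucʳ as y bs ⟨
  length (as ++ y ∷ bs)       ∎
  where
  open ℕₚ.≤-Reasoning
  image′ : ∀ {x′} → x′ ∈ xs → ∃ λ y′ → y′ ∈ as ++ bs × R x′ y′
  image′ x′∈ with image (there x′∈)
  ... | y′ , y′∈ , Rx′y′ with ∈-++⁻ as y′∈
  ... | inj₁ ∈as         = y′ , ∈-++⁺ˡ ∈as , Rx′y′
  ... | inj₂ (there ∈bs) = y′ , ∈-++⁺ʳ as ∈bs , Rx′y′
  ... | inj₂ (here refl) = contradiction (inj (here refl) (there x′∈) Rxy Rx′y′) (All.lookup x∉ x′∈)

∑-distrib-+ : ∀ n f g → ∑ n (λ i → f i + g i) ≡ ∑ n f + ∑ n g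
∑-distrib-+ zero    f g = refl
∑-distrib-+ (suc n) f g rewrite ∑-distrib-+ n f g =
  solve 4 (λ a b c d → a :+ b :+ (c :+ d) := a :+ c :+ (b :+ d)) refl (∑ n f) (∑ n g) (f n) (g n)
  where open ℕ-Solver

∑-split : ∀ m n f → ∑ (n + m) f ≡ ∑ m f + ∑ n (λ i → f (i + m))
∑-split m zero    f = sym (ℕₚ.+-identityʳ (∑ m f))
∑-split m (suc n) f rewrite ∑-split m n f = ℕₚ.+-assoc (∑ m f) _ _

∑-residues : ∀ t K f → ∑ (K * t) f ≡ ∑ t (λ i → ∑ K (λ k → f (i + k * t)))
∑-residues t zero    f = sym (∑-zero t λ _ → refl)
∑-residues t (suc K) f = begin
  ∑ (t + K * t) f                                ≡⟨ ∑-split (K * t) t f ⟩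
  ∑ (K * t) f + ∑ t (λ i → f (i + K * t))        ≡⟨ cong (_+ ∑ t (λ i → f (i + K * t))) (∑-residues t K f) ⟩
  ∑ t (λ i → ∑ K (λ k → f (i + k * t))) + ∑ t (λ i → f (i + K * t))
    ≡⟨ ∑-distrib-+ t (λ i → ∑ K (λ k → f (i + k * t))) (λ i → f (i + K * t)) ⟨
  ∑ t (λ i → ∑ (suc K) (λ k → f (i + k * t)))    ∎
  where open ≡-Reasoning

∑-part : ∀ n xs → length xs ≡ n → ∑ n (part xs) ≡ sum xs
∑-part zero    []       _  = refl
∑-part (suc n) (x ∷ xs) eq = begin
  ∑ (suc n) (part (x ∷ xs))        ≡⟨ cong (λ z → ∑ z (part (x ∷ xs))) (ℕₚ.+-comm 1 n) ⟩
  ∑ (n + 1) (part (x ∷ xs))        ≡⟨ ∑-split 1 n (part (x ∷ xs)) ⟩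
  x + ∑ n (λ i → part (x ∷ xs) (i + 1))
    ≡⟨ cong (x ℕ.+_) (∑-cong n λ {i} _ → cong (part (x ∷ xs)) (ℕₚ.+-comm i 1)) ⟩
  x + ∑ n (part xs)                ≡⟨ cong (x ℕ.+_) (∑-part n xs (ℕₚ.suc-injective eq)) ⟩
  x + sum xs                       ∎
  where open ≡-Reasoning

part-applyUpTo : ∀ f {n i} → i < n → part (applyUpTo f n) i ≡ f i
part-applyUpTo f {suc n} {zero}  _         = refl
part-applyUpTo f {suc n} {suc i} (s≤s i<n) = part-applyUpTo (f ∘ suc) i<n

𝟙 : ∀ {A : Set} → Dec A → ℕ
𝟙 (yes _) = 1
𝟙 (no _)  = 0

length-filter-downFrom : ∀ {Q : ℕ → Set} (Q? : Decidable Q) n →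
  length (filter Q? (downFrom n)) ≡ ∑ n (𝟙 ∘ Q?)
length-filter-downFrom Q? zero    = refl
length-filter-downFrom Q? (suc n) with Q? n
... | yes _ = trans (cong suc (length-filter-downFrom Q? n)) (ℕₚ.+-comm 1 _)
... | no  _ = trans (length-filter-downFrom Q? n) (sym (ℕₚ.+-identityʳ _))

module _ {Q : ℕ → Set} (Q? : Decidable Q) where

  ∑-𝟙-≤ : ∀ K → ∑ K (𝟙 ∘ Q?) ≤ K
  ∑-𝟙-≤ zero    = z≤n
  ∑-𝟙-≤ (suc K) with Q? K
  ... | yes _ = subst (_≤ suc K) (ℕₚ.+-comm 1 _) (s≤s (∑-𝟙-≤ K))
  ... | no  _ = subst (_≤ suc K) (sym (ℕₚ.+-identityʳ _)) (ℕₚ.m≤n⇒m≤1+n (∑-𝟙-≤ K))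

  ∑-𝟙-all : ∀ K → (∀ {k} → k < K → Q k) → ∑ K (𝟙 ∘ Q?) ≡ K
  ∑-𝟙-all zero    all = refl
  ∑-𝟙-all (suc K) all with Q? K
  ... | yes _ = trans (cong (_+ 1) (∑-𝟙-all K (all ∘ ℕₚ.m<n⇒m<1+n))) (ℕₚ.+-comm K 1)
  ... | no ¬q = contradiction (all ℕₚ.≤-refl) ¬q

  module _ (down : ∀ {k} → Q (suc k) → Q k) where

    down* : ∀ {j k} → j ≤ k → Q k → Q j
    down* j≤k = go (ℕₚ.≤⇒≤′ j≤k)
      where
      go : ∀ {j k} → j ℕ.≤′ k → Q k → Q j
      go ℕ.≤′-refl       q = q
      go (ℕ.≤′-step j≤k) q = go j≤k (down q)

    -- A predicate closed under predecessors holds on an initial segment, so the count below K is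
    -- the length of that segment. This and the converse turn the closure of a core under
    -- subtraction of t into bead counts.
    ∑-𝟙-down⁺ : ∀ K {k} → k < K → Q k → k < ∑ K (𝟙 ∘ Q?)
    ∑-𝟙-down⁺ (suc K) {k} k<1+K q with Q? K
    ... | yes Q-K = subst (λ z → k < z + 1) (sym (∑-𝟙-all K λ j<K → down* (ℕₚ.<⇒≤ j<K) Q-K))
                      (subst (k <_) (ℕₚ.+-comm 1 K) k<1+K)
    ... | no ¬q with ℕₚ.m≤n⇒m<n∨m≡n (ℕ.s≤s⁻¹ k<1+K)
    ...   | inj₁ k<K  = subst (k <_) (sym (ℕₚ.+-identityʳ _)) (∑-𝟙-down⁺ K k<K q)
    ...   | inj₂ refl = contradiction q ¬q

    ∑-𝟙-down⁻ : ∀ K {k} → k < ∑ K (𝟙 ∘ Q?) → Q k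
    ∑-𝟙-down⁻ (suc K) {k} k< with Q? K
    ... | yes Q-K = down* (ℕ.s≤s⁻¹ (ℕₚ.<-≤-trans (subst (k <_) (ℕₚ.+-comm _ 1) k<) (s≤s (∑-𝟙-≤ K)))) Q-K
    ... | no  _   = ∑-𝟙-down⁻ K (subst (k <_) (ℕₚ.+-identityʳ _) k<)

∑-𝟙-< : ∀ {Q : ℕ → Set} (Q? : Decidable Q) K {c} → c ≤ K →
  (∀ {k} → k < K → Q k → k < c) → (∀ {k} → k < c → Q k) → ∑ K (𝟙 ∘ Q?) ≡ c
∑-𝟙-< Q? zero    z≤n  to from = refl
∑-𝟙-< Q? (suc K) {c} c≤1+K to from with Q? K
... | yes q = trans (cong (_+ 1) (∑-𝟙-all Q? K λ k<K → from (ℕₚ.<-trans k<K (to ℕₚ.≤-refl q))))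
                (trans (ℕₚ.+-comm K 1) (ℕₚ.≤-antisym (to ℕₚ.≤-refl q) c≤1+K))
... | no ¬q = trans (ℕₚ.+-identityʳ _) (∑-𝟙-< Q? K (ℕₚ.≮⇒≥ (¬q ∘ from)) (to ∘ ℕₚ.m<n⇒m<1+n) from)

-- Partitions and strictly decreasing lists

Decreasing : List ℕ → Set
Decreasing = AllPairs _>_

-- Each head is the maximum of its list, so the heads agree; strictness keeps them out of the tails,
-- where the argument repeats.
decreasing-ext : ∀ {xs ys} → Decreasing xs → Decreasing ys →
  (∀ {x} → x ∈ xs → x ∈ ys) → (∀ {x} → x ∈ ys → x ∈ xs) → xs ≡ ys
decreasing-ext {[]}     {[]}     _ _ to from = refl
decreasing-ext {[]}     {y ∷ ys} _ _ to from with () ← from (here refl)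
decreasing-ext {x ∷ xs} {[]}     _ _ to from with () ← to (here refl)
decreasing-ext {x ∷ xs} {y ∷ ys} (x> ∷ dx) (y> ∷ dy) to from
  with heads
  where
  le : ∀ {z w ws} → All (w >_) ws → z ∈ w ∷ ws → z ≤ w
  le w> (here refl) = ℕₚ.≤-refl
  le w> (there z∈)  = ℕₚ.<⇒≤ (All.lookup w> z∈)
  heads : x ≡ y
  heads = ℕₚ.≤-antisym (le y> (to (here refl))) (le x> (from (here refl)))
... | refl = cong (x ∷_) (decreasing-ext dx dy (tails x> to) (tails y> from))
  where
  tails : ∀ {xs ys} → All (x >_) xs → (∀ {z} → z ∈ x ∷ xs → z ∈ x ∷ ys) → ∀ {z} → z ∈ xs → z ∈ ys
  tails x> to z∈ with to (there z∈)
  ... | there z∈′ = z∈′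
  ... | here refl = contradiction (All.lookup x> z∈) (ℕₚ.<-irrefl refl)

filter-downFrom-decreasing : ∀ {Q : ℕ → Set} (Q? : Decidable Q) n → Decreasing (filter Q? (downFrom n))
filter-downFrom-decreasing Q? n = AllPairsₚ.filter⁺ Q? (AllPairsₚ.applyDownFrom⁺₁ id n λ j<i _ → j<i)

drop-linked : ∀ {lam} → Linked _≥_ lam → Linked _≥_ (drop 1 lam)
drop-linked []        = []
drop-linked [-]       = []
drop-linked (_ ∷ dec) = dec

beta-decreasing : ∀ r {lam} → Linked _≥_ lam → Decreasing (beta r lam)
beta-decreasing zero    dec = []
beta-decreasing (suc r) {lam} dec = All.tabulate below-head ∷ beta-decreasing r (drop-linked dec)
  where
  below-head : ∀ {x} → x ∈ beta r (drop 1 lam) → x < part lam 0 + r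
  below-head {x} x∈ with ∈-beta⁻ r (drop 1 lam) x∈
  ... | i , _ , eq = begin
    suc x                     ≤⟨ s≤s (ℕₚ.m≤m+n x i) ⟩
    suc (x + i)               ≡⟨ ℕₚ.+-suc x i ⟨
    x + suc i                 ≡⟨ eq ⟨
    part (drop 1 lam) i + r   ≡⟨ cong (_+ r) (part-drop lam i) ⟩
    part lam (suc i) + r      ≤⟨ ℕₚ.+-monoˡ-≤ r (part-antitone dec z≤n) ⟩
    part lam 0 + r            ∎
    where open ℕₚ.≤-Reasoning

beta-bounded : ∀ r {lam s} → Linked _≥_ lam → part lam 0 ≤ s → ∀ {x} → x ∈ beta r lam → x < r + s
beta-bounded r {lam} {s} dec ≤s {x} x∈ with ∈-beta⁻ r lam x∈
... | i , _ , eq = begin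
  suc x             ≤⟨ s≤s (ℕₚ.m≤m+n x i) ⟩
  suc (x + i)       ≡⟨ ℕₚ.+-suc x i ⟨
  x + suc i         ≡⟨ eq ⟨
  part lam i + r    ≤⟨ ℕₚ.+-monoˡ-≤ r (ℕₚ.≤-trans (part-antitone dec z≤n) ≤s) ⟩
  s + r             ≡⟨ ℕₚ.+-comm s r ⟩
  r + s             ∎
  where open ℕₚ.≤-Reasoning

length-beta : ∀ r lam → length (beta r lam) ≡ r
length-beta zero    lam = refl
length-beta (suc r) lam = cong suc (length-beta r (drop 1 lam))

beta-injective : ∀ r {lam nu} → IsPartition lam → IsPartition nu → length lam ≤ r → length nu ≤ r →
  beta r lam ≡ beta r nu → lam ≡ nu
beta-injective r       {[]}       {[]}      _ _ _ _ eq = refl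
beta-injective (suc r) {[]}       {y ∷ nu}  _ (_ , y>0 ∷ _) _ _ eq =
  contradiction (ℕₚ.+-cancelʳ-≡ r 0 y (Listₚ.∷-injectiveˡ eq)) (ℕₚ.<⇒≢ y>0)
beta-injective (suc r) {x ∷ lam} {[]}       (_ , x>0 ∷ _) _ _ _ eq =
  contradiction (ℕₚ.+-cancelʳ-≡ r 0 x (sym (Listₚ.∷-injectiveˡ eq))) (ℕₚ.<⇒≢ x>0)
beta-injective (suc r) {x ∷ lam} {y ∷ nu} (dx , _ ∷ px) (dy , _ ∷ py) (s≤s lx) (s≤s ly) eq =
  cong₂ _∷_ (ℕₚ.+-cancelʳ-≡ r x y (Listₚ.∷-injectiveˡ eq))
    (beta-injective r (Linked.tail dx , px) (Linked.tail dy , py) lx ly (Listₚ.∷-injectiveʳ eq))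

-- Subtracting from each entry the number of entries after it gives the parts, and strict decrease
-- makes them weakly decreasing. If the head yields a zero part, then so do all later entries, and
-- the partition is empty.
beta-surjective : ∀ {xs} → Decreasing xs →
  ∃ λ lam → IsPartition lam × length lam ≤ length xs × beta (length xs) lam ≡ xs
beta-surjective []                       = [] , ([] , []) , z≤n , refl
beta-surjective {x ∷ xs} (x> ∷ dec) with beta-surjective dec
... | lam , (dlam , plam) , len , eq = prepend (x ∸ r) (ℕₚ.m∸n+n≡m r≤x)
  where
  r = length xs

  head-bound : ∀ r xs → length xs ≡ r → beta r lam ≡ xs → All (x >_) xs → part lam 0 + r ≤ x ⊎ r ≡ 0
  head-bound zero    xs       _  _    _        = inj₂ refl
  head-bound (suc r) (y ∷ ys) _  refl (x>y ∷ _) = inj₁ (subst (_≤ x) (sym (ℕₚ.+-suc (part lam 0) r)) x>y)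

  first : part lam 0 + r ≤ x
  first with head-bound r xs refl eq x>
  ... | inj₁ le  = le
  ... | inj₂ r≡0 = subst (_≤ x) (sym (cong₂ _+_ (part-beyond lam (subst (length lam ≤_) r≡0 len)) r≡0)) z≤n

  r≤x : r ≤ x
  r≤x = ℕₚ.≤-trans (ℕₚ.m≤n+m r (part lam 0)) first

  empty : part lam 0 ≤ 0 → All (0 <_) lam → lam ≡ []
  empty _  []         = refl
  empty le (0<a ∷ _)  = contradiction 0<a (ℕₚ.≤⇒≯ le)

  prepend : ∀ a → a + r ≡ x → ∃ λ nu → IsPartition nu × length nu ≤ suc r × beta (suc r) nu ≡ x ∷ xs
  prepend a a+r≡x with ℕₚ.+-cancelʳ-≤ r (part lam 0) a (subst (part lam 0 + r ≤_) (sym a+r≡x) first)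
  prepend (suc a) a+r≡x | le =
    suc a ∷ lam , (linked-∷ lam dlam le , s≤s z≤n ∷ plam) , s≤s len , cong₂ _∷_ a+r≡x eq
  prepend zero    a+r≡x | le = [] , ([] , []) , z≤n ,
    cong₂ _∷_ a+r≡x (trans (cong (beta r) (sym (empty le plam))) eq)

-- Bounded tuples and the abacus

tuples : ℕ → ℕ → ℕ → List (List ℕ)
tuples zero    c zero    = [] ∷ []
tuples zero    c (suc r) = []
-- The bound `c ⊓ r` on the first entry keeps `r ∸ a` an exact subtraction; otherwise tuples with
-- too large a sum would be listed.
tuples (suc t) c r       = concatMap (λ a → map (a ∷_) (tuples t c (r ∸ a))) (upTo (suc (c ⊓ r)))

∈-tuples⁺ : ∀ t {c r n} → length n ≡ t → All (_≤ c) n → sum n ≡ r → n ∈ tuples t c r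
∈-tuples⁺ zero    {n = []}    _  _          refl = here refl
∈-tuples⁺ (suc t) {n = a ∷ n} eq (a≤c ∷ ≤c) refl = ∈-concatMap⁺ _
  (lose (∈-upTo⁺ (s≤s (ℕₚ.⊓-glb a≤c (ℕₚ.m≤m+n a (sum n)))))
    (∈-map⁺ (a ∷_) (∈-tuples⁺ t (ℕₚ.suc-injective eq) ≤c (sym (ℕₚ.m+n∸m≡n a (sum n))))))

∈-tuples⁻ : ∀ t {c r n} → n ∈ tuples t c r → length n ≡ t × All (_≤ c) n × sum n ≡ r
∈-tuples⁻ zero    {r = zero} (here refl) = refl , [] , refl
∈-tuples⁻ (suc t) {c} {r} n∈
  with find (∈-concatMap⁻ (λ a → map (a ∷_) (tuples t c (r ∸ a))) {xs = upTo (suc (c ⊓ r))} n∈)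
... | a , a∈ , q with ∈-map⁻ (a ∷_) q
... | n , n∈′ , refl with ∈-tuples⁻ t n∈′ | ℕ.s≤s⁻¹ (∈-upTo⁻ a∈)
... | len , ≤c , sum≡ | a≤ = cong suc len , ℕₚ.≤-trans a≤ (ℕₚ.m⊓n≤m c r) ∷ ≤c ,
  trans (cong (a ℕ.+_) sum≡) (ℕₚ.m+[n∸m]≡n (ℕₚ.≤-trans a≤ (ℕₚ.m⊓n≤n c r)))

tuples-unique : ∀ t c r → Unique (tuples t c r)
tuples-unique zero    c zero    = [] ∷ []
tuples-unique zero    c (suc r) = []
tuples-unique (suc t) c r       = Uniqueₚ.concat⁺
  (Allₚ.map⁺ (All.tabulate λ {a} _ → Uniqueₚ.map⁺ Listₚ.∷-injectiveʳ (tuples-unique t c (r ∸ a))))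
  (AllPairsₚ.map⁺ (AllPairs.map disjoint (Uniqueₚ.upTo⁺ (suc (c ⊓ r)))))
  where
  disjoint : ∀ {a b} → a ≢ b →
    Disjoint (map (a ∷_) (tuples t c (r ∸ a))) (map (b ∷_) (tuples t c (r ∸ b)))
  disjoint {a} {b} a≢b (p , q) with ∈-map⁻ (a ∷_) p | ∈-map⁻ (b ∷_) q
  ... | _ , _ , refl | _ , _ , e = a≢b (Listₚ.∷-injectiveˡ e)

part-ext : ∀ {t} m n → length m ≡ t → length n ≡ t → (∀ {i} → i < t → part m i ≡ part n i) → m ≡ n
part-ext {zero}  []      []      _  _  eq = refl
part-ext {suc t} (a ∷ m) (b ∷ n) lm ln eq = cong₂ _∷_ (eq (s≤s z≤n))
  (part-ext m n (ℕₚ.suc-injective lm) (ℕₚ.suc-injective ln) (eq ∘ s≤s))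

part-≤ : ∀ {c n} → All (_≤ c) n → ∀ i → part n i ≤ c
part-≤ []         i       = z≤n
part-≤ (a≤c ∷ _)  zero    = a≤c
part-≤ (_ ∷ ≤c)   (suc i) = part-≤ ≤c i

-- On the i-th runner of the t-abacus the beads of xs occupy exactly the first
-- part n i positions.
Runners : ℕ → List ℕ → List ℕ → Set
Runners t xs n = ∀ {i} k → i < t → (i + k * t ∈ xs → k < part n i) × (k < part n i → i + k * t ∈ xs)

module Abacus (t : ℕ) {{_ : NonZero t}} where

  0<t : 0 < t
  0<t = ℕ.>-nonZero⁻¹ t

  x≡x%t+x/t*t : ∀ x → x ≡ x ℕ÷.% t + (x ℕ÷./ t) * t
  x≡x%t+x/t*t x = ℕ÷.m≡m%n+[m/n]*n x t

  runners⇒∈ : ∀ {xs ys n} → Runners t xs n → Runners t ys n → ∀ {x} → x ∈ xs → x ∈ ys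
  runners⇒∈ {xs} {ys} rx ry {x} x∈ = subst (_∈ ys) (sym (x≡x%t+x/t*t x))
    (proj₂ (ry (x ℕ÷./ t) (ℕ÷.m%n<n x t))
      (proj₁ (rx (x ℕ÷./ t) (ℕ÷.m%n<n x t)) (subst (_∈ xs) (x≡x%t+x/t*t x) x∈)))

  runners⇒closed : ∀ {xs n} → Runners t xs n → Closed t xs
  runners⇒closed {xs} {n} run {x} x+t∈ = subst (_∈ xs) (sym (x≡x%t+x/t*t x))
    (proj₂ (run (x ℕ÷./ t) (ℕ÷.m%n<n x t)) (ℕₚ.<⇒≤
      (proj₁ (run (suc (x ℕ÷./ t)) (ℕ÷.m%n<n x t)) (subst (_∈ xs) eq x+t∈))))
    where
    open ℕ-Solver
    eq : x + t ≡ x ℕ÷.% t + suc (x ℕ÷./ t) * t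
    eq = trans (cong (_+ t) (x≡x%t+x/t*t x))
      (solve 3 (λ a b c → a :+ b :+ c := a :+ (c :+ b)) refl (x ℕ÷.% t) (x ℕ÷./ t * t) t)

  runners-injective : ∀ {xs m n} → length m ≡ t → length n ≡ t → Runners t xs m → Runners t xs n → m ≡ n
  runners-injective {xs} {m} {n} lm ln rm rn = part-ext m n lm ln λ i<t →
    ℕₚ.≤-antisym (half {m} {n} rm rn i<t) (half {n} {m} rn rm i<t)
    where
    half : ∀ {m n} → Runners t xs m → Runners t xs n → ∀ {i} → i < t → part m i ≤ part n i
    half {m} {n} rm rn {i} i<t = ℕₚ.≮⇒≥ λ lt →
      ℕₚ.<-irrefl refl (proj₁ (rn (part n i) i<t) (proj₂ (rm (part n i) i<t) lt))

  Occupied : List ℕ → ℕ → Set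
  Occupied n x = x ℕ÷./ t < part n (x ℕ÷.% t)

  occupied? : ∀ n → Decidable (Occupied n)
  occupied? n x = x ℕ÷./ t ℕ.<? part n (x ℕ÷.% t)

  module _ (r s : ℕ) where

    cores : List (List ℕ)
    cores = filter (isCore? t) (partitionsInBox r s)

    core-tuple : ∀ {lam} → lam ∈ cores →
      ∃ λ n → n ∈ tuples t (suc ((r + s) ℕ÷./ t)) r × Runners t (beta r lam) n
    core-tuple {lam} lam∈ with ∈-filter⁻ (isCore? t) {xs = partitionsInBox r s} lam∈
    ... | lam∈box , core with ∈-partitionsInBox⁻ {r} {s} lam∈box
    ... | plam , len , ≤s = n , ∈-tuples⁺ t (Listₚ.length-applyUpTo beads t) capped total , runners
      where
      -- All beads lie below r + s < K * t, so K positions on each runner suffice.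
      K = suc ((r + s) ℕ÷./ t)
      X = beta r lam
      On : ℕ → ℕ → Set
      On i k = i + k * t ∈ X
      on? : ∀ i → Decidable (On i)
      on? i k = DecMembership._∈?_ ℕ._≟_ (i + k * t) X

      down : ∀ {i k} → On i (suc k) → On i k
      down {i} {k} = core⇒closed 0<t plam len core ∘ subst (_∈ X)
        (solve 3 (λ a b c → a :+ (c :+ b) := a :+ b :+ c) refl i (k * t) t)
        where open ℕ-Solver

      beads : ℕ → ℕ
      beads i = ∑ K (𝟙 ∘ on? i)
      n = applyUpTo beads t

      below-K : ∀ {i k} → On i k → k < K
      below-K {i} {k} on = s≤s (begin
        k                       ≡⟨ ℕ÷.m*n/n≡m k t ⟨
        k * t ℕ÷./ t
          ≤⟨ ℕ÷./-monoˡ-≤ t (ℕₚ.≤-trans (ℕₚ.m≤n+m (k * t) i) (ℕₚ.<⇒≤ (beta-bounded r (proj₁ plam) ≤s on))) ⟩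
        (r + s) ℕ÷./ t          ∎)
        where open ℕₚ.≤-Reasoning

      runners : Runners t X n
      runners {i} k i<t rewrite part-applyUpTo beads i<t =
        (λ on → ∑-𝟙-down⁺ (on? i) (λ {j} → down {i} {j}) K (below-K {i} on) on) ,
        ∑-𝟙-down⁻ (on? i) (λ {j} → down {i} {j}) K

      capped : All (_≤ K) n
      capped = Allₚ.applyUpTo⁺₂ beads t λ i → ∑-𝟙-≤ (on? i) K

      ∈X? : Decidable (_∈ X)
      ∈X? x = DecMembership._∈?_ ℕ._≟_ x X

      X<K*t : ∀ {x} → x ∈ X → x < K * t
      X<K*t {x} x∈ = ℕₚ.<-trans (beta-bounded r (proj₁ plam) ≤s x∈) (begin-strict
        r + s                                        ≡⟨ x≡x%t+x/t*t (r + s) ⟩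
        (r + s) ℕ÷.% t + ((r + s) ℕ÷./ t) * t        <⟨ ℕₚ.+-monoˡ-< _ (ℕ÷.m%n<n (r + s) t) ⟩
        K * t                                        ∎)
        where open ℕₚ.≤-Reasoning

      -- `X` is recovered as the decreasing list of its own elements below K * t. Its length thus
      -- becomes a sum of indicators, which can be regrouped by residues modulo t.
      total : sum n ≡ r
      total = begin
        sum n                                          ≡⟨ ∑-part t n (Listₚ.length-applyUpTo beads t) ⟨
        ∑ t (part n)                                   ≡⟨ ∑-cong t (part-applyUpTo beads) ⟩
        ∑ t (λ i → ∑ K (λ k → 𝟙 (∈X? (i + k * t))))    ≡⟨ ∑-residues t K (𝟙 ∘ ∈X?) ⟨
        ∑ (K * t) (𝟙 ∘ ∈X?)                            ≡⟨ length-filter-downFrom ∈X? (K * t) ⟨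
        length (filter ∈X? (downFrom (K * t)))
         
          ≡⟨ cong length (decreasing-ext (filter-downFrom-decreasing ∈X? (K * t)) (beta-decreasing r (proj₁ plam))
               (λ p → proj₂ (∈-filter⁻ ∈X? {xs = downFrom (K * t)} p))
               (λ p → ∈-filter⁺ ∈X? (∈-downFrom⁺ (X<K*t p)) p)) ⟩
        length X                                       ≡⟨ length-beta r lam ⟩
        r                                              ∎
        where open ≡-Reasoning

    -- Entries of at most q place all beads below q * t ≤ r + s, which is what keeps the largest
    -- part within s. The whole box of positions need not be a multiple of t, hence the smaller cap
    -- than in `core-tuple`.
    tuple-core : ∀ {n} → n ∈ tuples t ((r + s) ℕ÷./ t) r →
      ∃ λ lam → lam ∈ cores × Runners t (beta r lam) n
    tuple-core {n} n∈ with ∈-tuples⁻ t n∈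
    ... | len-n , ≤q , sum≡r with beta-surjective (filter-downFrom-decreasing (occupied? n) ((r + s) ℕ÷./ t * t))
    ... | lam , plam , len , eq = lam
      , ∈-filter⁺ (isCore? t)
          (∈-partitionsInBox⁺ plam len′ first)
          (closed⇒core 0<t plam len′ (runners⇒closed {n = n} runners))
      , runners
      where
      q = (r + s) ℕ÷./ t
      on? : Decidable (Occupied n)
      on? = occupied? n
      X = filter on? (downFrom (q * t))

      residue : ∀ {i} k → i < t → (i + k * t) ℕ÷.% t ≡ i
      residue {i} k i<t = trans (ℕ÷.[m+kn]%n≡m%n i k t) (ℕ÷.m<n⇒m%n≡m i<t)

      position : ∀ {i} k → i < t → (i + k * t) ℕ÷./ t ≡ k
      position {i} k i<t = ℕₚ.*-cancelʳ-≡ _ k t (ℕₚ.+-cancelˡ-≡ i _ _ (trans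
        (cong (_+ (i + k * t) ℕ÷./ t * t) (sym (residue k i<t))) (sym (x≡x%t+x/t*t (i + k * t)))))

      on⇒ : ∀ {i} k → i < t → Occupied n (i + k * t) → k < part n i
      on⇒ k i<t = subst₂ _<_ (position k i<t) (cong (part n) (residue k i<t))

      ⇒on : ∀ {i} k → i < t → k < part n i → Occupied n (i + k * t)
      ⇒on k i<t = subst₂ _<_ (sym (position k i<t)) (cong (part n) (sym (residue k i<t)))

      length-X : length X ≡ r
      length-X = begin
        length X                                         ≡⟨ length-filter-downFrom on? (q * t) ⟩
        ∑ (q * t) (𝟙 ∘ on?)                              ≡⟨ ∑-residues t q (𝟙 ∘ on?) ⟩
        ∑ t (λ i → ∑ q (λ k → 𝟙 (on? (i + k * t))))
         
          ≡⟨ ∑-cong t (λ {i} i<t → ∑-𝟙-< (λ k → on? (i + k * t)) q (part-≤ ≤q i)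
             (λ {k} _ → on⇒ k i<t) (λ {k} → ⇒on k i<t)) ⟩
        ∑ t (part n)                                     ≡⟨ ∑-part t n len-n ⟩
        sum n                                            ≡⟨ sum≡r ⟩
        r                                                ∎
        where open ≡-Reasoning

      beta≡X : beta r lam ≡ X
      beta≡X = subst (λ z → beta z lam ≡ X) length-X eq

      len′ : length lam ≤ r
      len′ = subst (length lam ≤_) length-X len

      qt≤ : q * t ≤ r + s
      qt≤ = ℕ÷.m/n*n≤m (r + s) t

      first : part lam 0 ≤ s
      first = head-bound r qt≤ beta≡X len′
        where
        head-bound : ∀ r′ → q * t ≤ r′ + s → beta r′ lam ≡ X → length lam ≤ r′ → part lam 0 ≤ s
        -- With no rows there is no bead to compare with, but the partition is then empty.
        head-bound zero     _    _  len = subst (_≤ s) (sym (part-beyond lam len)) z≤n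
        head-bound (suc r′) qt≤′ eq _   = ℕₚ.+-cancelʳ-≤ r′ _ _ (subst (part lam 0 + r′ ≤_) (ℕₚ.+-comm r′ s)
          (ℕ.s≤s⁻¹ (ℕₚ.<-≤-trans
            (∈-downFrom⁻ (proj₁ (∈-filter⁻ on? {xs = downFrom (q * t)}
              (subst (part lam 0 + r′ ∈_) eq (here refl))))) qt≤′)))

      runners : Runners t (beta r lam) n
      runners {i} k i<t rewrite beta≡X =
        (λ p → on⇒ k i<t (proj₂ (∈-filter⁻ on? {xs = downFrom (q * t)} p))) ,
        (λ lt → ∈-filter⁺ on? (∈-downFrom⁺ (begin-strict
           i + k * t          <⟨ ℕₚ.+-monoˡ-< (k * t) i<t ⟩
           suc k * t          ≤⟨ ℕₚ.*-monoˡ-≤ t (ℕₚ.<-≤-trans lt (part-≤ ≤q i)) ⟩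
           q * t              ∎)) (⇒on k i<t lt))
        where open ℕₚ.≤-Reasoning

    P-upper : P t r s ≤ length (tuples t (suc ((r + s) ℕ÷./ t)) r)
    P-upper = length-≤-by-relation (λ lam n → Runners t (beta r lam) n)
      (Uniqueₚ.filter⁺ (isCore? t) (partitionsInBox-unique r s)) core-tuple (λ {_} {_} {n} → same {n = n})
      where
      in-box : ∀ {lam} → lam ∈ cores → IsPartition lam × length lam ≤ r × part lam 0 ≤ s
      in-box lam∈ = ∈-partitionsInBox⁻ {r} {s} (proj₁ (∈-filter⁻ (isCore? t) {xs = partitionsInBox r s} lam∈))

      same : ∀ {lam nu n} → lam ∈ cores → nu ∈ cores →
        Runners t (beta r lam) n → Runners t (beta r nu) n → lam ≡ nu
      same {n = n} lam∈ nu∈ rl rn =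
        let plam , len-lam , _ = in-box lam∈
            pnu  , len-nu  , _ = in-box nu∈
        in beta-injective r plam pnu len-lam len-nu
             (decreasing-ext (beta-decreasing r (proj₁ plam)) (beta-decreasing r (proj₁ pnu))
               (runners⇒∈ {n = n} rl rn) (runners⇒∈ {n = n} rn rl))

    P-lower : length (tuples t ((r + s) ℕ÷./ t) r) ≤ P t r s
    P-lower = length-≤-by-relation (λ n lam → Runners t (beta r lam) n)
      (tuples-unique t _ r) tuple-core
      (λ {m} {n} m∈ n∈ rm rn → runners-injective {m = m} {n}
        (proj₁ (∈-tuples⁻ t m∈)) (proj₁ (∈-tuples⁻ t n∈)) rm rn)

length-tuples : ∀ t c r → length (tuples (suc t) c r) ≡ ∑ (suc (c ⊓ r)) (λ a → length (tuples t c (r ∸ a)))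
length-tuples t c r = trans (length-concatMap-upTo (λ a → map (a ∷_) (tuples t c (r ∸ a))) (suc (c ⊓ r)))
  (∑-cong (suc (c ⊓ r)) λ {a} _ → Listₚ.length-map (a ∷_) (tuples t c (r ∸ a)))

-- Inclusion–exclusion for bounded tuples

ι : ℕ → ℚ
ι n = + n / 1

toℚᵘ-/ : ∀ m n → ℚ.toℚᵘ (+ m / suc n) ℚᵘ.≃ ℚᵘ.mkℚᵘ (+ m) n
toℚᵘ-/ m n = ℚₚ.toℚᵘ-fromℚᵘ (ℚᵘ.mkℚᵘ (+ m) n)

ι-+ : ∀ m n → ι (m + n) ≡ ι m ℚ.+ ι n
ι-+ m n = ℚₚ.toℚᵘ-injective (begin
  ℚ.toℚᵘ (ι (m + n))                          ≈⟨ toℚᵘ-/ (m + n) 0 ⟩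
  ℚᵘ.mkℚᵘ (+ (m + n)) 0
    ≈⟨ ℚᵘ.*≡* (cong (ℤ._* + 1) (sym (cong₂ ℤ._+_ (ℤₚ.*-identityʳ (+ m)) (ℤₚ.*-identityʳ (+ n))))) ⟩
  ℚᵘ.mkℚᵘ (+ m) 0 ℚᵘ.+ ℚᵘ.mkℚᵘ (+ n) 0        ≈⟨ ℚᵘₚ.+-cong (toℚᵘ-/ m 0) (toℚᵘ-/ n 0) ⟨
  ℚ.toℚᵘ (ι m) ℚᵘ.+ ℚ.toℚᵘ (ι n)              ≈⟨ ℚₚ.toℚᵘ-homo-+ (ι m) (ι n) ⟨
  ℚ.toℚᵘ (ι m ℚ.+ ι n)                        ∎)
  where open ℚᵘₚ.≃-Reasoning

ι-* : ∀ m n → ι (m * n) ≡ ι m ℚ.* ι n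
ι-* m n = ℚₚ.toℚᵘ-injective (begin
  ℚ.toℚᵘ (ι (m * n))                          ≈⟨ toℚᵘ-/ (m * n) 0 ⟩
  ℚᵘ.mkℚᵘ (+ (m * n)) 0                       ≈⟨ ℚᵘ.*≡* (cong (ℤ._* + 1) (ℤₚ.pos-* m n)) ⟩
  ℚᵘ.mkℚᵘ (+ m) 0 ℚᵘ.* ℚᵘ.mkℚᵘ (+ n) 0        ≈⟨ ℚᵘₚ.*-cong (toℚᵘ-/ m 0) (toℚᵘ-/ n 0) ⟨
  ℚ.toℚᵘ (ι m) ℚᵘ.* ℚ.toℚᵘ (ι n)              ≈⟨ ℚₚ.toℚᵘ-homo-* (ι m) (ι n) ⟨
  ℚ.toℚᵘ (ι m ℚ.* ι n)                        ∎)
  where open ℚᵘₚ.≃-Reasoning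

/-*-cancel : ∀ m n .{{_ : NonZero n}} → (+ m / n) ℚ.* ι n ≡ ι m
/-*-cancel m (suc n) = ℚₚ.toℚᵘ-injective (begin
  ℚ.toℚᵘ ((+ m / suc n) ℚ.* ι (suc n))                ≈⟨ ℚₚ.toℚᵘ-homo-* (+ m / suc n) (ι (suc n)) ⟩
  ℚ.toℚᵘ (+ m / suc n) ℚᵘ.* ℚ.toℚᵘ (ι (suc n))        ≈⟨ ℚᵘₚ.*-cong (toℚᵘ-/ m n) (toℚᵘ-/ (suc n) 0) ⟩
  ℚᵘ.mkℚᵘ (+ m) n ℚᵘ.* ℚᵘ.mkℚᵘ (+ suc n) 0
    ≈⟨ ℚᵘ.*≡* (trans (ℤₚ.*-identityʳ _) (cong (λ z → + m ℤ.* + z) (sym (ℕₚ.*-identityʳ (suc n))))) ⟩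
  ℚᵘ.mkℚᵘ (+ m) 0                                     ≈⟨ toℚᵘ-/ m 0 ⟨
  ℚ.toℚᵘ (ι m)                                        ∎)
  where open ℚᵘₚ.≃-Reasoning

ι-mono-≤ : ∀ {m n} → m ≤ n → ι m ℚ.≤ ι n
ι-mono-≤ {m} {n} m≤n = ℚₚ.toℚᵘ-cancel-≤ (begin
  ℚ.toℚᵘ (ι m)       ≃⟨ toℚᵘ-/ m 0 ⟩
  ℚᵘ.mkℚᵘ (+ m) 0    ≤⟨ ℚᵘ.*≤* (ℤₚ.*-monoʳ-≤-nonNeg (+ 1) (ℤ.+≤+ m≤n)) ⟩
  ℚᵘ.mkℚᵘ (+ n) 0    ≃⟨ toℚᵘ-/ n 0 ⟨
  ℚ.toℚᵘ (ι n)       ∎)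
  where open ℚᵘₚ.≤-Reasoning

infixr 8 _^ℚ_
_^ℚ_ : ℚ → ℕ → ℚ
q ^ℚ zero  = 1ℚ
q ^ℚ suc n = q ℚ.* q ^ℚ n

-- The upper limit is included, as in Σ[_].
Σℚ : ℕ → (ℕ → ℚ) → ℚ
Σℚ zero    f = f 0
Σℚ (suc n) f = Σℚ n f ℚ.+ f (suc n)

Πℚ : ℕ → (ℕ → ℚ) → ℚ
Πℚ zero    f = 1ℚ
Πℚ (suc n) f = f n ℚ.* Πℚ n f

Σℚ-cong : ∀ n {f g} → (∀ i → f i ≡ g i) → Σℚ n f ≡ Σℚ n g
Σℚ-cong zero    eq = eq 0
Σℚ-cong (suc n) eq = cong₂ ℚ._+_ (Σℚ-cong n eq) (eq (suc n))

Πℚ-zero : ∀ n {f} → f 0 ≡ 0ℚ → Πℚ (suc n) f ≡ 0ℚ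
Πℚ-zero zero    {f} eq = trans (cong (ℚ._* 1ℚ) eq) (ℚₚ.*-zeroˡ 1ℚ)
Πℚ-zero (suc n) {f} eq = trans (cong (f (suc n) ℚ.*_) (Πℚ-zero n {f} eq)) (ℚₚ.*-zeroʳ (f (suc n)))

Σℚ-*ˡ : ∀ n c f → c ℚ.* Σℚ n f ≡ Σℚ n (λ i → c ℚ.* f i)
Σℚ-*ˡ zero    c f = refl
Σℚ-*ˡ (suc n) c f = trans (ℚₚ.*-distribˡ-+ c (Σℚ n f) (f (suc n))) (cong (ℚ._+ c ℚ.* f (suc n)) (Σℚ-*ˡ n c f))

-- Finite differences of sequences extended by zero

shift : ℕ → (ℕ → ℚ) → ℕ → ℚ
shift zero    f r       = f r
shift (suc d) f zero    = 0ℚ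
shift (suc d) f (suc r) = shift d f r

-- Backward difference with the value 0 understood at -1. On generating functions `shift d`
-- multiplies by x^d, `∇` by 1 - x, and `Δ` below by 1 - x^d. Keeping f 0 as the value at 0 is what
-- makes `∇` injective.
∇ : (ℕ → ℚ) → ℕ → ℚ
∇ f zero    = f 0
∇ f (suc r) = f (suc r) ℚ.- f r

shift-cong : ∀ d {f g} → f ≗ g → shift d f ≗ shift d g
shift-cong zero    eq r       = eq r
shift-cong (suc d) eq zero    = refl
shift-cong (suc d) eq (suc r) = shift-cong d eq r

shift-shift : ∀ d e f → shift d (shift e f) ≗ shift (d + e) f
shift-shift zero    e f r       = refl
shift-shift (suc d) e f zero    = refl
shift-shift (suc d) e f (suc r) = shift-shift d e f r

shift-* : ∀ d q f r → shift d (λ x → q ℚ.* f x) r ≡ q ℚ.* shift d f r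
shift-* zero    q f r       = refl
shift-* (suc d) q f zero    = sym (ℚₚ.*-zeroʳ q)
shift-* (suc d) q f (suc r) = shift-* d q f r

shift-+ : ∀ d f g r → shift d (λ x → f x ℚ.+ g x) r ≡ shift d f r ℚ.+ shift d g r
shift-+ zero    f g r       = refl
shift-+ (suc d) f g zero    = refl
shift-+ (suc d) f g (suc r) = shift-+ d f g r

shift-Σℚ : ∀ d n (F : ℕ → ℕ → ℚ) r → shift d (λ x → Σℚ n (λ j → F j x)) r ≡ Σℚ n (λ j → shift d (F j) r)
shift-Σℚ d zero    F r = refl
shift-Σℚ d (suc n) F r = trans (shift-+ d (λ x → Σℚ n (λ j → F j x)) (F (suc n)) r)
  (cong (ℚ._+ shift d (F (suc n)) r) (shift-Σℚ d n F r))

shift-< : ∀ {d r} f → r < d → shift d f r ≡ 0ℚ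
shift-< {suc d} {zero}  f _         = refl
shift-< {suc d} {suc r} f (s≤s r<d) = shift-< f r<d

shift-≥ : ∀ {d r} f → d ≤ r → shift d f r ≡ f (r ∸ d)
shift-≥ f z≤n       = refl
shift-≥ f (s≤s d≤r) = shift-≥ f d≤r

∇-injective : ∀ {f g} → ∇ f ≗ ∇ g → f ≗ g
∇-injective         eq zero    = eq 0
∇-injective {f} {g} eq (suc r) = begin
  f (suc r)                        ≡⟨ solve 2 (λ x y → x := (x :- y) :+ y) refl (f (suc r)) (f r) ⟩
  (f (suc r) ℚ.- f r) ℚ.+ f r      ≡⟨ cong₂ ℚ._+_ (eq (suc r)) (∇-injective eq r) ⟩
  (g (suc r) ℚ.- g r) ℚ.+ g r      ≡⟨ solve 2 (λ x y → x := (x :- y) :+ y) refl (g (suc r)) (g r) ⟨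
  g (suc r)                        ∎
  where
  open ≡-Reasoning
  open ℚ-Solver

∇-shift : ∀ d f → ∇ (shift d f) ≗ shift d (∇ f)
∇-shift zero    f r             = refl
∇-shift (suc d) f zero          = refl
∇-shift (suc d) f (suc zero)    = trans (ℚₚ.+-identityʳ (shift d f 0)) (∇-shift d f 0)
∇-shift (suc d) f (suc (suc r)) = ∇-shift d f (suc r)

∇-* : ∀ q f r → ∇ (λ x → q ℚ.* f x) r ≡ q ℚ.* ∇ f r
∇-* q f zero    = refl
∇-* q f (suc r) = solve 3 (λ q x y → q :* x :- q :* y := q :* (x :- y)) refl q (f (suc r)) (f r)
  where open ℚ-Solver

signed : ℕ → ℕ → ℚ
signed n j = (ℚ.- 1ℚ) ^ℚ j ℚ.* ι (n C j)

signed-suc : ∀ n j → signed (suc n) (suc j) ≡ signed n (suc j) ℚ.- signed n j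
signed-suc n j = begin
  (ℚ.- 1ℚ) ^ℚ suc j ℚ.* ι (suc n C suc j)
    ≡⟨ cong (λ z → (ℚ.- 1ℚ) ^ℚ suc j ℚ.* ι z) (nCk+nC[k+1]≡[n+1]C[k+1] n j) ⟨
  (ℚ.- 1ℚ) ^ℚ suc j ℚ.* ι (n C j + n C suc j)
    ≡⟨ cong ((ℚ.- 1ℚ) ^ℚ suc j ℚ.*_) (ι-+ (n C j) (n C suc j)) ⟩
  (ℚ.- 1ℚ) ^ℚ suc j ℚ.* (ι (n C j) ℚ.+ ι (n C suc j))
    ≡⟨ solve 3 (λ s x y → (:- con 1ℚ :* s) :* (x :+ y) := (:- con 1ℚ :* s) :* y :- s :* x) refl
         ((ℚ.- 1ℚ) ^ℚ j) (ι (n C j)) (ι (n C suc j)) ⟩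
  signed n (suc j) ℚ.- signed n j                    ∎
  where
  open ≡-Reasoning
  open ℚ-Solver

signed-> : ∀ {n j} → n < j → signed n j ≡ 0ℚ
signed-> {n} {j} n<j = trans (cong (λ z → (ℚ.- 1ℚ) ^ℚ j ℚ.* ι z) (k>n⇒nCk≡0 n<j)) (ℚₚ.*-zeroʳ ((ℚ.- 1ℚ) ^ℚ j))

-- Pascal's rule splits off a copy of the sum with its index moved by one. Cutting both copies at J
-- leaves the last term, which vanishes once n < J.
pascal-Σℚ : ∀ n J (G : ℕ → ℚ) →
  Σℚ J (λ j → signed (suc n) j ℚ.* G j) ≡
  Σℚ J (λ j → signed n j ℚ.* G j) ℚ.- Σℚ J (λ j → signed n j ℚ.* G (suc j)) ℚ.+ signed n J ℚ.* G (suc J)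
pascal-Σℚ n zero    G = solve 2 (λ a b → a := a :- b :+ b) refl (signed n 0 ℚ.* G 0) (signed n 0 ℚ.* G 1)
  where open ℚ-Solver
pascal-Σℚ n (suc J) G = trans
  (cong₂ (λ x s → x ℚ.+ s ℚ.* G (suc J)) (pascal-Σℚ n J G) (signed-suc n J))
  (rearrange (Σℚ J (λ j → signed n j ℚ.* G j)) (Σℚ J (λ j → signed n j ℚ.* G (suc j)))
    (signed n J) (signed n (suc J)) (G (suc J)) (G (suc (suc J))))
  where
  open ℚ-Solver
  rearrange : ∀ x y s s′ g g′ →
    x ℚ.- y ℚ.+ s ℚ.* g ℚ.+ (s′ ℚ.- s) ℚ.* g ≡ (x ℚ.+ s′ ℚ.* g) ℚ.- (y ℚ.+ s′ ℚ.* g′) ℚ.+ s′ ℚ.* g′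
  rearrange = solve 6 (λ x y s s′ g g′ →
    x :- y :+ s :* g :+ (s′ :- s) :* g := (x :+ s′ :* g) :- (y :+ s′ :* g′) :+ s′ :* g′) refl

module _ (d : ℕ) where

  Δ : (ℕ → ℚ) → ℕ → ℚ
  Δ f r = f r ℚ.- shift d f r

  Δ^ : ℕ → (ℕ → ℚ) → ℕ → ℚ
  Δ^ zero    f = f
  Δ^ (suc n) f = Δ (Δ^ n f)

  Δ-cong : ∀ {f g} → f ≗ g → Δ f ≗ Δ g
  Δ-cong eq r = cong₂ ℚ._-_ (eq r) (shift-cong d eq r)

  Δ^-cong : ∀ n {f g} → f ≗ g → Δ^ n f ≗ Δ^ n g
  Δ^-cong zero    eq = eq
  Δ^-cong (suc n) eq = Δ-cong (Δ^-cong n eq)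

  Δ-* : ∀ q f r → Δ (λ x → q ℚ.* f x) r ≡ q ℚ.* Δ f r
  Δ-* q f r rewrite shift-* d q f r =
    solve 3 (λ q x y → q :* x :- q :* y := q :* (x :- y)) refl q (f r) (shift d f r)
    where open ℚ-Solver

  Δ^-* : ∀ n q f r → Δ^ n (λ x → q ℚ.* f x) r ≡ q ℚ.* Δ^ n f r
  Δ^-* zero    q f r = refl
  Δ^-* (suc n) q f r = trans (Δ-cong (Δ^-* n q f) r) (Δ-* q (Δ^ n f) r)

  ∇-Δ : ∀ f → ∇ (Δ f) ≗ Δ (∇ f)
  ∇-Δ f zero    = cong (λ z → f 0 ℚ.- z) (∇-shift d f 0)
  ∇-Δ f (suc r) = trans
    (solve 4 (λ a b x y → (a :- x) :- (b :- y) := (a :- b) :- (x :- y)) refl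
      (f (suc r)) (f r) (shift d f (suc r)) (shift d f r))
    (cong (λ z → f (suc r) ℚ.- f r ℚ.- z) (∇-shift d f (suc r)))
    where open ℚ-Solver

  ∇-Δ^ : ∀ n f → ∇ (Δ^ n f) ≗ Δ^ n (∇ f)
  ∇-Δ^ zero    f r = refl
  ∇-Δ^ (suc n) f r = trans (∇-Δ (Δ^ n f) r) (Δ-cong (∇-Δ^ n f) r)

  -- This is the binomial theorem for (1 - x^d)^n. The upper limit J stays free because the sum will
  -- have to reach both the exponent t and the floor.
  Δ^-expand : ∀ n J f r → n ≤ J → Δ^ n f r ≡ Σℚ J (λ j → signed n j ℚ.* shift (j * d) f r)
  Δ^-expand zero    zero    f r _ = sym (ℚₚ.*-identityˡ (f r))
  Δ^-expand zero    (suc J) f r _ = trans (Δ^-expand zero J f r z≤n) (sym (trans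
    (cong (Σℚ J _ ℚ.+_) (trans (cong (ℚ._* shift (suc J * d) f r) (signed-> {0} {suc J} (s≤s z≤n)))
      (ℚₚ.*-zeroˡ (shift (suc J * d) f r))))
    (ℚₚ.+-identityʳ _)))
  Δ^-expand (suc n) J f r n<J = begin
    Δ^ n f r ℚ.- shift d (Δ^ n f) r
      ≡⟨ cong₂ ℚ._-_ (Δ^-expand n J f r (ℕₚ.<⇒≤ n<J))
           (trans (shift-cong d (λ x → Δ^-expand n J f x (ℕₚ.<⇒≤ n<J)) r)
             (trans (shift-Σℚ d J (λ j x → signed n j ℚ.* shift (j * d) f x) r)
               (Σℚ-cong J λ j → trans (shift-* d (signed n j) (shift (j * d) f) r)
                 (cong (signed n j ℚ.*_) (shift-shift d (j * d) f r))))) ⟩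
    X ℚ.- Y
      ≡⟨ solve 3 (λ x y g → x :- y := x :- y :+ con 0ℚ :* g) refl X Y (G (suc J)) ⟩
    X ℚ.- Y ℚ.+ 0ℚ ℚ.* G (suc J)
      ≡⟨ cong (λ z → X ℚ.- Y ℚ.+ z ℚ.* G (suc J)) (signed-> n<J) ⟨
    X ℚ.- Y ℚ.+ signed n J ℚ.* G (suc J)               ≡⟨ pascal-Σℚ n J G ⟨
    Σℚ J (λ j → signed (suc n) j ℚ.* G j)              ∎
    where
    open ≡-Reasoning
    open ℚ-Solver
    G : ℕ → ℚ
    G j = shift (j * d) f r
    X = Σℚ J (λ j → signed n j ℚ.* G j)
    Y = Σℚ J (λ j → signed n j ℚ.* G (suc j))

-- The product (x + 1)⋯(x + u), which is u! times the number of (u + 1)-tuples of naturals with sum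
-- x and no cap.
rising : ℕ → ℕ → ℚ
rising u x = Πℚ u (λ i → ι (x + suc i))

rising-front : ∀ u x → rising (suc u) x ≡ ι (suc x) ℚ.* rising u (suc x)
rising-front zero    x = cong (λ z → ι z ℚ.* 1ℚ) (ℕₚ.+-comm x 1)
rising-front (suc u) x = begin
  ι (x + suc (suc u)) ℚ.* rising (suc u) x
    ≡⟨ cong₂ ℚ._*_ (cong ι (ℕₚ.+-suc x (suc u))) (rising-front u x) ⟩
  ι (suc x + suc u) ℚ.* (ι (suc x) ℚ.* rising u (suc x))
   
    ≡⟨ solve 3 (λ a b c → a :* (b :* c) := b :* (a :* c)) refl
         (ι (suc x + suc u)) (ι (suc x)) (rising u (suc x)) ⟩
  ι (suc x) ℚ.* rising (suc u) (suc x)                          ∎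
  where
  open ≡-Reasoning
  open ℚ-Solver

∇-rising : ∀ u x → ∇ (rising (suc u)) x ≡ ι (suc u) ℚ.* rising u x
∇-rising u zero    = refl
∇-rising u (suc x) = begin
  ι (suc x + suc u) ℚ.* rising u (suc x) ℚ.- rising (suc u) x
    ≡⟨ cong₂ (λ y z → y ℚ.* rising u (suc x) ℚ.- z) (ι-+ (suc x) (suc u)) (rising-front u x) ⟩
  (ι (suc x) ℚ.+ ι (suc u)) ℚ.* rising u (suc x) ℚ.- ι (suc x) ℚ.* rising u (suc x)
    ≡⟨ solve 3 (λ a b c → (a :+ b) :* c :- a :* c := b :* c) refl (ι (suc x)) (ι (suc u)) (rising u (suc x)) ⟩
  ι (suc u) ℚ.* rising u (suc x)  ∎
  where
  open ≡-Reasoning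
  open ℚ-Solver

-- If r < p, the factor with i = 0 vanishes on the right.
shift-rising : ∀ u p r → shift p (rising (suc u)) r ≡ Πℚ (suc u) (λ i → ι (r + suc i ∸ p))
shift-rising u zero    r       = refl
shift-rising u (suc p) zero    = sym (Πℚ-zero u {λ i → ι (suc i ∸ suc p)} (cong ι (ℕₚ.0∸n≡0 p)))
shift-rising u (suc p) (suc r) = shift-rising u p r

-- Recurrences for the number of bounded tuples

∑-front : ∀ n f → ∑ (suc n) f ≡ f 0 + ∑ n (f ∘ suc)
∑-front n f = trans (cong (λ z → ∑ z f) (ℕₚ.+-comm 1 n)) (trans (∑-split 1 n f)
  (cong (f 0 ℕ.+_) (∑-cong n λ {i} _ → cong f (ℕₚ.+-comm i 1))))

module _ (c : ℕ) where

  tuples-from-0 : ∀ t → length (tuples (suc t) c 0) ≡ length (tuples t c 0)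
  tuples-from-0 t = trans (length-tuples t c 0)
    (cong (λ z → ∑ (suc z) (λ a → length (tuples t c (0 ∸ a)))) (ℕₚ.⊓-zeroʳ c))

  tuples-below-cap : ∀ t {r} → r < c →
    length (tuples (suc t) c (suc r)) ≡ length (tuples t c (suc r)) + length (tuples (suc t) c r)
  tuples-below-cap t {r} r<c = begin
    length (tuples (suc t) c (suc r))                 ≡⟨ length-tuples t c (suc r) ⟩
    ∑ (suc (c ⊓ suc r)) (λ a → L (suc r ∸ a))
      ≡⟨ cong (λ z → ∑ (suc z) (λ a → L (suc r ∸ a))) (ℕₚ.m≥n⇒m⊓n≡n r<c) ⟩
    ∑ (suc (suc r)) (λ a → L (suc r ∸ a))             ≡⟨ ∑-front (suc r) (λ a → L (suc r ∸ a)) ⟩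
    L (suc r) + ∑ (suc r) (λ a → L (r ∸ a))
      ≡⟨ cong (λ z → L (suc r) + ∑ (suc z) (λ a → L (r ∸ a))) (ℕₚ.m≥n⇒m⊓n≡n (ℕₚ.<⇒≤ r<c)) ⟨
    L (suc r) + ∑ (suc (c ⊓ r)) (λ a → L (r ∸ a))     ≡⟨ cong (L (suc r) ℕ.+_) (length-tuples t c r) ⟨
    L (suc r) + length (tuples (suc t) c r)           ∎
    where
    open ≡-Reasoning
    L : ℕ → ℕ
    L x = length (tuples t c x)

  -- Lowering a positive first entry by one turns tuples of sum r + 1 into tuples of sum r whose
  -- first entry is not c. The summand with `r ∸ c` supplies the missing ones, and a first entry 0
  -- accounts for the other summand on the right.
  tuples-above-cap : ∀ t {r} → c ≤ r →
    length (tuples (suc t) c (suc r)) + length (tuples t c (r ∸ c)) ≡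
    length (tuples t c (suc r)) + length (tuples (suc t) c r)
  tuples-above-cap t {r} c≤r = begin
    length (tuples (suc t) c (suc r)) + L (r ∸ c)
      ≡⟨ cong (_+ L (r ∸ c)) (length-tuples t c (suc r)) ⟩
    ∑ (suc (c ⊓ suc r)) (λ a → L (suc r ∸ a)) + L (r ∸ c)
      ≡⟨ cong (λ z → ∑ (suc z) (λ a → L (suc r ∸ a)) + L (r ∸ c)) (ℕₚ.m≤n⇒m⊓n≡m (ℕₚ.m≤n⇒m≤1+n c≤r)) ⟩
    ∑ (suc c) (λ a → L (suc r ∸ a)) + L (r ∸ c)
      ≡⟨ cong (_+ L (r ∸ c)) (∑-front c (λ a → L (suc r ∸ a))) ⟩
    L (suc r) + ∑ c (λ a → L (r ∸ a)) + L (r ∸ c)               ≡⟨ ℕₚ.+-assoc (L (suc r)) _ _ ⟩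
    L (suc r) + ∑ (suc c) (λ a → L (r ∸ a))
      ≡⟨ cong (λ z → L (suc r) + ∑ (suc z) (λ a → L (r ∸ a))) (ℕₚ.m≤n⇒m⊓n≡m c≤r) ⟨
    L (suc r) + ∑ (suc (c ⊓ r)) (λ a → L (r ∸ a))
      ≡⟨ cong (L (suc r) ℕ.+_) (length-tuples t c r) ⟨
    L (suc r) + length (tuples (suc t) c r)                     ∎
    where
    open ≡-Reasoning
    L : ℕ → ℕ
    L x = length (tuples t c x)

  #tuples : ℕ → ℕ → ℚ
  #tuples t r = ι (length (tuples t c r))

  -- One more entry multiplies the generating function by (1 - x^(c+1))/(1 - x); the denominator is
  -- moved to the left as `∇`.
  ∇-#tuples : ∀ t → ∇ (#tuples (suc t)) ≗ Δ (suc c) (#tuples t)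
  ∇-#tuples t zero    = trans (cong ι (tuples-from-0 t)) (sym (ℚₚ.+-identityʳ (#tuples t 0)))
  ∇-#tuples t (suc r) = step (ℕₚ.<-≤-connex r c)
    where
    open ≡-Reasoning
    open ℚ-Solver
    below : ∀ x y → x ℚ.+ y ℚ.- y ≡ x ℚ.- 0ℚ
    below = solve 2 (λ x y → x :+ y :- y := x :- con 0ℚ) refl

    above : ∀ x y z w → x ℚ.+ y ≡ z ℚ.+ w → x ℚ.- w ≡ z ℚ.- y
    above x y z w eq = trans (solve 3 (λ x y w → x :- w := (x :+ y) :- (y :+ w)) refl x y w)
      (trans (cong (λ v → v ℚ.- (y ℚ.+ w)) eq) (solve 3 (λ y z w → (z :+ w) :- (y :+ w) := z :- y) refl y z w))

    step : r < c ⊎ c ≤ r →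
      #tuples (suc t) (suc r) ℚ.- #tuples (suc t) r ≡ #tuples t (suc r) ℚ.- shift c (#tuples t) r
    step (inj₁ r<c) = begin
      #tuples (suc t) (suc r) ℚ.- #tuples (suc t) r
        ≡⟨ cong (λ z → z ℚ.- #tuples (suc t) r) (trans (cong ι (tuples-below-cap t r<c))
             (ι-+ (length (tuples t c (suc r))) (length (tuples (suc t) c r)))) ⟩
      #tuples t (suc r) ℚ.+ #tuples (suc t) r ℚ.- #tuples (suc t) r
        ≡⟨ below (#tuples t (suc r)) (#tuples (suc t) r) ⟩
      #tuples t (suc r) ℚ.- 0ℚ
        ≡⟨ cong (λ z → #tuples t (suc r) ℚ.- z) (shift-< (#tuples t) r<c) ⟨
      #tuples t (suc r) ℚ.- shift c (#tuples t) r  ∎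
    step (inj₂ c≤r) = begin
      #tuples (suc t) (suc r) ℚ.- #tuples (suc t) r
        ≡⟨ above (#tuples (suc t) (suc r)) (#tuples t (r ∸ c)) (#tuples t (suc r)) (#tuples (suc t) r)
             (trans (sym (ι-+ (length (tuples (suc t) c (suc r))) (length (tuples t c (r ∸ c)))))
               (trans (cong ι (tuples-above-cap t c≤r))
                 (ι-+ (length (tuples t c (suc r))) (length (tuples (suc t) c r))))) ⟩
      #tuples t (suc r) ℚ.- #tuples t (r ∸ c)
        ≡⟨ cong (λ z → #tuples t (suc r) ℚ.- z) (shift-≥ (#tuples t) c≤r) ⟨
      #tuples t (suc r) ℚ.- shift c (#tuples t) r  ∎

  -- Induction on t, comparing `∇` of both sides: a further entry contributes one more `Δ`, which
  -- commutes with `∇`, and the difference of `rising (suc t)` contributes the next factor of the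
  -- factorial.
  #tuples-Δ^ : ∀ t r → ι (t !) ℚ.* #tuples (suc t) r ≡ Δ^ (suc c) (suc t) (rising t) r
  #tuples-Δ^ zero r = trans (ℚₚ.*-identityˡ (#tuples 1 r)) (∇-injective (λ x →
    trans (∇-#tuples 0 x) (trans (Δ-cong (suc c) base x) (sym (∇-Δ (suc c) (rising 0) x)))) r)
    where
    -- The empty tuple has sum 0, and the indicator of 0 is the difference of the constant 1.
    base : #tuples 0 ≗ ∇ (rising 0)
    base zero    = refl
    base (suc x) = refl
  #tuples-Δ^ (suc t) = ∇-injective (λ x → begin
    ∇ (λ r → ι (suc t !) ℚ.* #tuples (suc (suc t)) r) x
      ≡⟨ ∇-* (ι (suc t !)) (#tuples (suc (suc t))) x ⟩
    ι (suc t !) ℚ.* ∇ (#tuples (suc (suc t))) x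
      ≡⟨ cong₂ ℚ._*_ (ι-* (suc t) (t !)) (∇-#tuples (suc t) x) ⟩
    (ι (suc t) ℚ.* ι (t !)) ℚ.* Δ (suc c) (#tuples (suc t)) x
      ≡⟨ ℚₚ.*-assoc (ι (suc t)) (ι (t !)) (Δ (suc c) (#tuples (suc t)) x) ⟩
    ι (suc t) ℚ.* (ι (t !) ℚ.* Δ (suc c) (#tuples (suc t)) x)
     
      ≡⟨ cong (ι (suc t) ℚ.*_) (trans (sym (Δ-* (suc c) (ι (t !)) (#tuples (suc t)) x))
          (Δ-cong (suc c) (#tuples-Δ^ t) x)) ⟩
    ι (suc t) ℚ.* Δ^ (suc c) (suc (suc t)) (rising t) x
      ≡⟨ Δ^-* (suc c) (suc (suc t)) (ι (suc t)) (rising t) x ⟨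
    Δ^ (suc c) (suc (suc t)) (λ r → ι (suc t) ℚ.* rising t r) x
      ≡⟨ Δ^-cong (suc c) (suc (suc t)) (∇-rising t) x ⟨
    Δ^ (suc c) (suc (suc t)) (∇ (rising (suc t))) x
      ≡⟨ ∇-Δ^ (suc c) (suc (suc t)) (rising (suc t)) x ⟨
    ∇ (Δ^ (suc c) (suc (suc t)) (rising (suc t))) x             ∎)
    where open ≡-Reasoning

  -- The product needs at least one factor: when r < j * suc c, the shifted sequence is zero, and it
  -- is the truncated factor with i = 0 that records this.
  #tuples-formula : ∀ t J r → 1 < t → t ≤ J →
    ι ((t ∸ 1) !) ℚ.* #tuples t r ≡
    Σℚ J (λ j → signed t j ℚ.* Πℚ (t ∸ 1) (λ i → ι (r + suc i ∸ j * suc c)))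
  #tuples-formula (suc (suc u)) J r (s≤s (s≤s _)) t≤J = trans (#tuples-Δ^ (suc u) r)
    (trans (Δ^-expand (suc c) (suc (suc u)) J (rising (suc u)) r t≤J)
      (Σℚ-cong J λ j → cong (signed (suc (suc u)) j ℚ.*_) (shift-rising u (j * suc c) r)))

-- Convergence

infix 4 _⇝_

-- Convergence of rationals to a real, read off the representing sequence of
-- the limit at an independent index.
record _⇝_ (x : ℕ → ℚ) (L : ℝ) : Set where
  constructor converges
  field
    close : ∀ ε → 0ℚ ℚ.< ε → ∃ λ N → ∀ k m → N ≤ k → N ≤ m → ℚ.∣ x k ℚ.- seq L m ∣ ℚ.< ε

open _⇝_

≤-⊔ˡ : ∀ {M N k} → M ⊔ N ≤ k → M ≤ k
≤-⊔ˡ {M} {N} = ℕₚ.m⊔n≤o⇒m≤o M N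

≤-⊔ʳ : ∀ {M N k} → M ⊔ N ≤ k → N ≤ k
≤-⊔ʳ {M} {N} = ℕₚ.m⊔n≤o⇒n≤o M N

p≤∣p∣ : ∀ p → p ℚ.≤ ℚ.∣ p ∣
p≤∣p∣ p with ℚₚ.≤-total 0ℚ p
... | inj₁ 0≤p = ℚₚ.≤-reflexive (sym (ℚₚ.0≤p⇒∣p∣≡p 0≤p))
... | inj₂ p≤0 = ℚₚ.≤-trans p≤0 (ℚₚ.0≤∣p∣ p)

∣-∣<⁺ : ∀ {x y ε} → x ℚ.< y ℚ.+ ε → y ℚ.< x ℚ.+ ε → ℚ.∣ x ℚ.- y ∣ ℚ.< ε
∣-∣<⁺ {x} {y} {ε} x< y< with ℚₚ.∣p∣≡p∨∣p∣≡-p (x ℚ.- y)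
... | inj₁ eq = begin-strict
  ℚ.∣ x ℚ.- y ∣     ≡⟨ eq ⟩
  x ℚ.- y           <⟨ ℚₚ.+-monoˡ-< (ℚ.- y) x< ⟩
  y ℚ.+ ε ℚ.- y     ≡⟨ solve 2 (λ y e → y :+ e :- y := e) refl y ε ⟩
  ε                 ∎
  where
  open ℚₚ.≤-Reasoning
  open ℚ-Solver
... | inj₂ eq = begin-strict
  ℚ.∣ x ℚ.- y ∣     ≡⟨ eq ⟩
  ℚ.- (x ℚ.- y)     ≡⟨ solve 2 (λ x y → :- (x :- y) := y :- x) refl x y ⟩
  y ℚ.- x           <⟨ ℚₚ.+-monoˡ-< (ℚ.- x) y< ⟩
  x ℚ.+ ε ℚ.- x     ≡⟨ solve 2 (λ y e → y :+ e :- y := e) refl x ε ⟩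
  ε                 ∎
  where
  open ℚₚ.≤-Reasoning
  open ℚ-Solver

∣-∣<⁻ : ∀ {x y ε} → ℚ.∣ x ℚ.- y ∣ ℚ.< ε → x ℚ.< y ℚ.+ ε
∣-∣<⁻ {x} {y} {ε} lt = begin-strict
  x                       ≡⟨ solve 2 (λ x y → x := y :+ (x :- y)) refl x y ⟩
  y ℚ.+ (x ℚ.- y)         ≤⟨ ℚₚ.+-monoʳ-≤ y (p≤∣p∣ (x ℚ.- y)) ⟩
  y ℚ.+ ℚ.∣ x ℚ.- y ∣     <⟨ ℚₚ.+-monoʳ-< y lt ⟩
  y ℚ.+ ε                 ∎
  where
  open ℚₚ.≤-Reasoning
  open ℚ-Solver

∣-∣<⁻′ : ∀ {x y ε} → ℚ.∣ x ℚ.- y ∣ ℚ.< ε → y ℚ.< x ℚ.+ ε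
∣-∣<⁻′ {x} {y} {ε} lt = ∣-∣<⁻ {y} {x} (subst (ℚ._< ε) (∣-∣-sym x y) lt)

⇝-const : ∀ q → (λ _ → q) ⇝ fromℚ q
close (⇝-const q) ε 0<ε = 0 , λ _ _ _ _ → subst (ℚ._< ε) (sym (cong ℚ.∣_∣ (ℚₚ.+-inverseʳ q))) 0<ε

⇝-resp : ∀ {x y L M} → x ⇝ L → (∀ k → x k ≡ y k) → (∀ m → seq L m ≡ seq M m) → y ⇝ M
close (⇝-resp {x} {y} {L} {M} x⇝L x≗y L≗M) ε 0<ε = let N , p = close x⇝L ε 0<ε in
  N , λ k m N≤k N≤m → subst₂ (λ a b → ℚ.∣ a ℚ.- b ∣ ℚ.< ε) (x≗y k) (L≗M m) (p k m N≤k N≤m)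

⇝-+ : ∀ {x y L M} → x ⇝ L → y ⇝ M → (λ k → x k ℚ.+ y k) ⇝ L +ᴿ M
close (⇝-+ {x} {y} {L} {M} x⇝L y⇝M) ε 0<ε =
  let N₁ , p = close x⇝L _ (half>0 0<ε)
      N₂ , q = close y⇝M _ (half>0 0<ε)
  in N₁ ⊔ N₂ , λ k m ≤k ≤m → begin-strict
    ℚ.∣ (x k ℚ.+ y k) ℚ.- (seq L m ℚ.+ seq M m) ∣
      ≡⟨ cong ℚ.∣_∣ (solve 4 (λ x y z w → (x :+ y) :- (z :+ w) := (x :- z) :+ (y :- w)) refl
           (x k) (y k) (seq L m) (seq M m)) ⟩
    ℚ.∣ (x k ℚ.- seq L m) ℚ.+ (y k ℚ.- seq M m) ∣
      ≤⟨ ℚₚ.∣p+q∣≤∣p∣+∣q∣ (x k ℚ.- seq L m) (y k ℚ.- seq M m) ⟩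
    ℚ.∣ x k ℚ.- seq L m ∣ ℚ.+ ℚ.∣ y k ℚ.- seq M m ∣
      <⟨ ℚₚ.+-mono-< (p k m (≤-⊔ˡ ≤k) (≤-⊔ˡ ≤m)) (q k m (≤-⊔ʳ {N₁} ≤k) (≤-⊔ʳ {N₁} ≤m)) ⟩
    ½ ℚ.* ε ℚ.+ ½ ℚ.* ε   ≡⟨ half+half ε ⟩
    ε                     ∎
  where
  open ℚₚ.≤-Reasoning
  open ℚ-Solver

⇝-neg : ∀ {x L} → x ⇝ L → (λ k → ℚ.- x k) ⇝ -ᴿ L
close (⇝-neg {x} {L} x⇝L) ε 0<ε = let N , p = close x⇝L ε 0<ε in
  N , λ k m N≤k N≤m → subst (ℚ._< ε)
    (trans (sym (ℚₚ.∣-p∣≡∣p∣ (x k ℚ.- seq L m))) (cong ℚ.∣_∣ (ℚₚ.neg-distrib-+ (x k) (ℚ.- seq L m))))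
    (p k m N≤k N≤m)

⇝-* : ∀ {x y L M} → x ⇝ L → y ⇝ M → (λ k → x k ℚ.* y k) ⇝ L *ᴿ M
close (⇝-* {x} {y} {L} {M} x⇝L y⇝M) ε 0<ε =
  let B , 0<B , N₁ , ≤B = bounded (cauchy L)
      C , 0<C , N₂ , ≤C = bounded (cauchy M)
      N₃ , r            = close x⇝L 1ℚ (ℚₚ.positive⁻¹ 1ℚ)
      0<1+B             = ℚₚ.+-mono-< (ℚₚ.positive⁻¹ 1ℚ) 0<B
      -- Eventually 1 + B bounds x and C bounds M, so errors below γ in both factors change the
      -- product by less than (1 + B + C)γ = ε.
      γ , 0<γ , eq      = quotient (1ℚ ℚ.+ B ℚ.+ C) (ℚₚ.+-mono-< 0<1+B 0<C) ε 0<ε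
      N₄ , p            = close x⇝L γ 0<γ
      N₅ , q            = close y⇝M γ 0<γ
  in (N₁ ⊔ N₂) ⊔ (N₃ ⊔ (N₄ ⊔ N₅)) , λ k m ≤k ≤m →
    subst (ℚ.∣ x k ℚ.* y k ℚ.- seq L m ℚ.* seq M m ∣ ℚ.<_) eq
      (product-estimate 0<1+B 0<C (x k) (y k) (seq L m) (seq M m)
        (ℚₚ.≤-trans (∣x∣≤∣x-y∣+∣y∣ (x k) (seq L m))
          (ℚₚ.+-mono-≤ (ℚₚ.<⇒≤ (r k m (≤-⊔ˡ {N₃} (≤-⊔ʳ {N₁ ⊔ N₂} ≤k)) (≤-⊔ˡ {N₃} (≤-⊔ʳ {N₁ ⊔ N₂} ≤m))))
                       (≤B m (≤-⊔ˡ {N₁} (≤-⊔ˡ {N₁ ⊔ N₂} ≤m)))))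
        (≤C m (≤-⊔ʳ {N₁} (≤-⊔ˡ {N₁ ⊔ N₂} ≤m)))
        (p k m (≤-⊔ˡ {N₄} (≤-⊔ʳ {N₃} (≤-⊔ʳ {N₁ ⊔ N₂} ≤k))) (≤-⊔ˡ {N₄} (≤-⊔ʳ {N₃} (≤-⊔ʳ {N₁ ⊔ N₂} ≤m))))
        (q k m (≤-⊔ʳ {N₄} (≤-⊔ʳ {N₃} (≤-⊔ʳ {N₁ ⊔ N₂} ≤k))) (≤-⊔ʳ {N₄} (≤-⊔ʳ {N₃} (≤-⊔ʳ {N₁ ⊔ N₂} ≤m)))))

⇝-Π : ∀ n {F : ℕ → ℕ → ℚ} {L} → (∀ i → F i ⇝ L) → (λ k → Πℚ n (λ i → F i k)) ⇝ L ^ᴿ n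
⇝-Π zero        F⇝L = ⇝-const 1ℚ
⇝-Π (suc n) {F} {L} F⇝L = ⇝-* {F n} {λ k → Πℚ n (λ i → F i k)} {L} {L ^ᴿ n} (F⇝L n) (⇝-Π n {F} {L} F⇝L)

⇝-Σ : ∀ n {F : ℕ → ℕ → ℚ} {L : ℕ → ℝ} → (∀ j → j ≤ n → F j ⇝ L j) → (λ k → Σℚ n (λ j → F j k)) ⇝ Σ[ n ] L
⇝-Σ zero            F⇝L = F⇝L 0 z≤n
⇝-Σ (suc n) {F} {L} F⇝L = ⇝-+ {λ k → Σℚ n (λ j → F j k)} {F (suc n)} {Σ[ n ] L} {L (suc n)}
  (⇝-Σ n {F} {L} (λ j j≤n → F⇝L j (ℕₚ.m≤n⇒m≤1+n j≤n))) (F⇝L (suc n) ℕₚ.≤-refl)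

-- The counting formula runs at least up to t, the limit only up to the floor; the summands in
-- between disappear in the limit.
⇝-Σ-extend : ∀ e n {F : ℕ → ℕ → ℚ} {L : ℕ → ℝ} → (∀ j → j ≤ n → F j ⇝ L j) → (∀ j → n < j → F j ⇝ 0ᴿ) →
  (λ k → Σℚ (e + n) (λ j → F j k)) ⇝ Σ[ n ] L
⇝-Σ-extend zero    n {F} {L} F⇝L F⇝0 = ⇝-Σ n {F} {L} F⇝L
⇝-Σ-extend (suc e) n {F} {L} F⇝L F⇝0 =
  ⇝-resp (⇝-+ (⇝-Σ-extend e n {F} {L} F⇝L F⇝0) (F⇝0 (suc e + n) (s≤s (ℕₚ.m≤n+m n e))))
    (λ _ → refl) (λ m → ℚₚ.+-identityʳ (seq (Σ[ n ] L) m))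

⇝-squeeze : ∀ {x y z L} → x ⇝ L → z ⇝ L → (∀ k → x k ℚ.≤ y k) → (∀ k → y k ℚ.≤ z k) → y ⇝ L
close (⇝-squeeze {x} x⇝L z⇝L x≤y y≤z) ε 0<ε =
  let N₁ , p = close x⇝L ε 0<ε
      N₂ , q = close z⇝L ε 0<ε
  in N₁ ⊔ N₂ , λ k m ≤k ≤m → ∣-∣<⁺
    (ℚₚ.≤-<-trans (y≤z k) (∣-∣<⁻ (q k m (≤-⊔ʳ {N₁} ≤k) (≤-⊔ʳ {N₁} ≤m))))
    (ℚₚ.<-≤-trans (∣-∣<⁻′ {x k} (p k m (≤-⊔ˡ ≤k) (≤-⊔ˡ ≤m))) (ℚₚ.+-monoˡ-≤ ε (x≤y k)))

-- Limits of positive parts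

PositivePart : ℚ → ℚ → Set
PositivePart x y = (0ℚ ℚ.≤ x × y ≡ x) ⊎ (x ℚ.≤ 0ℚ × y ≡ 0ℚ)

module _ {x y : ℕ → ℚ} {L : ℝ} (x⁺≡y : ∀ k → PositivePart (x k) (y k)) (x⇝L : x ⇝ L) where

  -- Where x k is negative, 0 lies between x k and L up to a small error, so replacing x k by 0 does
  -- no harm. The sign of L is an assumption here and in the companion lemma because it cannot be
  -- decided.
  ⇝-positivePart : 0ᴿ ≤ᴿ L → y ⇝ L
  close (⇝-positivePart 0≤L) ε 0<ε =
    let N₁ , p = close x⇝L ε 0<ε
        N₂ , q = 0≤L _ (half>0 0<ε)
    in N₁ ⊔ N₂ , λ k m ≤k ≤m → estimate (x⁺≡y k) (p k m (≤-⊔ˡ ≤k) (≤-⊔ˡ ≤m)) (q m (≤-⊔ʳ {N₁} ≤m))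
    where
    estimate : ∀ {x y z} → PositivePart x y → ℚ.∣ x ℚ.- z ∣ ℚ.< ε → 0ℚ ℚ.≤ z ℚ.+ ½ ℚ.* ε → ℚ.∣ y ℚ.- z ∣ ℚ.< ε
    estimate         (inj₁ (_ , refl))   p 0≤z = p
    estimate {x} {z = z} (inj₂ (x≤0 , refl)) p 0≤z = ∣-∣<⁺
      (ℚₚ.≤-<-trans 0≤z (ℚₚ.+-monoʳ-< z
        (subst₂ ℚ._<_ (ℚₚ.+-identityʳ (½ ℚ.* ε)) (half+half ε) (ℚₚ.+-monoʳ-< (½ ℚ.* ε) (half>0 0<ε)))))
      (ℚₚ.<-≤-trans (∣-∣<⁻′ {x} p) (ℚₚ.+-monoˡ-≤ ε x≤0))

  ⇝-positivePart-0 : L ≤ᴿ 0ᴿ → y ⇝ 0ᴿ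
  close (⇝-positivePart-0 L≤0) ε 0<ε =
    let N₁ , p = close x⇝L _ (half>0 0<ε)
        N₂ , q = L≤0 _ (half>0 0<ε)
        N      = N₁ ⊔ N₂
    -- The new limit 0 is a constant sequence, so L may be read at the fixed index N.
    in N , λ k m ≤k ≤m → estimate (x⁺≡y k) (p k N (≤-⊔ˡ ≤k) (≤-⊔ˡ {N₁} ℕₚ.≤-refl)) (q N (≤-⊔ʳ {N₁} ℕₚ.≤-refl))
    where
    estimate : ∀ {x y z} → PositivePart x y → ℚ.∣ x ℚ.- z ∣ ℚ.< ½ ℚ.* ε →
      z ℚ.≤ 0ℚ ℚ.+ ½ ℚ.* ε → ℚ.∣ y ℚ.- 0ℚ ∣ ℚ.< ε
    estimate {x} {z = z} (inj₁ (0≤x , refl)) p z≤0 = ∣-∣<⁺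
      (begin-strict
        x                                <⟨ ∣-∣<⁻ {x} {z} p ⟩
        z ℚ.+ ½ ℚ.* ε                    ≤⟨ ℚₚ.+-monoˡ-≤ (½ ℚ.* ε) z≤0 ⟩
        0ℚ ℚ.+ ½ ℚ.* ε ℚ.+ ½ ℚ.* ε
          ≡⟨ trans (ℚₚ.+-assoc 0ℚ (½ ℚ.* ε) (½ ℚ.* ε)) (cong (0ℚ ℚ.+_) (half+half ε)) ⟩
        0ℚ ℚ.+ ε                         ∎)
      (ℚₚ.+-mono-≤-< 0≤x 0<ε)
      where
      open ℚₚ.≤-Reasoning
    estimate (inj₂ (_ , refl)) _ _ = 0<ε

-- For each k the hypothesis bounds the distance only from some index of L that depends on k. The
-- Cauchy property of L makes that index uniform, at the cost of the second half of ε.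
⟶⇒⇝ : ∀ {x L} → (λ k → fromℚ (x k)) ⟶ L → x ⇝ L
close (⟶⇒⇝ {x} {L} x⟶L) ε 0<ε =
  let N₁ , p = x⟶L (fromℚ (½ ℚ.* ε))
          (½ ℚ.* ε , half>0 0<ε , 0 , λ _ _ → ℚₚ.≤-reflexive (ℚₚ.+-identityˡ (½ ℚ.* ε)))
      N₂ , q = cauchy L _ (half>0 0<ε)
  in N₁ ⊔ N₂ , λ k m ≤k ≤m → estimate k m (p k (≤-⊔ˡ ≤k)) λ m′ N₂≤m′ → q m′ m N₂≤m′ (≤-⊔ʳ {N₁} ≤m)
  where
  open ℚₚ.≤-Reasoning
  open ℚ-Solver
  estimate : ∀ k m {N₂} → ∣ fromℚ (x k) -ᴿ L ∣ᴿ <ᴿ fromℚ (½ ℚ.* ε) →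
    (∀ m′ → N₂ ≤ m′ → ℚ.∣ seq L m′ ℚ.- seq L m ∣ ℚ.< ½ ℚ.* ε) → ℚ.∣ x k ℚ.- seq L m ∣ ℚ.< ε
  estimate k m {N₂} (δ , 0<δ , N , p) q = begin-strict
    ℚ.∣ x k ℚ.- l ∣
      ≡⟨ cong ℚ.∣_∣ (solve 3 (λ x l l′ → x :- l := (x :- l′) :+ (l′ :- l)) refl (x k) l l′) ⟩
    ℚ.∣ (x k ℚ.- l′) ℚ.+ (l′ ℚ.- l) ∣               ≤⟨ ℚₚ.∣p+q∣≤∣p∣+∣q∣ (x k ℚ.- l′) (l′ ℚ.- l) ⟩
    ℚ.∣ x k ℚ.- l′ ∣ ℚ.+ ℚ.∣ l′ ℚ.- l ∣
     
      <⟨ ℚₚ.+-mono-< (ℚₚ.<-≤-trans (subst (ℚ._< ℚ.∣ x k ℚ.- l′ ∣ ℚ.+ δ)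
           (ℚₚ.+-identityʳ ℚ.∣ x k ℚ.- l′ ∣) (ℚₚ.+-monoʳ-< ℚ.∣ x k ℚ.- l′ ∣ 0<δ))
           (p (N ⊔ N₂) (ℕₚ.m≤m⊔n N N₂))) (q (N ⊔ N₂) (ℕₚ.m≤n⊔m N N₂)) ⟩
    ½ ℚ.* ε ℚ.+ ½ ℚ.* ε                             ≡⟨ half+half ε ⟩
    ε                                               ∎
    where
    l  = seq L m
    l′ = seq L (N ⊔ N₂)

-- One half of ε bounds the distance, the other half is the gap demanded by `<ᴿ`.
⇝⇒⟶ : ∀ {x L} → x ⇝ L → (λ k → fromℚ (x k)) ⟶ L
⇝⇒⟶ {x} {L} x⇝L δ (ε , 0<ε , M , ε≤δ) =
  let N , p = close x⇝L _ (half>0 0<ε)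
  in N , λ k N≤k → ½ ℚ.* ε , half>0 0<ε , M ⊔ N , λ m ≤m → begin
    ℚ.∣ x k ℚ.- seq L m ∣ ℚ.+ ½ ℚ.* ε    ≤⟨ ℚₚ.+-monoˡ-≤ (½ ℚ.* ε) (ℚₚ.<⇒≤ (p k m N≤k (≤-⊔ʳ {M} ≤m))) ⟩
    ½ ℚ.* ε ℚ.+ ½ ℚ.* ε                  ≡⟨ half+half ε ⟩
    ε                                    ≡⟨ ℚₚ.+-identityˡ ε ⟨
    0ℚ ℚ.+ ε                             ≤⟨ ε≤δ m (≤-⊔ˡ ≤m) ⟩
    seq δ m                              ∎
  where open ℚₚ.≤-Reasoning

-- The limit of the core counts

inv : ∀ n .{{_ : NonZero n}} → ℚ
inv n = + 1 / n

inv-ι : ∀ n .{{_ : NonZero n}} → inv n ℚ.* ι n ≡ 1ℚ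
inv-ι n = /-*-cancel 1 n

/≡*inv : ∀ m n .{{_ : NonZero n}} → + m / n ≡ ι m ℚ.* inv n
/≡*inv m n = begin
  + m / n                              ≡⟨ ℚₚ.*-identityʳ (+ m / n) ⟨
  (+ m / n) ℚ.* 1ℚ                     ≡⟨ cong ((+ m / n) ℚ.*_) (inv-ι n) ⟨
  (+ m / n) ℚ.* (inv n ℚ.* ι n)
    ≡⟨ solve 3 (λ a b c → a :* (b :* c) := a :* c :* b) refl (+ m / n) (inv n) (ι n) ⟩
  (+ m / n) ℚ.* ι n ℚ.* inv n          ≡⟨ cong (ℚ._* inv n) (/-*-cancel m n) ⟩
  ι m ℚ.* inv n                        ∎
  where
  open ≡-Reasoning
  open ℚ-Solver

ι-nonNeg : ∀ n → ℚ.NonNegative (ι n)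
ι-nonNeg n = ℚ.nonNegative (ι-mono-≤ {0} {n} z≤n)

inv>0 : ∀ n .{{_ : NonZero n}} → 0ℚ ℚ.< inv n
inv>0 n = ℚₚ.positive⁻¹ (inv n) {{ℚₚ.normalize-pos 1 n}}

inv-nonNeg : ∀ n .{{_ : NonZero n}} → ℚ.NonNegative (inv n)
inv-nonNeg n = ℚ.nonNegative (ℚₚ.<⇒≤ (inv>0 n))

^ℚ-* : ∀ n x y → (x ℚ.* y) ^ℚ n ≡ x ^ℚ n ℚ.* y ^ℚ n
^ℚ-* zero    x y = refl
^ℚ-* (suc n) x y rewrite ^ℚ-* n x y =
  solve 4 (λ x y p q → x :* y :* (p :* q) := x :* p :* (y :* q)) refl x y (x ^ℚ n) (y ^ℚ n)
  where open ℚ-Solver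

ι-^ : ∀ m n → ι (m ^ n) ≡ ι m ^ℚ n
ι-^ m zero    = refl
ι-^ m (suc n) = trans (ι-* m (m ^ n)) (cong (ι m ℚ.*_) (ι-^ m n))

1^ℚ : ∀ n → 1ℚ ^ℚ n ≡ 1ℚ
1^ℚ zero    = refl
1^ℚ (suc n) = trans (ℚₚ.*-identityˡ _) (1^ℚ n)

inv-^ : ∀ m n .{{_ : NonZero m}} .{{_ : NonZero (m ^ n)}} → inv (m ^ n) ≡ inv m ^ℚ n
inv-^ m n = begin
  inv (m ^ n)                                         ≡⟨ ℚₚ.*-identityʳ _ ⟨
  inv (m ^ n) ℚ.* 1ℚ
    ≡⟨ cong (inv (m ^ n) ℚ.*_) (trans (cong (_^ℚ n) (inv-ι m)) (1^ℚ n)) ⟨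
  inv (m ^ n) ℚ.* (inv m ℚ.* ι m) ^ℚ n                ≡⟨ cong (inv (m ^ n) ℚ.*_) (^ℚ-* n (inv m) (ι m)) ⟩
  inv (m ^ n) ℚ.* (inv m ^ℚ n ℚ.* ι m ^ℚ n)
    ≡⟨ cong (λ z → inv (m ^ n) ℚ.* (inv m ^ℚ n ℚ.* z)) (ι-^ m n) ⟨
  inv (m ^ n) ℚ.* (inv m ^ℚ n ℚ.* ι (m ^ n))
    ≡⟨ solve 3 (λ a b c → a :* (b :* c) := a :* c :* b) refl (inv (m ^ n)) (inv m ^ℚ n) (ι (m ^ n)) ⟩
  inv (m ^ n) ℚ.* ι (m ^ n) ℚ.* inv m ^ℚ n            ≡⟨ cong (ℚ._* inv m ^ℚ n) (inv-ι (m ^ n)) ⟩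
  1ℚ ℚ.* inv m ^ℚ n                                   ≡⟨ ℚₚ.*-identityˡ _ ⟩
  inv m ^ℚ n                                          ∎
  where
  open ≡-Reasoning
  open ℚ-Solver

Πℚ-*ˡ : ∀ n c f → Πℚ n (λ i → c ℚ.* f i) ≡ c ^ℚ n ℚ.* Πℚ n f
Πℚ-*ˡ zero    c f = refl
Πℚ-*ˡ (suc n) c f rewrite Πℚ-*ˡ n c f =
  solve 4 (λ c x p q → c :* x :* (p :* q) := c :* p :* (x :* q)) refl c (f n) (c ^ℚ n) (Πℚ n f)
  where open ℚ-Solver

archimedean : ∀ ε → 0ℚ ℚ.< ε → ∃ λ M → ∀ n .{{_ : NonZero n}} → M ≤ n → inv n ℚ.< ε
-- The threshold is the denominator of ε plus one: beyond it ε * n exceeds the numerator of ε, which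
-- is at least 1.
archimedean ε@(ℚ.mkℚ +[1+ a ] b-1 _) 0<ε = suc (suc b-1) , λ n b<n →
  ℚₚ.*-cancelʳ-<-nonNeg (ι n) {{ι-nonNeg n}} (begin-strict
    inv n ℚ.* ι n                   ≡⟨ inv-ι n ⟩
    1ℚ                              ≤⟨ ι-mono-≤ {1} {suc a} (s≤s z≤n) ⟩
    ι (suc a)
      ≡⟨ trans (cong (ℚ._* ι (suc b-1)) (sym (ℚₚ.↥p/↧p≡p ε))) (/-*-cancel (suc a) (suc b-1)) ⟨
    ε ℚ.* ι (suc b-1)               <⟨ ℚₚ.*-monoʳ-<-pos ε {{ℚ.positive 0<ε}} (ι-mono-< b<n) ⟩
    ε ℚ.* ι n                       ∎)
  where
  open ℚₚ.≤-Reasoning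
  ι-mono-< : ∀ {m n} → m < n → ι m ℚ.< ι n
  ι-mono-< {m} m<n = ℚₚ.<-≤-trans
    (subst₂ ℚ._<_ (ℚₚ.+-identityˡ (ι m)) (sym (ι-+ 1 m)) (ℚₚ.+-monoˡ-< (ι m) (ℚₚ.positive⁻¹ 1ℚ)))
    (ι-mono-≤ m<n)
archimedean (ℚ.mkℚ (+ 0) _ _)        0<ε = contradiction (ℚ.positive 0<ε) λ ()
archimedean (ℚ.mkℚ ℤ.-[1+ _ ] _ _)   0<ε = contradiction (ℚ.positive 0<ε) λ ()

⟶∞⇒inv⇝0 : ∀ (r : ℕ → ℕ) .{{_ : ∀ {k} → NonZero (r k)}} → r ⟶∞ → (λ k → inv (r k)) ⇝ 0ᴿ
close (⟶∞⇒inv⇝0 r r⟶∞) ε 0<ε =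
  let M , p = archimedean ε 0<ε
      N , q = r⟶∞ M
  in N , λ k _ N≤k _ → ∣-∣<⁺
    (subst (inv (r k) ℚ.<_) (sym (ℚₚ.+-identityˡ ε)) (p (r k) (q k N≤k)))
    (ℚₚ.+-mono-< (inv>0 (r k)) 0<ε)

∸-positivePart : ∀ c (0≤c : 0ℚ ℚ.≤ c) m p → PositivePart (c ℚ.* (ι m ℚ.- ι p)) (c ℚ.* ι (m ∸ p))
∸-positivePart c 0≤c m p with ℕₚ.≤-total p m
... | inj₁ p≤m = inj₁ (subst (0ℚ ℚ.≤_) eq (subst (ℚ._≤ c ℚ.* ι (m ∸ p)) (ℚₚ.*-zeroʳ c)
                   (ℚₚ.*-monoˡ-≤-nonNeg c {{ℚ.nonNegative 0≤c}} (ι-mono-≤ {0} {m ∸ p} z≤n))) , eq)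
  where
  open ℚ-Solver
  eq : c ℚ.* ι (m ∸ p) ≡ c ℚ.* (ι m ℚ.- ι p)
  eq = cong (c ℚ.*_) (trans (solve 2 (λ x y → x := x :+ y :- y) refl (ι (m ∸ p)) (ι p))
    (cong (ℚ._- ι p) (trans (sym (ι-+ (m ∸ p) p)) (cong ι (ℕₚ.m∸n+n≡m p≤m)))))
... | inj₂ m≤p = inj₂ (
    subst (c ℚ.* (ι m ℚ.- ι p) ℚ.≤_) (ℚₚ.*-zeroʳ c) (ℚₚ.*-monoˡ-≤-nonNeg c {{ℚ.nonNegative 0≤c}}
      (subst (ι m ℚ.- ι p ℚ.≤_) (ℚₚ.+-inverseʳ (ι p)) (ℚₚ.+-monoˡ-≤ (ℚ.- ι p) (ι-mono-≤ m≤p))))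
  , trans (cong (λ z → c ℚ.* ι z) (ℕₚ.m≤n⇒m∸n≡0 m≤p)) (ℚₚ.*-zeroʳ c))

-- Signs read off from the floor

linear : ℕ → ℝ → ℕ → ℝ
linear t κ j = fromℕ t -ᴿ (1ᴿ +ᴿ κ) *ᴿ fromℕ j

module _ (t n : ℕ) (κ : ℝ) (w : 0ᴿ <ᴿ κ +ᴿ 1ᴿ) where

  private
    b = proj₁ w
    0<b = proj₁ (proj₂ w)
    M = proj₁ (proj₂ (proj₂ w))

    -- `v` is the reciprocal sequence inside the division `/ᴿ`. From index M on, y is at least b, so
    -- the cut-off is inactive and v m is the inverse of y m.
    v y : ℕ → ℚ
    v m = 1/max 0<b (seq (κ +ᴿ 1ᴿ) m)
    y m = seq (κ +ᴿ 1ᴿ) m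

    b≤y : ∀ m → M ≤ m → b ℚ.≤ y m
    b≤y m M≤m = subst (ℚ._≤ y m) (ℚₚ.+-identityˡ b) (proj₂ (proj₂ (proj₂ w)) m M≤m)

    y-nonNeg : ∀ m → M ≤ m → ℚ.NonNegative (y m)
    y-nonNeg m M≤m = ℚ.nonNegative (ℚₚ.≤-trans (ℚₚ.<⇒≤ 0<b) (b≤y m M≤m))

    vy : ∀ m → M ≤ m → v m ℚ.* y m ≡ 1ℚ
    vy m M≤m = subst (λ z → v m ℚ.* z ≡ 1ℚ) (ℚₚ.p≥q⇒p⊔q≡p (b≤y m M≤m)) (1/max-inverse 0<b (y m))

    tvy : ∀ m → M ≤ m → ι t ℚ.* v m ℚ.* y m ≡ ι t
    tvy m M≤m = trans (ℚₚ.*-assoc (ι t) (v m) (y m)) (trans (cong (ι t ℚ.*_) (vy m M≤m)) (ℚₚ.*-identityʳ (ι t)))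

    swap : ∀ j m → seq (linear t κ j) m ≡ ι t ℚ.- ι j ℚ.* y m
    swap j m = cong (λ z → ι t ℚ.- z)
      (trans (ℚₚ.*-comm (1ℚ ℚ.+ seq κ m) (ι j)) (cong (ι j ℚ.*_) (ℚₚ.+-comm 1ℚ (seq κ m))))

  linear-nonNeg : IsFloor (fromℕ t /ᴿ (κ +ᴿ 1ᴿ) [ w ]) n → ∀ j → j ≤ n → 0ᴿ ≤ᴿ linear t κ j
  linear-nonNeg (n≤ , _) j j≤n δ 0<δ =
    let B , 0<B , N₁ , ≤B = bounded (cauchy (κ +ᴿ 1ᴿ))
        -- The inequality n ≤ t/(κ+1) + γ gets multiplied by κ + 1 ≤ B, which turns the error γ into
        -- at most B * γ = δ.
        γ , 0<γ , eq      = quotient B 0<B δ 0<δ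
        N₂ , p            = n≤ γ 0<γ
    in M ⊔ (N₁ ⊔ N₂) , λ m ≤m → estimate m eq 0<γ (≤-⊔ˡ ≤m)
         (≤B m (≤-⊔ˡ {N₁} (≤-⊔ʳ {M} ≤m))) (p m (≤-⊔ʳ {N₁} (≤-⊔ʳ {M} ≤m)))
    where
    open ℚₚ.≤-Reasoning
    open ℚ-Solver
    estimate : ∀ m {B γ} → B ℚ.* γ ≡ δ → 0ℚ ℚ.< γ → M ≤ m → ℚ.∣ y m ∣ ℚ.≤ B → ι n ℚ.≤ ι t ℚ.* v m ℚ.+ γ →
      0ℚ ℚ.≤ seq (linear t κ j) m ℚ.+ δ
    estimate m {B} {γ} eq 0<γ M≤m y≤B p = begin
      0ℚ                                             ≡⟨ ℚₚ.+-inverseʳ (ι j ℚ.* y m) ⟨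
      ι j ℚ.* y m ℚ.- ι j ℚ.* y m                    ≤⟨ ℚₚ.+-monoˡ-≤ (ℚ.- (ι j ℚ.* y m)) (begin
        ι j ℚ.* y m
          ≤⟨ ℚₚ.*-monoʳ-≤-nonNeg (y m) {{y-nonNeg m M≤m}} (ℚₚ.≤-trans (ι-mono-≤ j≤n) p) ⟩
        (ι t ℚ.* v m ℚ.+ γ) ℚ.* y m                    ≡⟨ ℚₚ.*-distribʳ-+ (y m) (ι t ℚ.* v m) γ ⟩
        ι t ℚ.* v m ℚ.* y m ℚ.+ γ ℚ.* y m              ≡⟨ cong₂ ℚ._+_ (tvy m M≤m) (ℚₚ.*-comm γ (y m)) ⟩
        ι t ℚ.+ y m ℚ.* γ
          ≤⟨ ℚₚ.+-monoʳ-≤ (ι t)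
              (ℚₚ.*-monoʳ-≤-nonNeg γ {{ℚ.nonNegative (ℚₚ.<⇒≤ 0<γ)}} (ℚₚ.≤-trans (p≤∣p∣ (y m)) y≤B)) ⟩
        ι t ℚ.+ B ℚ.* γ                                ≡⟨ cong (ι t ℚ.+_) eq ⟩
        ι t ℚ.+ δ                                      ∎) ⟩
      ι t ℚ.+ δ ℚ.- ι j ℚ.* y m
        ≡⟨ solve 3 (λ a b c → a :+ b :- c := a :- c :+ b) refl (ι t) δ (ι j ℚ.* y m) ⟩
      ι t ℚ.- ι j ℚ.* y m ℚ.+ δ                      ≡⟨ cong (ℚ._+ δ) (swap j m) ⟨
      seq (linear t κ j) m ℚ.+ δ                     ∎

  linear-nonPos : IsFloor (fromℕ t /ᴿ (κ +ᴿ 1ᴿ) [ w ]) n → ∀ j → n < j → linear t κ j ≤ᴿ 0ᴿ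
  linear-nonPos (_ , δ , 0<δ , N , p) j n<j γ 0<γ = M ⊔ N , λ m ≤m → begin
    seq (linear t κ j) m            ≡⟨ swap j m ⟩
    ι t ℚ.- ι j ℚ.* y m             ≤⟨ ℚₚ.+-monoˡ-≤ (ℚ.- (ι j ℚ.* y m)) (begin
      ι t                             ≡⟨ tvy m (≤-⊔ˡ ≤m) ⟨
      ι t ℚ.* v m ℚ.* y m             ≤⟨ ℚₚ.*-monoʳ-≤-nonNeg (y m) {{y-nonNeg m (≤-⊔ˡ ≤m)}} (begin
        ι t ℚ.* v m                     ≡⟨ ℚₚ.+-identityʳ _ ⟨
        ι t ℚ.* v m ℚ.+ 0ℚ              ≤⟨ ℚₚ.+-monoʳ-≤ (ι t ℚ.* v m) (ℚₚ.<⇒≤ 0<δ) ⟩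
        ι t ℚ.* v m ℚ.+ δ               ≤⟨ p m (≤-⊔ʳ {M} ≤m) ⟩
        ι (suc n)                       ≤⟨ ι-mono-≤ n<j ⟩
        ι j                             ∎) ⟩
      ι j ℚ.* y m                     ∎) ⟩
    ι j ℚ.* y m ℚ.- ι j ℚ.* y m     ≡⟨ ℚₚ.+-inverseʳ (ι j ℚ.* y m) ⟩
    0ℚ                              ≤⟨ ℚₚ.<⇒≤ 0<γ ⟩
    γ                               ≡⟨ ℚₚ.+-identityˡ γ ⟨
    0ℚ ℚ.+ γ                        ∎
    where open ℚₚ.≤-Reasoning

seq-sign : ∀ j m → (ℚ.- 1ℚ) ^ℚ j ≡ seq ((-ᴿ 1ᴿ) ^ᴿ j) m
seq-sign zero    m = refl
seq-sign (suc j) m = cong ((ℚ.- 1ℚ) ℚ.*_) (seq-sign j m)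

density-lower : ∀ d .{{_ : NonZero d}} {m p} → m ≤ p → ι m ℚ.* inv d ℚ.≤ + p / d
density-lower d {m} {p} m≤p = subst (λ z → ι m ℚ.* inv d ℚ.≤ z) (sym (/≡*inv p d))
  (ℚₚ.*-monoʳ-≤-nonNeg (inv d) {{inv-nonNeg d}} (ι-mono-≤ m≤p))

density-upper : ∀ d .{{_ : NonZero d}} {m p} → p ≤ m → + p / d ℚ.≤ ι m ℚ.* inv d
density-upper d {m} {p} p≤m = subst (λ z → z ℚ.≤ ι m ℚ.* inv d) (sym (/≡*inv p d))
  (ℚₚ.*-monoʳ-≤-nonNeg (inv d) {{inv-nonNeg d}} (ι-mono-≤ p≤m))

-- The exponent must be positive, since `0ᴿ ^ᴿ 0` is 1; this is what lets the summands past the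
-- floor vanish.
seq-0^ : ∀ {t} → 1 < t → ∀ m → seq (0ᴿ ^ᴿ (t ∸ 1)) m ≡ 0ℚ
seq-0^ {suc (suc u)} (s≤s (s≤s _)) m = ℚₚ.*-zeroˡ (seq (0ᴿ ^ᴿ u) m)

module Asymptotics (t : ℕ) .{{_ : NonTrivial t}} (n : ℕ) (κ : ℝ) (1≤κ : 1ᴿ ≤ᴿ κ)
  (floor : IsFloor (fromℕ t /ᴿ (κ +ᴿ 1ᴿ) [ 0<κ+1 κ 1≤κ ]) n)
  (r s : ℕ → ℕ) .{{r≢0 : ∀ {k} → NonZero (r k)}} (r⟶∞ : r ⟶∞)
  (s/r⇝κ : (λ k → + s k / r k) ⇝ κ) where

  1<t : 1 < t
  1<t = ℕ.nonTrivial⇒n>1 t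

  ρ : ℕ → ℚ
  ρ k = inv (r k)

  ρ⇝0 : ρ ⇝ 0ᴿ
  ρ⇝0 = ⟶∞⇒inv⇝0 r r⟶∞

  ι-r*ρ : ∀ k → ι (r k) ℚ.* ρ k ≡ 1ℚ
  ι-r*ρ k = trans (ℚₚ.*-comm (ι (r k)) (ρ k)) (inv-ι (r k))

  instance
    _ = (t ∸ 1) !≢0
    t≢0 : NonZero t
    t≢0 = nonTrivial⇒nonZero t
    t^≢0 : NonZero (t ^ (t ∸ 1))
    t^≢0 = m^n≢0 t (t ∸ 1)
    r^≢0 : ∀ {k} → NonZero (r k ^ (t ∸ 1))
    r^≢0 {k} = m^n≢0 (r k) (t ∸ 1)

  -- Both caps, q and q + 1, satisfy these bounds. A deviation of at most 2t from r + s is invisible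
  -- after division by r, so the two tuple counts have the same limit.
  module _ (c : ℕ → ℕ)
    (c-lower : ∀ k → r k + s k ≤ t * suc (c k))
    (c-upper : ∀ k → t * suc (c k) ≤ r k + s k + 2 * t) where

    spacing : (λ k → ι (t * suc (c k)) ℚ.* ρ k) ⇝ 1ᴿ +ᴿ κ
    spacing = ⇝-squeeze lower
      (⇝-resp (⇝-+ lower (⇝-* (⇝-const (ι (2 * t))) ρ⇝0))
        (λ k → sym (trans (cong (ℚ._* ρ k) (ι-+ (r k + s k) (2 * t)))
          (ℚₚ.*-distribʳ-+ (ρ k) (ι (r k + s k)) (ι (2 * t)))))
        (λ m → trans (cong (1ℚ ℚ.+ seq κ m ℚ.+_) (ℚₚ.*-zeroʳ (ι (2 * t)))) (ℚₚ.+-identityʳ (1ℚ ℚ.+ seq κ m))))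
      (λ k → ℚₚ.*-monoʳ-≤-nonNeg (ρ k) {{inv-nonNeg (r k)}} (ι-mono-≤ (c-lower k)))
      (λ k → ℚₚ.*-monoʳ-≤-nonNeg (ρ k) {{inv-nonNeg (r k)}} (ι-mono-≤ (c-upper k)))
      where
      lower : (λ k → ι (r k + s k) ℚ.* ρ k) ⇝ 1ᴿ +ᴿ κ
      lower = ⇝-resp (⇝-+ (⇝-const 1ℚ) s/r⇝κ)
        (λ k → sym (trans (cong (ℚ._* ρ k) (ι-+ (r k) (s k)))
          (trans (ℚₚ.*-distribʳ-+ (ρ k) (ι (r k)) (ι (s k)))
            (cong₂ ℚ._+_ (ι-r*ρ k) (sym (/≡*inv (s k) (r k)))))))
        (λ _ → refl)

    -- Scaling by t/r instead of 1/r gives the limit t - (1+κ)j in the very form it has in `A`; the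
    -- surplus t^(t-1) is divided out in `rescale`.
    untruncated factor : ℕ → ℕ → ℕ → ℚ
    untruncated j i k = (ι t ℚ.* ρ k) ℚ.* (ι (r k + suc i) ℚ.- ι (j * suc (c k)))
    factor j i k = (ι t ℚ.* ρ k) ℚ.* ι (r k + suc i ∸ j * suc (c k))

    untruncated⇝ : ∀ j i → untruncated j i ⇝ linear t κ j
    untruncated⇝ j i = ⇝-resp
      (⇝-+ (⇝-+ (⇝-const (ι t)) (⇝-* (⇝-const (ι t ℚ.* ι (suc i))) ρ⇝0))
           (⇝-neg (⇝-* spacing (⇝-const (ι j)))))
      (λ k → sym (expand k))
      (λ m → cong (ℚ._- (1ℚ ℚ.+ seq κ m) ℚ.* ι j)
        (trans (cong (ι t ℚ.+_) (ℚₚ.*-zeroʳ (ι t ℚ.* ι (suc i)))) (ℚₚ.+-identityʳ (ι t))))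
      where
      expanded : ℕ → ℚ
      expanded k = ι t ℚ.+ ι t ℚ.* ι (suc i) ℚ.* ρ k ℚ.- ι (t * suc (c k)) ℚ.* ρ k ℚ.* ι j
      expand : ∀ k → untruncated j i k ≡ expanded k
      expand k = begin
        (T ℚ.* ρ k) ℚ.* (ι (r k + suc i) ℚ.- ι (j * suc (c k)))
          ≡⟨ cong₂ (λ x y → (T ℚ.* ρ k) ℚ.* (x ℚ.- y)) (ι-+ (r k) (suc i)) (ι-* j (suc (c k))) ⟩
        (T ℚ.* ρ k) ℚ.* (ι (r k) ℚ.+ I ℚ.- ι j ℚ.* D)
         
          ≡⟨ solve 6 (λ T p R I j D → (T :* p) :* (R :+ I :- j :* D)
               := T :* (R :* p) :+ T :* I :* p :- (T :* D) :* p :* j) refl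
               T (ρ k) (ι (r k)) I (ι j) D ⟩
        T ℚ.* (ι (r k) ℚ.* ρ k) ℚ.+ T ℚ.* I ℚ.* ρ k ℚ.- (T ℚ.* D) ℚ.* ρ k ℚ.* ι j
          ≡⟨ cong₂ (λ x y → x ℚ.+ T ℚ.* I ℚ.* ρ k ℚ.- y ℚ.* ρ k ℚ.* ι j)
               (trans (cong (T ℚ.*_) (ι-r*ρ k)) (ℚₚ.*-identityʳ T)) (sym (ι-* t (suc (c k)))) ⟩
        expanded k ∎
        where
        open ≡-Reasoning
        open ℚ-Solver
        T = ι t
        I = ι (suc i)
        D = ι (suc (c k))

    truncation : ∀ j i k → PositivePart (untruncated j i k) (factor j i k)
    truncation j i k = ∸-positivePart (ι t ℚ.* ρ k)
      (subst (ℚ._≤ ι t ℚ.* ρ k) (ℚₚ.*-zeroʳ (ι t))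
        (ℚₚ.*-monoˡ-≤-nonNeg (ι t) {{ι-nonNeg t}} (ℚₚ.<⇒≤ (inv>0 (r k)))))
      (r k + suc i) (j * suc (c k))

    factor⇝ : ∀ j → j ≤ n → ∀ i → factor j i ⇝ linear t κ j
    factor⇝ j j≤n i = ⇝-positivePart (truncation j i) (untruncated⇝ j i)
      (linear-nonNeg t n κ (0<κ+1 κ 1≤κ) floor j j≤n)

    factor⇝0 : ∀ j → n < j → ∀ i → factor j i ⇝ 0ᴿ
    factor⇝0 j n<j i = ⇝-positivePart-0 (truncation j i) (untruncated⇝ j i)
      (linear-nonPos t n κ (0<κ+1 κ 1≤κ) floor j n<j)

    coefficient : ℕ → ℝ
    coefficient j = (-ᴿ 1ᴿ) ^ᴿ j *ᴿ fromℕ (t C j)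

    coefficient⇝ : ∀ j → (λ _ → signed t j) ⇝ coefficient j
    coefficient⇝ j = ⇝-resp (⇝-const (signed t j)) (λ _ → refl) (λ m → cong (ℚ._* ι (t C j)) (seq-sign j m))

    term : ℕ → ℕ → ℚ
    term j k = signed t j ℚ.* Πℚ (t ∸ 1) (λ i → factor j i k)

    summand : ℕ → ℝ
    summand j = (-ᴿ 1ᴿ) ^ᴿ j *ᴿ fromℕ (t C j) *ᴿ (fromℕ t -ᴿ (1ᴿ +ᴿ κ) *ᴿ fromℕ j) ^ᴿ (t ∸ 1)

    term⇝ : ∀ j → j ≤ n → term j ⇝ summand j
    term⇝ j j≤n = ⇝-resp (⇝-* (coefficient⇝ j) (⇝-Π (t ∸ 1) (factor⇝ j j≤n))) (λ _ → refl) (λ _ → refl)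

    term⇝0 : ∀ j → n < j → term j ⇝ 0ᴿ
    term⇝0 j n<j = ⇝-resp (⇝-* (coefficient⇝ j) (⇝-Π (t ∸ 1) (factor⇝0 j n<j))) (λ _ → refl)
      (λ m → trans (cong (seq (coefficient j) m ℚ.*_) (seq-0^ 1<t m)) (ℚₚ.*-zeroʳ (seq (coefficient j) m)))

    -- The t - 1 factors together carry (t/r)^(t-1) and the counting formula carries (t-1)!; both
    -- cancel against the two inverses, leaving the tuple count over r^(t-1).
    rescale : ∀ k → Σℚ (t + n) (λ j → term j k) ℚ.* inv ((t ∸ 1) !) ℚ.* inv (t ^ (t ∸ 1)) ≡
      ι (length (tuples t (c k) (r k))) ℚ.* inv (r k ^ (t ∸ 1))
    rescale k = begin
      Σℚ (t + n) (λ j → term j k) ℚ.* inv F ℚ.* inv (t ^ (t ∸ 1))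
        ≡⟨ cong (λ z → z ℚ.* inv F ℚ.* inv (t ^ (t ∸ 1))) (begin
             Σℚ (t + n) (λ j → term j k)
               ≡⟨ Σℚ-cong (t + n) (λ j → trans (cong (signed t j ℚ.*_) (Πℚ-*ˡ (t ∸ 1) a (N j)))
                    (solve 3 (λ x y z → x :* (y :* z) := y :* (x :* z))
                      refl (signed t j) (a ^ℚ (t ∸ 1)) (Πℚ (t ∸ 1) (N j)))) ⟩
             Σℚ (t + n) (λ j → a ^ℚ (t ∸ 1) ℚ.* (signed t j ℚ.* Πℚ (t ∸ 1) (N j)))
               ≡⟨ Σℚ-*ˡ (t + n) (a ^ℚ (t ∸ 1)) (λ j → signed t j ℚ.* Πℚ (t ∸ 1) (N j)) ⟨
             a ^ℚ (t ∸ 1) ℚ.* Σℚ (t + n) (λ j → signed t j ℚ.* Πℚ (t ∸ 1) (N j))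
               ≡⟨ cong (a ^ℚ (t ∸ 1) ℚ.*_) (sym (#tuples-formula (c k) t (t + n) (r k) 1<t (ℕₚ.m≤m+n t n))) ⟩
             a ^ℚ (t ∸ 1) ℚ.* (ι F ℚ.* X)  ∎) ⟩
      a ^ℚ (t ∸ 1) ℚ.* (ι F ℚ.* X) ℚ.* inv F ℚ.* inv (t ^ (t ∸ 1))
        ≡⟨ cong (λ z → z ℚ.* (ι F ℚ.* X) ℚ.* inv F ℚ.* inv (t ^ (t ∸ 1))) (trans (^ℚ-* (t ∸ 1) (ι t) (ρ k))
             (cong₂ ℚ._*_ (sym (ι-^ t (t ∸ 1))) (sym (inv-^ (r k) (t ∸ 1))))) ⟩
      ι (t ^ (t ∸ 1)) ℚ.* inv (r k ^ (t ∸ 1)) ℚ.* (ι F ℚ.* X) ℚ.* inv F ℚ.* inv (t ^ (t ∸ 1))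
        ≡⟨ solve 6 (λ T R F X f τ → T :* R :* (F :* X) :* f :* τ := (f :* F) :* ((τ :* T) :* (X :* R))) refl
             (ι (t ^ (t ∸ 1))) (inv (r k ^ (t ∸ 1))) (ι F) X (inv F) (inv (t ^ (t ∸ 1))) ⟩
      (inv F ℚ.* ι F) ℚ.* ((inv (t ^ (t ∸ 1)) ℚ.* ι (t ^ (t ∸ 1))) ℚ.* (X ℚ.* inv (r k ^ (t ∸ 1))))
        ≡⟨ cong₂ (λ x y → x ℚ.* (y ℚ.* (X ℚ.* inv (r k ^ (t ∸ 1))))) (inv-ι F) (inv-ι (t ^ (t ∸ 1))) ⟩
      1ℚ ℚ.* (1ℚ ℚ.* (X ℚ.* inv (r k ^ (t ∸ 1))))
        ≡⟨ trans (ℚₚ.*-identityˡ _) (ℚₚ.*-identityˡ _) ⟩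
      X ℚ.* inv (r k ^ (t ∸ 1))  ∎
      where
      open ≡-Reasoning
      open ℚ-Solver
      F = (t ∸ 1) !
      a = ι t ℚ.* ρ k
      X = ι (length (tuples t (c k) (r k)))
      N : ℕ → ℕ → ℚ
      N j i = ι (r k + suc i ∸ j * suc (c k))

    S : ℕ → ℚ
    S k = Σℚ (t + n) (λ j → term j k)

    S⇝A : (λ k → S k ℚ.* inv ((t ∸ 1) !)) ⇝ A t n κ
    S⇝A = ⇝-resp (⇝-* (⇝-Σ-extend t n term⇝ term⇝0) (⇝-const (inv ((t ∸ 1) !)))) (λ _ → refl) A-seq
      where
      A-seq : ∀ m → seq (Σ[ n ] summand) m ℚ.* inv ((t ∸ 1) !) ≡ seq (A t n κ) m
      A-seq m = refl

    tuples⇝ : (λ k → ι (length (tuples t (c k) (r k))) ℚ.* inv (r k ^ (t ∸ 1))) ⇝ A t n κ /ℕ (t ^ (t ∸ 1))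
    tuples⇝ = ⇝-resp (⇝-* S⇝A (⇝-const (inv (t ^ (t ∸ 1))))) rescale (λ _ → refl)

  q : ℕ → ℕ
  q k = (r k + s k) ℕ÷./ t

  q-lower : ∀ k → r k + s k ≤ t * suc (q k)
  q-lower k = begin
    r k + s k                                    ≡⟨ ℕ÷.m≡m%n+[m/n]*n (r k + s k) t ⟩
    (r k + s k) ℕ÷.% t + q k * t                 ≤⟨ ℕₚ.+-monoˡ-≤ (q k * t) (ℕₚ.<⇒≤ (ℕ÷.m%n<n (r k + s k) t)) ⟩
    t + q k * t                                  ≡⟨ cong (t ℕ.+_) (ℕₚ.*-comm (q k) t) ⟩
    t + t * q k                                  ≡⟨ ℕₚ.*-suc t (q k) ⟨
    t * suc (q k)                                ∎
    where open ℕₚ.≤-Reasoning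

  q-upper : ∀ k → t * suc (suc (q k)) ≤ r k + s k + 2 * t
  q-upper k = begin
    t * suc (suc (q k))
      ≡⟨ solve 2 (λ t q → t :* (con 2 :+ q) := q :* t :+ con 2 :* t) refl t (q k) ⟩
    q k * t + 2 * t                ≤⟨ ℕₚ.+-monoˡ-≤ (2 * t) (ℕ÷.m/n*n≤m (r k + s k) t) ⟩
    r k + s k + 2 * t              ∎
    where
    open ℕₚ.≤-Reasoning
    open ℕ-Solver

  cores⇝ : (λ k → + P t (r k) (s k) / (r k ^ (t ∸ 1))) ⇝ A t n κ /ℕ (t ^ (t ∸ 1))
  cores⇝ = ⇝-squeeze
    (tuples⇝ q q-lower (λ k → ℕₚ.≤-trans (ℕₚ.*-monoʳ-≤ t (ℕₚ.n≤1+n (suc (q k)))) (q-upper k)))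
    (tuples⇝ (suc ∘ q) (λ k → ℕₚ.≤-trans (q-lower k) (ℕₚ.*-monoʳ-≤ t (ℕₚ.n≤1+n (suc (q k))))) q-upper)
    (λ k → density-lower (r k ^ (t ∸ 1)) (Abacus.P-lower t (r k) (s k)))
    (λ k → density-upper (r k ^ (t ∸ 1)) (Abacus.P-upper t (r k) (s k)))

theorem3p9 : (t : ℕ) .{{_ : NonTrivial t}}
    (κ : ℝ) (1≤κ : 1ᴿ ≤ᴿ κ)
    (n : ℕ) → IsFloor (fromℕ t /ᴿ (κ +ᴿ 1ᴿ) [ 0<κ+1 κ 1≤κ ]) n →
    (r s : ℕ → ℕ) .{{_ : ∀ {k} → NonZero (r k)}} .{{_ : ∀ {k} → NonZero (s k)}} →
    r ⟶∞ → s ⟶∞ →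
    (λ k → fromℚ (+ s k / r k)) ⟶ κ →
    (λ k → fromℚ ((+ P t (r k) (s k) / (r k ^ (t ∸ 1))) {{m^n≢0 (r k) (t ∸ 1)}}))
    ⟶ (A t n κ /ℕ (t ^ (t ∸ 1))) {{m^n≢0 t (t ∸ 1) {{nonTrivial⇒nonZero t}}}}
theorem3p9 t κ 1≤κ n floor r s r⟶∞ _ s/r⟶κ =
  ⇝⇒⟶ (Asymptotics.cores⇝ t n κ 1≤κ floor r s r⟶∞ (⟶⇒⇝ s/r⟶κ))
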